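{- Let $n$ be a positive integer, and let $\alpha=\nu_2(n)$ and $\beta=\nu_3(n)$. Let $r,s,t$ be positive integers. Then the following hold in $\mathbb{Z}[q]$. (1) $$\genfrac{[}{]}{0pt}{}{6n}{n}_q^{ -1}\sum_{k=-n}^{n}(-1)^kq^{\binom{k}{2}}\genfrac{[}{]}{0pt}{}{6n}{3n+k}_q^r\genfrac{[}{]}{0pt}{}{4n}{2n+k}_q^s\genfrac{[}{]}{0pt}{}{2n}{n+k}_q^t\equiv 0\pmod{[2]_{q^{2^\alpha}}}.$$ (2) $$\genfrac{[}{]}{0pt}{}{6n}{3n}_q^{ -1}\sum_{k=-n}^{n}(-1)^kq^{\binom{k}{2}}\genfrac{[}{]}{0pt}{}{6n}{3n+k}_q^r\genfrac{[}{]}{0pt}{}{4n}{2n+k}_q^s\genfrac{[}{]}{0pt}{}{2n}{n+k}_q^t\equiv 0\pmod{[2]_{q^{2^\alpha}}[3]_{q^{3^\beta}}}.$$ (3) Put $$Q(q)=\genfrac{[}{]}{0pt}{}{8n}{3n}_q^{ -1}\sum_{k=-n}^{n}(-1)^kq^{\binom{k}{2}}\genfrac{[}{]}{0pt}{}{8n}{4n+k}_q^r\genfrac{[}{]}{0pt}{}{4n}{2n+k}_q^s\genfrac{[}{]}{0pt}{}{2n}{n+k}_q^t.$$ Then: - if $t\geq 2$, then $Q(q)\equiv 0\pmod{[2]_{q^{2^\alpha}}}$; - if $s\geq 2$, or if $r\geq 2$ and $n\equiv 3\cdot 2^\alpha\pmod{2^{\alpha+2}}$, then $Q(q)\equiv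 0\pmod{[2]_{q^{2^{\alpha+1}}}}$; - if $r\geq 2$ and $n\equiv 2^\alpha\pmod{2^{\alpha+2}}$, then $Q(q)\equiv 0\pmod{[2]_{q^{2^{\alpha+2}}}}$.
   Context: For a prime $p$ and a nonzero integer $m$, $\nu_p(m)$ is the greatest integer such that $p^{\nu_p(m)}\mid m$. For a positive integer $m$, $[m]_q=\frac{1-q^m}{1-q}=1+q+\cdots+q^{m-1}$, and $[m]_{q^a}$ denotes the result of replacing $q$ by $q^a$ in it, e.g. $[2]_{q^a}=1+q^a$ and $[3]_{q^a}=1+q^a+q^{2a}$. The $q$-binomial coefficient is $\genfrac{[}{]}{0pt}{}{m}{k}_q=\prod_{j=1}^k\frac{1-q^{m+1-j}}{1-q^j}$ if $m\geq k\geq 1$, equal to $1$ if $k=0$, and equal to $0$ if $k<0$ or $k>m$; it is a polynomial in $\mathbb{Z}[q]$. Here $\binom{k}{2}=k(k-1)/2$ for every integer $k$ (including negative $k$). A congruence of the form $B(q)^{ -1}S(q)\equiv 0\pmod{M(q)}$ means that $S(q)=H(q)M(q)B(q)$ for some $H(q)\in\mathbb{Z}[q]$. -}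

module Defs where

open import Algebra.Bundles using (AbelianGroup; CommutativeRing)
import Algebra.Definitions.RawMagma as RawMagmaDefinitions
import Algebra.Properties.CommutativeSemigroup as CommutativeSemigroupProperties
import Algebra.Properties.Monoid.Sum as MonoidSum
import Algebra.Properties.Semiring.Exp as SemiringExp
import Algebra.Properties.Semiring.Sum as SemiringSum
open import Data.Bool.Base using (if_then_else_)
open import Data.Fin.Base using (toℕ; fromℕ; inject₁)
open import Data.Fin.Properties using (toℕ-fromℕ; toℕ-inject₁)
open import Data.Integer.Base as ℤ using (ℤ; +_; -[1+_]; 0ℤ; 1ℤ; ∣_∣)
import Data.Integer.DivMod as ℤ
import Data.Integer.Divisibility as ℤ
import Data.Integer.Properties as ℤ
open import Data.List.Base using (List; []; _∷_; map)
open import Data.Nat.Base as ℕ using (ℕ; zero; suc; _∸_; _≤_; _<_; s≤s)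
import Data.Nat.Divisibility as ℕ
import Data.Nat.Properties as ℕ
open import Data.Product.Base using (∃; _×_; _,_)
open import Level using (0ℓ)
open import Relation.Binary.Bundles using (Setoid)
open import Relation.Binary.PropositionalEquality as ≡ using (_≡_; cong; cong₂)
import Relation.Binary.Reasoning.Setoid as SetoidReasoning
open import Relation.Nullary.Decidable.Core using (does; yes; no)

-- The ring ℤ[q].  A polynomial is its list of coefficients, constant term
-- first; trailing zeros are allowed, so equality is coefficientwise.

Poly : Set
Poly = List ℤ

coeff : Poly → ℕ → ℤ
coeff []      _       = 0ℤ
coeff (a ∷ f) zero    = a
coeff (a ∷ f) (suc i) = coeff f i

infix 4 _≈_

record _≈_ (f g : Poly) : Set where
  constructor coeffs≡
  field
    coeff≡ : ∀ i → coeff f i ≡ coeff g i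

open _≈_ public

infixl 6 _+_
infixl 7 _*_ _·_
infix  8 -_

0# 1# q : Poly
0# = []
1# = 1ℤ ∷ []
q  = 0ℤ ∷ 1ℤ ∷ []

_+_ : Poly → Poly → Poly
[]      + g       = g
(a ∷ f) + []      = a ∷ f
(a ∷ f) + (b ∷ g) = (a ℤ.+ b) ∷ (f + g)

-_ : Poly → Poly
-_ = map (λ a → ℤ.- a)

_·_ : ℤ → Poly → Poly
a · f = map (a ℤ.*_) f

_*_ : Poly → Poly → Poly
[]      * g = []
(a ∷ f) * g = a · g + (0ℤ ∷ f * g)

coeff-+ : ∀ f g i → coeff (f + g) i ≡ coeff f i ℤ.+ coeff g i
coeff-+ []      g       i       = ≡.sym (ℤ.+-identityˡ _)
coeff-+ (a ∷ f) []      i       = ≡.sym (ℤ.+-identityʳ _)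
coeff-+ (a ∷ f) (b ∷ g) zero    = ≡.refl
coeff-+ (a ∷ f) (b ∷ g) (suc i) = coeff-+ f g i

coeff-neg : ∀ f i → coeff (- f) i ≡ ℤ.- coeff f i
coeff-neg []      i       = ≡.refl
coeff-neg (a ∷ f) zero    = ≡.refl
coeff-neg (a ∷ f) (suc i) = coeff-neg f i

coeff-· : ∀ a f i → coeff (a · f) i ≡ a ℤ.* coeff f i
coeff-· a []      i       = ≡.sym (ℤ.*-zeroʳ a)
coeff-· a (b ∷ f) zero    = ≡.refl
coeff-· a (b ∷ f) (suc i) = coeff-· a f i

≈-setoid : Setoid 0ℓ 0ℓ
≈-setoid = record
  { Carrier       = Poly
  ; _≈_           = _≈_
  ; isEquivalence = record
    { refl  = coeffs≡ λ _ → ≡.refl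
    ; sym   = λ p → coeffs≡ λ i → ≡.sym (coeff≡ p i)
    ; trans = λ p r → coeffs≡ λ i → ≡.trans (coeff≡ p i) (coeff≡ r i)
    }
  }

+-abelianGroup : AbelianGroup 0ℓ 0ℓ
+-abelianGroup = record
  { Carrier = Poly
  ; _≈_     = _≈_
  ; _∙_     = _+_
  ; ε       = 0#
  ; _⁻¹     = -_
  ; isAbelianGroup = record
    { isGroup = record
      { isMonoid = record
        { isSemigroup = record
          { isMagma = record
            { isEquivalence = isEquivalence
            ; ∙-cong = λ {f} {g} {h} {k} p r → coeffs≡ λ i →
                ≡.trans (coeff-+ f h i)
                  (≡.trans (cong₂ ℤ._+_ (coeff≡ p i) (coeff≡ r i))
                    (≡.sym (coeff-+ g k i)))
            }
          ; assoc = λ f g h → coeffs≡ λ i →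
              ≡.trans (coeff-+ (f + g) h i)
                (≡.trans (cong (ℤ._+ coeff h i) (coeff-+ f g i))
                  (≡.trans (ℤ.+-assoc (coeff f i) (coeff g i) (coeff h i))
                    (≡.sym (≡.trans (coeff-+ f (g + h) i)
                      (cong (λ x → coeff f i ℤ.+ x) (coeff-+ g h i))))))
          }
        ; identity = (λ f → refl) , identityʳ
        }
      ; inverse = (λ f → trans (+-commutes (- f) f) (inverseʳ f)) , inverseʳ
      ; ⁻¹-cong = λ {f} {g} p → coeffs≡ λ i →
          ≡.trans (coeff-neg f i)
            (≡.trans (cong (λ x → ℤ.- x) (coeff≡ p i)) (≡.sym (coeff-neg g i)))
      }
    ; comm = +-commutes
    }
  }
  where
  open Setoid ≈-setoid using (isEquivalence; refl; trans)
  identityʳ : ∀ f → f + 0# ≈ f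
  identityʳ []      = refl
  identityʳ (a ∷ f) = refl
  +-commutes : ∀ f g → f + g ≈ g + f
  +-commutes f g = coeffs≡ λ i →
    ≡.trans (coeff-+ f g i)
      (≡.trans (ℤ.+-comm (coeff f i) (coeff g i)) (≡.sym (coeff-+ g f i)))
  inverseʳ : ∀ f → f + - f ≈ 0#
  inverseʳ f = coeffs≡ λ i →
    ≡.trans (coeff-+ f (- f) i)
      (≡.trans (cong (λ x → coeff f i ℤ.+ x) (coeff-neg f i))
        (ℤ.+-inverseʳ (coeff f i)))

open Setoid ≈-setoid public
  using ()
  renaming (refl to ≈-refl; sym to ≈-sym; trans to ≈-trans)

private
  module + where
    open AbelianGroup +-abelianGroup public
    open CommutativeSemigroupProperties commutativeSemigroup public

∷-cong : ∀ {a b f g} → a ≡ b → f ≈ g → a ∷ f ≈ b ∷ g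
∷-cong a≡b f≈g = coeffs≡ λ where
  zero    → a≡b
  (suc i) → coeff≡ f≈g i

0∷-zero : ∀ {f} → f ≈ 0# → 0ℤ ∷ f ≈ 0#
0∷-zero f≈0 = coeffs≡ λ where
  zero    → ≡.refl
  (suc i) → coeff≡ f≈0 i

·-congˡ : ∀ a {f g} → f ≈ g → a · f ≈ a · g
·-congˡ a {f} {g} f≈g = coeffs≡ λ i →
  ≡.trans (coeff-· a f i)
    (≡.trans (cong (a ℤ.*_) (coeff≡ f≈g i)) (≡.sym (coeff-· a g i)))

·-distribˡ-+ : ∀ a f g → a · (f + g) ≈ a · f + a · g
·-distribˡ-+ a []      g       = ≈-refl
·-distribˡ-+ a (b ∷ f) []      = ≈-refl
·-distribˡ-+ a (b ∷ f) (c ∷ g) =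
  ∷-cong (ℤ.*-distribˡ-+ a b c) (·-distribˡ-+ a f g)

·-assoc : ∀ a b f → (a ℤ.* b) · f ≈ a · (b · f)
·-assoc a b []      = ≈-refl
·-assoc a b (c ∷ f) = ∷-cong (ℤ.*-assoc a b c) (·-assoc a b f)

1·-identity : ∀ f → 1ℤ · f ≈ f
1·-identity []      = ≈-refl
1·-identity (a ∷ f) = ∷-cong (ℤ.*-identityˡ a) (1·-identity f)

0·-zero : ∀ f → 0ℤ · f ≈ 0#
0·-zero []      = ≈-refl
0·-zero (a ∷ f) = 0∷-zero (0·-zero f)

module _ where
  open SetoidReasoning ≈-setoid

  *-zeroʳ : ∀ f → f * 0# ≈ 0#
  *-zeroʳ []      = ≈-refl
  *-zeroʳ (a ∷ f) = 0∷-zero (*-zeroʳ f)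

  *-congˡ : ∀ f {g h} → g ≈ h → f * g ≈ f * h
  *-congˡ []      g≈h = ≈-refl
  *-congˡ (a ∷ f) g≈h =
    +.∙-cong (·-congˡ a g≈h) (∷-cong ≡.refl (*-congˡ f g≈h))

  *-∷ : ∀ f b g → f * (b ∷ g) ≈ b · f + (0ℤ ∷ f * g)
  *-∷ []      b g = ≈-sym (0∷-zero ≈-refl)
  *-∷ (a ∷ f) b g = ∷-cong (cong (ℤ._+ 0ℤ) (ℤ.*-comm a b)) (begin
    a · g + f * (b ∷ g)              ≈⟨ +.∙-congˡ (*-∷ f b g) ⟩
    a · g + (b · f + (0ℤ ∷ f * g))  ≈⟨ +.x∙yz≈y∙xz (a · g) (b · f) _ ⟩
    b · f + (a · g + (0ℤ ∷ f * g))  ∎)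

  *-comm : ∀ f g → f * g ≈ g * f
  *-comm []      g = ≈-sym (*-zeroʳ g)
  *-comm (a ∷ f) g = begin
    a · g + (0ℤ ∷ f * g)  ≈⟨ +.∙-congˡ (∷-cong ≡.refl (*-comm f g)) ⟩
    a · g + (0ℤ ∷ g * f)  ≈⟨ *-∷ g a f ⟨
    g * (a ∷ f)           ∎

  *-cong : ∀ {f g h k} → f ≈ g → h ≈ k → f * h ≈ g * k
  *-cong {f} {g} {h} {k} f≈g h≈k = begin
    f * h  ≈⟨ *-congˡ f h≈k ⟩
    f * k  ≈⟨ *-comm f k ⟩
    k * f  ≈⟨ *-congˡ k f≈g ⟩
    k * g  ≈⟨ *-comm k g ⟩
    g * k  ∎

  *-distribˡ-+ : ∀ f g h → f * (g + h) ≈ f * g + f * h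
  *-distribˡ-+ []      g h = ≈-refl
  *-distribˡ-+ (a ∷ f) g h = begin
    a · (g + h) + (0ℤ ∷ f * (g + h))
      ≈⟨ +.∙-cong (·-distribˡ-+ a g h) (∷-cong ≡.refl (*-distribˡ-+ f g h)) ⟩
    (a · g + a · h) + ((0ℤ ∷ f * g) + (0ℤ ∷ f * h))
      ≈⟨ +.interchange (a · g) (a · h) (0ℤ ∷ f * g) (0ℤ ∷ f * h) ⟩
    (a ∷ f) * g + (a ∷ f) * h
      ∎

  *-distribʳ-+ : ∀ h f g → (f + g) * h ≈ f * h + g * h
  *-distribʳ-+ h f g = begin
    (f + g) * h    ≈⟨ *-comm (f + g) h ⟩
    h * (f + g)    ≈⟨ *-distribˡ-+ h f g ⟩
    h * f + h * g  ≈⟨ +.∙-cong (*-comm h f) (*-comm h g) ⟩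
    f * h + g * h  ∎

  ·-*-assoc : ∀ a f g → (a · f) * g ≈ a · (f * g)
  ·-*-assoc a []      g = ≈-refl
  ·-*-assoc a (b ∷ f) g = begin
    (a ℤ.* b) · g + (0ℤ ∷ (a · f) * g)
      ≈⟨ +.∙-cong (·-assoc a b g)
           (∷-cong (≡.sym (ℤ.*-zeroʳ a)) (·-*-assoc a f g)) ⟩
    a · (b · g) + a · (0ℤ ∷ f * g)
      ≈⟨ ·-distribˡ-+ a (b · g) (0ℤ ∷ f * g) ⟨
    a · ((b ∷ f) * g)
      ∎

  *-assoc : ∀ f g h → (f * g) * h ≈ f * (g * h)
  *-assoc []      g h = ≈-refl
  *-assoc (a ∷ f) g h = begin
    (a · g + (0ℤ ∷ f * g)) * h
      ≈⟨ *-distribʳ-+ h (a · g) (0ℤ ∷ f * g) ⟩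
    (a · g) * h + (0ℤ · h + (0ℤ ∷ (f * g) * h))
      ≈⟨ +.∙-cong (·-*-assoc a g h)
           (+.∙-cong (0·-zero h) (∷-cong ≡.refl (*-assoc f g h))) ⟩
    a · (g * h) + (0ℤ ∷ f * (g * h))
      ∎

  *-identityˡ : ∀ f → 1# * f ≈ f
  *-identityˡ f = begin
    1ℤ · f + (0ℤ ∷ [])  ≈⟨ +.∙-cong (1·-identity f) (0∷-zero ≈-refl) ⟩
    f + 0#              ≈⟨ +.identityʳ f ⟩
    f                   ∎

ℤ[q] : CommutativeRing 0ℓ 0ℓ
ℤ[q] = record
  { Carrier = Poly
  ; _≈_     = _≈_
  ; _+_     = _+_
  ; _*_     = _*_
  ; -_      = -_
  ; 0#      = 0#
  ; 1#      = 1#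
  ; isCommutativeRing = record
    { isRing = record
      { +-isAbelianGroup = +.isAbelianGroup
      ; *-cong           = *-cong
      ; *-assoc          = *-assoc
      ; *-identity       = *-identityˡ ,
                           λ f → ≈-trans (*-comm f 1#) (*-identityˡ f)
      ; distrib          = *-distribˡ-+ , *-distribʳ-+
      }
    ; *-comm = *-comm
    }
  }

open CommutativeRing ℤ[q] public using (_-_; *-rawMagma)
open RawMagmaDefinitions *-rawMagma public using (_∣_)
open RawMagmaDefinitions *-rawMagma using (_∣ʳ_; _,_)
open SemiringExp (CommutativeRing.semiring ℤ[q]) public using (_^_; ^-homo-*)
open SemiringSum (CommutativeRing.semiring ℤ[q]) public using (sum-syntax)
open MonoidSum (CommutativeRing.*-monoid ℤ[q]) public
  using () renaming (sum to product)

infixl 10 ∏-syntax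

∏-syntax : ℕ → (ℕ → Poly) → Poly
∏-syntax k f = product {k} (λ i → f (suc (toℕ i)))

syntax ∏-syntax k (λ j → x) = ∏[1≤ j ≤ k ] x

-- [ m ]⟨ x ⟩ is [m]_x, so that [m]_{qᵃ} is [ m ]⟨ q ^ a ⟩.

[_]⟨_⟩ : ℕ → Poly → Poly
[ m ]⟨ x ⟩ = ∑[ i < m ] (x ^ toℕ i)

-- For k ≤ m the q-binomial coefficient is numerator m k / denominator k, and
-- the subtraction is not truncated.  For k > m the factor j = m + 1 vanishes.

numerator : ℕ → ℕ → Poly
numerator m k = ∏[1≤ j ≤ k ] (1# - q ^ (m ℕ.+ 1 ∸ j))

denominator : ℕ → Poly
denominator k = ∏[1≤ j ≤ k ] (1# - q ^ j)

module _ where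
  open CommutativeRing ℤ[q]
    using (+-cong; +-congˡ; +-congʳ; *-congʳ; *-identityʳ;
           +-assoc; -‿inverseˡ; -‿inverseʳ; -‿cong; zeroˡ; zeroʳ;
           distribˡ; distribʳ; *-commutativeSemigroup; ring)
  open CommutativeSemigroupProperties *-commutativeSemigroup
    using (x∙yz≈y∙xz)
  open MonoidSum (CommutativeRing.*-monoid ℤ[q])
    using (sum-init-last; sum-cong-≗)
  open import Algebra.Properties.Ring ring using (-‿distribʳ-*)
  open SetoidReasoning ≈-setoid

  ∏-last : ∀ k (f : ℕ → Poly) →
    (∏[1≤ j ≤ suc k ] f j) ≈ (∏[1≤ j ≤ k ] f j) * f (suc k)
  ∏-last k f = begin
    (∏[1≤ j ≤ suc k ] f j)
      ≈⟨ sum-init-last {k} (λ i → f (suc (toℕ i))) ⟩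
    product {k} (λ i → f (suc (toℕ (inject₁ i)))) * f (suc (toℕ (fromℕ k)))
      ≡⟨ cong₂ _*_
           (sum-cong-≗ {k} λ i → cong (λ j → f (suc j)) (toℕ-inject₁ i))
           (cong (λ j → f (suc j)) (toℕ-fromℕ k)) ⟩
    (∏[1≤ j ≤ k ] f j) * f (suc k)
      ∎

  numerator-zero : ∀ {m k} → m < k → numerator m k ≈ 0#
  numerator-zero {zero}  {suc k} _         = begin
    (1# - 1#) * x  ≈⟨ *-congʳ {x} (-‿inverseʳ 1#) ⟩
    0# * x         ≈⟨ zeroˡ x ⟩
    0#             ∎
    where
    x = product {k} (λ i → 1# - q ^ (1 ∸ suc (suc (toℕ i))))
  numerator-zero {suc m} {suc k} (s≤s m<k) = begin
    x * numerator m k  ≈⟨ *-congˡ x (numerator-zero m<k) ⟩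
    x * 0#             ≈⟨ zeroʳ x ⟩
    0#                 ∎
    where
    x = 1# - q ^ (suc m ℕ.+ 1 ∸ 1)

  telescope : ∀ x y → (1# - x) + x * (1# - y) ≈ 1# - x * y
  telescope x y = begin
    (1# - x) + x * (1# - y)
      ≈⟨ +-congˡ {1# - x} (distribˡ x 1# (- y)) ⟩
    (1# - x) + (x * 1# + x * (- y))
      ≈⟨ +-congˡ {1# - x} (+-cong (*-identityʳ x) (≈-sym (-‿distribʳ-* x y))) ⟩
    (1# - x) + (x - x * y)
      ≈⟨ +-assoc 1# (- x) (x - x * y) ⟩
    1# + (- x + (x - x * y))
      ≈⟨ +-congˡ {1#} (+-assoc (- x) x (- (x * y))) ⟨
    1# + ((- x + x) - x * y)
      ≈⟨ +-congˡ {1#} (+-congʳ { - (x * y)} (-‿inverseˡ x)) ⟩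
    1# - x * y
      ∎

  numerator-pascal : ∀ m k →
    numerator m k * (1# - q ^ suc k) + q ^ suc k * numerator m (suc k) ≈
    numerator (suc m) (suc k)
  numerator-pascal m k with k ℕ.≤? m
  ... | yes k≤m = begin
    N * (1# - x) + x * numerator m (suc k)
      ≈⟨ +-congˡ (*-congˡ x (∏-last k (λ j → 1# - q ^ (m ℕ.+ 1 ∸ j)))) ⟩
    N * (1# - x) + x * (N * (1# - y))
      ≈⟨ +-congˡ (x∙yz≈y∙xz x N (1# - y)) ⟩
    N * (1# - x) + N * (x * (1# - y))
      ≈⟨ distribˡ N (1# - x) (x * (1# - y)) ⟨
    N * ((1# - x) + x * (1# - y))
      ≈⟨ *-congˡ N (telescope x y) ⟩
    N * (1# - x * y)
      ≈⟨ *-congˡ N (+-congˡ (-‿cong (^-homo-* q (suc k) (m ℕ.+ 1 ∸ suc k)))) ⟨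
    N * (1# - q ^ (suc k ℕ.+ (m ℕ.+ 1 ∸ suc k)))
      ≡⟨ cong (λ e → N * (1# - q ^ e)) (ℕ.m+[n∸m]≡n {suc k} k<m+1) ⟩
    N * (1# - q ^ (m ℕ.+ 1))
      ≈⟨ *-comm N (1# - q ^ (m ℕ.+ 1)) ⟩
    (1# - q ^ (m ℕ.+ 1)) * N
      ∎
    where
    N = numerator m k
    x = q ^ suc k
    y = q ^ (m ℕ.+ 1 ∸ suc k)
    k<m+1 : k < m ℕ.+ 1
    k<m+1 = ≡.subst (k <_) (ℕ.+-comm 1 m) (s≤s k≤m)
  ... | no k≰m = begin
    numerator m k * (1# - x) + x * numerator m (suc k)
      ≈⟨ +.∙-cong (*-congʳ (numerator-zero m<k))
           (*-congˡ x (numerator-zero (ℕ.m<n⇒m<1+n m<k))) ⟩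
    0# + x * 0#                ≈⟨ zeroʳ x ⟩
    0#                         ≈⟨ numerator-zero (s≤s m<k) ⟨
    numerator (suc m) (suc k)  ∎
    where
    x = q ^ suc k
    m<k = ℕ.≰⇒> k≰m

  denominator∣numerator : ∀ m k → denominator k ∣ numerator m k
  denominator∣numerator m       zero    = 1# , *-identityʳ 1#
  denominator∣numerator zero    (suc k) =
    0# , ≈-sym (numerator-zero (s≤s {n = k} ℕ.z≤n))
  denominator∣numerator (suc m) (suc k)
    with denominator∣numerator m k | denominator∣numerator m (suc k)
  ... | b , b*d≈n | b′ , b′*d′≈n′ = b + x * b′ , (begin
    (b + x * b′) * d′
      ≈⟨ distribʳ d′ b (x * b′) ⟩
    b * d′ + (x * b′) * d′
      ≈⟨ +.∙-cong (*-congˡ b (∏-last k (λ j → 1# - q ^ j))) (*-assoc x b′ d′) ⟩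
    b * (denominator k * (1# - x)) + x * (b′ * d′)
      ≈⟨ +.∙-cong
           (≈-trans (≈-sym (*-assoc b (denominator k) (1# - x))) (*-congʳ b*d≈n))
           (*-congˡ x b′*d′≈n′) ⟩
    numerator m k * (1# - x) + x * numerator m (suc k)
      ≈⟨ numerator-pascal m k ⟩
    numerator (suc m) (suc k)
      ∎)
    where
    x = q ^ suc k
    d′ = denominator (suc k)

-- The quotient b satisfies b * denominator k ≈ numerator m k.  It is unique up
-- to ≈, because ℤ[q] is an integral domain and denominator k ≉ 0#.

qBinomial : ℕ → ℤ → Poly
qBinomial m (+ zero)    = 1#
qBinomial m (+ (suc k)) =
  if does (suc k ℕ.≤? m)
  then _∣ʳ_.quotient (denominator∣numerator m (suc k))
  else 0#
qBinomial m -[1+ k ]    = 0#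

-- The integer k(k-1)/2 is nonnegative for every k, so ∣_∣ only changes its
-- type.

choose₂ : ℤ → ℕ
choose₂ k = ∣ (k ℤ.* (k ℤ.- 1ℤ)) ℤ./ (+ 2) ∣

-- The parity of k is that of ∣ k ∣.

sign : ℤ → Poly
sign k = (- 1#) ^ ∣ k ∣

infixl 10 ∑±-syntax

∑±-syntax : ℕ → (ℤ → Poly) → Poly
∑±-syntax n f = ∑[ i < suc (2 ℕ.* n) ] f (+ toℕ i ℤ.- + n)

syntax ∑±-syntax n (λ k → x) = ∑[ k ∈± n ] x

S₆ S₈ : (n r s t : ℕ) → Poly
S₆ n r s t = ∑[ k ∈± n ]
  ( sign k * q ^ choose₂ k
  * qBinomial (6 ℕ.* n) (+ (3 ℕ.* n) ℤ.+ k) ^ r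
  * qBinomial (4 ℕ.* n) (+ (2 ℕ.* n) ℤ.+ k) ^ s
  * qBinomial (2 ℕ.* n) (+ n ℤ.+ k) ^ t )
S₈ n r s t = ∑[ k ∈± n ]
  ( sign k * q ^ choose₂ k
  * qBinomial (8 ℕ.* n) (+ (4 ℕ.* n) ℤ.+ k) ^ r
  * qBinomial (4 ℕ.* n) (+ (2 ℕ.* n) ℤ.+ k) ^ s
  * qBinomial (2 ℕ.* n) (+ n ℤ.+ k) ^ t )

infix 4 _⁻¹*_≡0[mod_]

_⁻¹*_≡0[mod_] : Poly → Poly → Poly → Set
B ⁻¹* S ≡0[mod M ] = ∃ λ H → S ≈ H * M * B

infix 4 _≡_[mod_]

_≡_[mod_] : ℕ → ℕ → ℕ → Set
a ≡ b [mod m ] = + m ℤ.∣ (+ a ℤ.- + b)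

record IsValuation (p m v : ℕ) : Set where
  field
    divides  : p ℕ.^ v ℕ.∣ m
    greatest : ∀ w → p ℕ.^ w ℕ.∣ m → w ≤ v

{-# OPTIONS --safe #-}
module Submission where

-- Inside ℤ[q] one can split 1 - q^m = ∏ Φ_d (over d ∣ m) with pairwise coprime
-- factors, and the multiplicity of Φ_d in a q-binomial coefficient
-- [k + l over k] is the carry ⌊(k+l)/d⌋ - ⌊k/d⌋ - ⌊l/d⌋ ∈ {0, 1}.  So it
-- suffices to find the required power of Φ_d in the sum for each d separately.
--   * If n mod d is not too close to d, absence of carries in all three
--     q-binomial coefficients of a summand forces linear inequalities between
--     the ⌊jn/d⌋ that exclude a carry in the divisor; so every summand is
--     divisible by Φ_d when the divisor is.
--   * If n mod d = d - e with 6e ≤ d (for S₆) or 8e ≤ d (for S₈), the summands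
--     with k = ud + v and k = (-1 - u)d + v cancel modulo Φ_d.
--   * For the index d of the modulus one more factor is needed.  Either the
--     q-binomial coefficients supply it, or k is an odd multiple of d/2, and
--     then adding the summands of k and -k produces 1 + q^k.

open import Algebra.Bundles using (CommutativeRing)
import Algebra.Definitions.RawMagma as RawMagmaDefinitions
import Algebra.Properties.CommutativeSemigroup.Divisibility as CommutativeDivisibility
import Algebra.Properties.Ring as RingProperties
import Algebra.Properties.Semiring.Divisibility as SemiringDivisibility
import Algebra.Properties.Semiring.Exp as SemiringExp
import Algebra.Properties.Semiring.Mult as SemiringMult
import Algebra.Properties.Semiring.Sum as SemiringSum
import Algebra.Solver.Ring.NaturalCoefficients.Default as Solver
open import Data.Bool.Base using (if_then_else_)
open import Data.Empty using (⊥; ⊥-elim)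
open import Data.Fin.Base using (toℕ)
open import Data.Fin.Properties using (toℕ-fromℕ; toℕ-inject₁; toℕ<n)
open import Data.Integer.Base as ℤ using (ℤ; +_; -[1+_]; 0ℤ; 1ℤ)
import Data.Integer.DivMod as ℤ
import Data.Integer.Properties as ℤ
open import Data.List.Base using ([]; _∷_)
open import Data.Nat.Base as ℕ
  using (ℕ; zero; suc; z≤n; s≤s; _≤_; _<_; _∸_; _/_; _%_; ∣_-_∣; NonZero)
import Data.Nat.Divisibility as ℕ
import Data.Nat.DivMod as ℕ
import Data.Nat.GCD as ℕ
open import Data.Nat.Induction using (<-rec)
open import Data.Nat.Primality
  using (Prime; prime?; euclidsLemma; prime⇒nonZero; prime⇒nonTrivial)
import Data.Nat.Properties as ℕ
open import Data.Nat.Solver using (module +-*-Solver)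
open import Data.Product.Base using (∃; _×_; _,_; proj₁; proj₂)
open import Data.Sum.Base using (_⊎_; inj₁; inj₂; [_,_]′)
open import Data.Unit.Base using (tt)
open import Level using (Level; _⊔_)
open import Relation.Binary.PropositionalEquality as ≡ using (_≡_; _≢_)
import Relation.Binary.Reasoning.Setoid as SetoidReasoning
open import Relation.Nullary using (¬_; Dec; yes; no; does; contradiction)
open import Relation.Nullary.Decidable
  using (toWitness; dec-true; dec-false; ¬?; _→-dec_; _×-dec_)

-- Integer factors are the obstacle. A Bézout identity between two cyclotomic factors ends in a
-- positive integer rather than in 1, because ℤ[q] is not a principal ideal domain; and both ways of
-- pairing summands only reach twice the sum. Both kinds of integers are removed by the same
-- property, carried along with every factor x: if x divides a positive multiple of y, then x
-- divides y. It holds for 1 - q^m by comparison of coefficients and passes to divisors and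
-- products. The Φ_d are not given by a formula: Φ_d is what remains of 1 - q^d after division by
-- the Φ_e of all proper divisors e. The development is over an arbitrary commutative ring because
-- the cancellation modulo Φ_d is computed in the quotient ring, where q is a root of unity. The
-- conditions 6e ≤ d and 8e ≤ d are the complements of n/d having fractional part below 5/6 and 7/8.
-- In that range the floors of jn/d depend, up to multiples of the floor of n/d, on a single bounded
-- integer, and a finite check decides the inequalities.

-- Divisibility, cancellation and coprimality in a commutative ring

module Base {c ℓ : Level} (R : CommutativeRing c ℓ) where

  open CommutativeRing R public hiding (zero)
  open RingProperties ring public
    using (-‿involutive; -‿+-comm; -1*x≈-x; -0#≈0#; +-cancelˡ; x[y-z]≈xy-xz; [y-z]x≈yx-zx)
  open SemiringExp semiring public using (_^_; ^-homo-*; ^-assocʳ; ^-congˡ)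
  open SemiringMult semiring public
    using (×-comm-*; ×-assoc-*; ×-congʳ; ×1-homo-*) renaming (_×_ to _×ᵣ_)
  open SemiringDivisibility semiring public using (_∣0; ∣ʳ-refl; ∣ʳ-reflexive; ∣ʳ-trans; 0∣x⇒x≈0)
  open CommutativeDivisibility *-commutativeSemigroup public
    using (_∣_; _,_; x∣xy; x∣yx; ∣-respʳ-≈; ∣-respˡ-≈; x∣ʳy⇒x∣ʳzy; ∙-cong-∣; x∣y⇒zx∣zy)
  open Solver commutativeSemiring public using (solve; _:=_; _:+_; _:*_; con)
  open SetoidReasoning setoid public

  ∣x⇒∣x*y : ∀ {x y} z → x ∣ y → x ∣ y * z
  ∣x⇒∣x*y {x} {y} z x∣y = ∣-respʳ-≈ (*-comm z y) (x∣ʳy⇒x∣ʳzy z x∣y)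

  ∣x∣y⇒∣x+y : ∀ {d x y} → d ∣ x → d ∣ y → d ∣ x + y
  ∣x∣y⇒∣x+y {d} (u , ud≈x) (v , vd≈y) = u + v , trans (distribʳ d u v) (+-cong ud≈x vd≈y)

  1^ : ∀ m → 1# ^ m ≈ 1#
  1^ zero    = refl
  1^ (suc m) = trans (*-identityˡ _) (1^ m)

  x+[1-x]≈1 : ∀ x → x + (1# - x) ≈ 1#
  x+[1-x]≈1 x = begin
    x + (1# - x)    ≈⟨ +-comm x (1# - x) ⟩
    1# - x + x      ≈⟨ +-assoc 1# (- x) x ⟩
    1# + (- x + x)  ≈⟨ +-congˡ (-‿inverseˡ x) ⟩
    1# + 0#         ≈⟨ +-identityʳ 1# ⟩
    1#              ∎

  1-unique : ∀ {x y} → x + y ≈ 1# → y ≈ 1# - x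
  1-unique {x} {y} x+y≈1 = +-cancelˡ x _ _ (trans x+y≈1 (sym (x+[1-x]≈1 x)))

  1-xy≈1-x+x[1-y] : ∀ x y → 1# - x * y ≈ (1# - x) + x * (1# - y)
  1-xy≈1-x+x[1-y] x y = sym (1-unique (begin
    x * y + ((1# - x) + x * (1# - y))
      ≈⟨ solve 4 (λ x y x′ y′ → x :* y :+ (x′ :+ x :* y′) := x :* (y :+ y′) :+ x′) refl x y _ _ ⟩
    x * (y + (1# - y)) + (1# - x)
      ≈⟨ +-congʳ (trans (*-congˡ (x+[1-x]≈1 y)) (*-identityʳ x)) ⟩
    x + (1# - x)
      ≈⟨ x+[1-x]≈1 x ⟩
    1# ∎))

  -- x is a non-zero-divisor and R/(x) has no integer torsion.
  record Primitive (x : Carrier) : Set (c ⊔ ℓ) where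
    field
      cancel    : ∀ {y z} → x * y ≈ x * z → y ≈ z
      saturated : ∀ m {y} → x ∣ suc m ×ᵣ y → x ∣ y

  open Primitive public

  -- The hypothesis through which ℤ[q] enters the cyclotomic part; `1-q^-primitive` establishes it
  -- there.
  PowersPrimitive : Carrier → Set (c ⊔ ℓ)
  PowersPrimitive q = ∀ m → Primitive (1# - q ^ suc m)

  ∣-cancel : ∀ {x y} z → Primitive z → z * x ∣ z * y → x ∣ y
  ∣-cancel {x} {y} z pz (u , eq) = u , cancel pz (begin
    z * (u * x) ≈⟨ solve 3 (λ z u x → z :* (u :* x) := u :* (z :* x)) refl z u x ⟩
    u * (z * x) ≈⟨ eq ⟩
    z * y       ∎)

  -- Write `y = u x`. If `x` divides a multiple of `a`, then `y` divides the same multiple of `u a`,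
  -- hence `u a` itself, and `u` is cancelled again.
  primitive-∣ : ∀ {x y} → x ∣ y → Primitive y → Primitive x
  primitive-∣ {x} {y} (u , ux≈y) py = record
    { cancel = λ {a} {b} xa≈xb → cancel py (begin
        y * a        ≈⟨ *-congʳ ux≈y ⟨
        u * x * a    ≈⟨ *-assoc u x a ⟩
        u * (x * a)  ≈⟨ *-congˡ xa≈xb ⟩
        u * (x * b)  ≈⟨ *-assoc u x b ⟨
        u * x * b    ≈⟨ *-congʳ ux≈y ⟩
        y * b        ∎)
    ; saturated = λ where
        m {a} (v , vx≈ma) → cancel-u (saturated py m (v , (begin
          v * y            ≈⟨ *-congˡ ux≈y ⟨
          v * (u * x)      ≈⟨ solve 3 (λ v u x → v :* (u :* x) := u :* (v :* x)) refl v u x ⟩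
          u * (v * x)      ≈⟨ *-congˡ vx≈ma ⟩
          u * (suc m ×ᵣ a) ≈⟨ ×-comm-* (suc m) u a ⟩
          suc m ×ᵣ (u * a) ∎)))
    }
    where
    cancel-u : ∀ {a} → y ∣ u * a → x ∣ a
    cancel-u {a} (w , wy≈ua) = w , cancel py (begin
      y * (w * x) ≈⟨ solve 3 (λ y w x → y :* (w :* x) := x :* (w :* y)) refl y w x ⟩
      x * (w * y) ≈⟨ *-congˡ wy≈ua ⟩
      x * (u * a) ≈⟨ solve 3 (λ x u a → x :* (u :* a) := u :* x :* a) refl x u a ⟩
      u * x * a   ≈⟨ *-congʳ ux≈y ⟩
      y * a       ∎)

  primitive-* : ∀ {x y} → Primitive x → Primitive y → Primitive (x * y)
  primitive-* {x} {y} px py = record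
    { cancel = λ {a} {b} eq →
        cancel py (cancel px (trans (sym (*-assoc x y a)) (trans eq (*-assoc x y b))))
    ; saturated = λ where
        m {a} (u , eq) → lemma m (u , eq) (saturated px m (u * y , (begin
          u * y * x    ≈⟨ solve 3 (λ u y x → u :* y :* x := u :* (x :* y)) refl u y x ⟩
          u * (x * y)  ≈⟨ eq ⟩
          suc m ×ᵣ a   ∎)))
    }
    where
    lemma : ∀ m {a} → x * y ∣ suc m ×ᵣ a → x ∣ a → x * y ∣ a
    lemma m {a} (u , eq) (v , vx≈a) = ∣-respʳ-≈ (trans (*-comm x v) vx≈a)
      (x∣y⇒zx∣zy x (saturated py m (u , cancel px (begin
        x * (u * y)          ≈⟨ solve 3 (λ x u y → x :* (u :* y) := u :* (x :* y)) refl x u y ⟩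
        u * (x * y)          ≈⟨ eq ⟩
        suc m ×ᵣ a           ≈⟨ ×-congʳ (suc m) (trans (sym vx≈a) (*-comm v x)) ⟩
        suc m ×ᵣ (x * v)     ≈⟨ ×-comm-* (suc m) x v ⟨
        x * (suc m ×ᵣ v)     ∎))))

  primitive-1 : Primitive 1#
  primitive-1 = record
    { cancel    = λ {y} {z} eq → trans (sym (*-identityˡ y)) (trans eq (*-identityˡ z))
    ; saturated = λ _ {y} _ → y , *-identityʳ y
    }

  primitive-^ : ∀ {x} → Primitive x → ∀ m → Primitive (x ^ m)
  primitive-^ px zero    = primitive-1
  primitive-^ px (suc m) = primitive-* px (primitive-^ px m)

  -- Pairing summands controls only twice the sum; this removes the 2.
  primitive-half : ∀ {x y} → Primitive x → x ∣ y + y → x ∣ y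
  primitive-half {y = y} px x∣2y = saturated px 1 (∣-respʳ-≈ (+-congˡ (sym (+-identityʳ y))) x∣2y)

  -- Coprimality over the rationals, with denominators cleared.
  Coprime : Carrier → Carrier → Set (c ⊔ ℓ)
  Coprime x y = ∃ λ m → ∃ λ u → ∃ λ v → u * x + v * y ≈ suc m ×ᵣ 1#

  coprime-sym : ∀ {x y} → Coprime x y → Coprime y x
  coprime-sym (m , u , v , eq) = m , v , u , trans (+-comm _ _) eq

  coprime-1 : ∀ x → Coprime x 1#
  coprime-1 x = 0 , 0# , 1# , (begin
    0# * x + 1# * 1# ≈⟨ +-cong (zeroˡ x) (*-identityˡ 1#) ⟩
    0# + 1#          ≈⟨ +-comm 0# 1# ⟩
    1# + 0#          ∎)

  coprime-* : ∀ {x y z} → Coprime x y → Coprime x z → Coprime x (y * z)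
  coprime-* {x} {y} {z} (m , u , v , eq) (m′ , u′ , v′ , eq′) =
    -- The two Bézout identities are multiplied: `suc` of this number is the product of their
    -- constants, and the first coefficient collects every term that contains `x`.
    m′ ℕ.+ m ℕ.* suc m′ , u * (u′ * x + v′ * z) + v * y * u′ , v * v′ , (begin
      (u * (u′ * x + v′ * z) + v * y * u′) * x + v * v′ * (y * z)
        ≈⟨ solve 7 (λ x y z u v u′ v′ →
             (u :* (u′ :* x :+ v′ :* z) :+ v :* y :* u′) :* x :+ v :* v′ :* (y :* z)
             := (u :* x :+ v :* y) :* (u′ :* x :+ v′ :* z)) refl x y z u v u′ v′ ⟩
      (u * x + v * y) * (u′ * x + v′ * z)  ≈⟨ *-cong eq eq′ ⟩
      (suc m ×ᵣ 1#) * (suc m′ ×ᵣ 1#)       ≈⟨ ×1-homo-* (suc m) (suc m′) ⟨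
      (suc m ℕ.* suc m′) ×ᵣ 1#             ∎)

  coprime-^ : ∀ {x y} → Coprime x y → ∀ m → Coprime x (y ^ m)
  coprime-^ {x} xy zero    = coprime-1 x
  coprime-^ {x} xy (suc m) = coprime-* xy (coprime-^ xy m)

  coprime-∣ : ∀ {x y x′ y′} → x′ ∣ x → y′ ∣ y → Coprime x y → Coprime x′ y′
  coprime-∣ {x} {y} {x′} {y′} (a , ax′≈x) (b , by′≈y) (m , u , v , eq) =
    m , u * a , v * b , (begin
      u * a * x′ + v * b * y′     ≈⟨ +-cong (*-assoc u a x′) (*-assoc v b y′) ⟩
      u * (a * x′) + v * (b * y′) ≈⟨ +-cong (*-congˡ ax′≈x) (*-congˡ by′≈y) ⟩
      u * x + v * y               ≈⟨ eq ⟩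
      suc m ×ᵣ 1#                 ∎)

  -- The ideal generated by `x` and `z` contains `y`, and modulo `y` the element `z` is a positive
  -- integer. In use `y` is `1 - q^g` with `g` a gcd, and `z` is the quotient of `1 - q^d` by it.
  coprime-via : ∀ {x y z t} m → (∃ λ u → ∃ λ v → u * x + v * t ≈ y) → z * y ≈ t →
                (∃ λ w → z + w * y ≈ suc m ×ᵣ 1#) → Coprime x z
  coprime-via {x} {y} {z} {t} m (u , v , eq₁) zy≈t (w , eq₂) =
    m , w * u , 1# + w * (v * y) , (begin
      w * u * x + (1# + w * (v * y)) * z
        ≈⟨ solve 6 (λ w u v x y z → w :* u :* x :+ (con 1 :+ w :* (v :* y)) :* z :=
             z :+ w :* (u :* x :+ v :* (z :* y))) refl w u v x y z ⟩
      z + w * (u * x + v * (z * y))  ≈⟨ +-congˡ (*-congˡ (trans (+-congˡ (*-congˡ zy≈t)) eq₁)) ⟩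
      z + w * y                      ≈⟨ eq₂ ⟩
      suc m ×ᵣ 1#                    ∎)

  -- Euclid's lemma: the Bézout identity times `z` shows that `y` divides a positive multiple of
  -- `z`, and saturation removes the multiplier.
  coprime-factor : ∀ {x y z} → Primitive y → Coprime x y → y ∣ x * z → y ∣ z
  coprime-factor {x} {y} {z} py (m , u , v , eq) (w , wy≈xz) =
    saturated py m (u * w + v * z , (begin
      (u * w + v * z) * y
        ≈⟨ solve 5 (λ u v w y z → (u :* w :+ v :* z) :* y := u :* (w :* y) :+ v :* y :* z)
             refl u v w y z ⟩
      u * (w * y) + v * y * z      ≈⟨ +-congʳ (*-congˡ wy≈xz) ⟩
      u * (x * z) + v * y * z
        ≈⟨ solve 5 (λ u v x y z → u :* (x :* z) :+ v :* y :* z := (u :* x :+ v :* y) :* z)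
             refl u v x y z ⟩
      (u * x + v * y) * z          ≈⟨ *-congʳ eq ⟩
      (suc m ×ᵣ 1#) * z            ≈⟨ ×-assoc-* (suc m) 1# z ⟩
      suc m ×ᵣ (1# * z)            ≈⟨ ×-congʳ (suc m) (*-identityˡ z) ⟩
      suc m ×ᵣ z                   ∎))

  coprime-*-∣ : ∀ {x y z} → Primitive y → Coprime x y → x ∣ z → y ∣ z → x * y ∣ z
  coprime-*-∣ {x} {y} {z} py xy (w , wx≈z) y∣z = ∣-respʳ-≈ (trans (*-comm x w) wx≈z)
    (x∣y⇒zx∣zy x (coprime-factor py xy (∣-respʳ-≈ (trans (sym wx≈z) (*-comm w x)) y∣z)))

-- Products of powers of pairwise coprime factors

-- As 0/1 exponents these turn a product over divisors into a value of `factored`, so that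
-- divisibility becomes comparison of exponents.
⟦_∣_⟧ : ℕ → ℕ → ℕ
⟦ d ∣ m ⟧ = if does (d ℕ.∣? m) then 1 else 0

⟦∣⟧-yes : ∀ {d m} → d ℕ.∣ m → ⟦ d ∣ m ⟧ ≡ 1
⟦∣⟧-yes {d} {m} d∣m = ≡.cong (if_then 1 else 0) (dec-true (d ℕ.∣? m) d∣m)

⟦∣⟧-no : ∀ {d m} → ¬ d ℕ.∣ m → ⟦ d ∣ m ⟧ ≡ 0
⟦∣⟧-no {d} {m} d∤m = ≡.cong (if_then 1 else 0) (dec-false (d ℕ.∣? m) d∤m)

⟦_≡_⟧ : ℕ → ℕ → ℕ
⟦ d ≡ e ⟧ = if does (d ℕ.≟ e) then 1 else 0

⟦≡⟧-yes : ∀ d → ⟦ d ≡ d ⟧ ≡ 1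
⟦≡⟧-yes d = ≡.cong (if_then 1 else 0) (dec-true (d ℕ.≟ d) ≡.refl)

⟦≡⟧-no : ∀ {d e} → d ≢ e → ⟦ d ≡ e ⟧ ≡ 0
⟦≡⟧-no {d} {e} d≢e = ≡.cong (if_then 1 else 0) (dec-false (d ℕ.≟ e) d≢e)

⟦∣⟧-mono : ∀ d {m n} → m ℕ.∣ n → ⟦ d ∣ m ⟧ ≤ ⟦ d ∣ n ⟧
⟦∣⟧-mono d {m} {n} m∣n with d ℕ.∣? m
... | no  _   = z≤n
... | yes d∣m = ℕ.≤-reflexive (≡.sym (⟦∣⟧-yes (ℕ.∣-trans d∣m m∣n)))

module Products {c ℓ : Level} (R : CommutativeRing c ℓ) where

  open Base R

  -- ∏ over d < N of Φ d ^ f d; below, Φ d is the cyclotomic polynomial of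
  -- index d + 1.
  factored : (ℕ → Carrier) → ℕ → (ℕ → ℕ) → Carrier
  factored Φ zero    f = 1#
  factored Φ (suc N) f = factored Φ N f * Φ N ^ f N

  factored-cong : ∀ {Φ Ψ} N {f g} → (∀ {d} → d < N → Φ d ≡ Ψ d) →
                  (∀ {d} → d < N → f d ≡ g d) → factored Φ N f ≡ factored Ψ N g
  factored-cong zero    Φ≗Ψ f≗g = ≡.refl
  factored-cong (suc N) Φ≗Ψ f≗g = ≡.cong₂ _*_
    (factored-cong N (λ d<N → Φ≗Ψ (ℕ.m<n⇒m<1+n d<N)) (λ d<N → f≗g (ℕ.m<n⇒m<1+n d<N)))
    (≡.cong₂ _^_ (Φ≗Ψ (ℕ.n<1+n N)) (f≗g (ℕ.n<1+n N)))

  module _ (Φ : ℕ → Carrier) where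

    factored-+ : ∀ N f g → factored Φ N (λ d → f d ℕ.+ g d) ≈ factored Φ N f * factored Φ N g
    factored-+ zero    f g = sym (*-identityˡ 1#)
    factored-+ (suc N) f g = begin
      factored Φ N (λ d → f d ℕ.+ g d) * Φ N ^ (f N ℕ.+ g N)
        ≈⟨ *-cong (factored-+ N f g) (^-homo-* (Φ N) (f N) (g N)) ⟩
      factored Φ N f * factored Φ N g * (Φ N ^ f N * Φ N ^ g N)
        ≈⟨ solve 4 (λ a b c d → a :* b :* (c :* d) := a :* c :* (b :* d)) refl _ _ _ _ ⟩
      factored Φ N f * Φ N ^ f N * (factored Φ N g * Φ N ^ g N)
        ∎

    factored-∣ : ∀ N {f g} → (∀ {d} → d < N → f d ≤ g d) → factored Φ N f ∣ factored Φ N g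
    factored-∣ N {f} {g} f≤g = ∣-respʳ-≈
      (trans (sym (factored-+ N f (λ d → g d ∸ f d)))
        (reflexive (factored-cong N (λ _ → ≡.refl) (λ d<N → ℕ.m+[n∸m]≡n (f≤g d<N)))))
      (x∣xy _ _)

    factored-zero : ∀ N {f} → (∀ {d} → d < N → f d ≡ 0) → factored Φ N f ≈ 1#
    factored-zero zero        f≡0 = refl
    factored-zero (suc N) {f} f≡0 rewrite f≡0 (ℕ.n<1+n N) =
      trans (*-identityʳ _) (factored-zero N (λ d<N → f≡0 (ℕ.m<n⇒m<1+n d<N)))

    factored-single : ∀ {N e} → e < N → factored Φ N ⟦ e ≡_⟧ ≈ Φ e
    factored-single {suc N} {e} e<1+N with e ℕ.≟ N
    ... | yes ≡.refl = begin
      factored Φ e ⟦ e ≡_⟧ * Φ e ^ ⟦ e ≡ e ⟧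
        ≡⟨ ≡.cong (λ k → factored Φ e ⟦ e ≡_⟧ * Φ e ^ k) (⟦≡⟧-yes e) ⟩
      factored Φ e ⟦ e ≡_⟧ * (Φ e * 1#)
        ≈⟨ *-cong (factored-zero e (λ d<e → ⟦≡⟧-no (ℕ.>⇒≢ d<e))) (*-identityʳ (Φ e)) ⟩
      1# * Φ e   ≈⟨ *-identityˡ (Φ e) ⟩
      Φ e        ∎
    ... | no e≢N = trans
      (trans (reflexive (≡.cong (λ k → factored Φ N ⟦ e ≡_⟧ * Φ N ^ k) (⟦≡⟧-no e≢N))) (*-identityʳ _))
      (factored-single (ℕ.≤∧≢⇒< (ℕ.s≤s⁻¹ e<1+N) e≢N))

    ∣-factored : ∀ {N e} f → e < N → Φ e ^ f e ∣ factored Φ N f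
    ∣-factored {suc N} {e} f e<1+N with e ℕ.≟ N
    ... | yes ≡.refl = x∣yx _ _
    ... | no e≢N = ∣x⇒∣x*y _ (∣-factored f (ℕ.≤∧≢⇒< (ℕ.s≤s⁻¹ e<1+N) e≢N))

    factored-primitive : ∀ N f → (∀ {d} → d < N → Primitive (Φ d)) → Primitive (factored Φ N f)
    factored-primitive zero    f pΦ = primitive-1
    factored-primitive (suc N) f pΦ = primitive-*
      (factored-primitive N f (λ d<N → pΦ (ℕ.m<n⇒m<1+n d<N)))
      (primitive-^ (pΦ (ℕ.n<1+n N)) (f N))

    coprime-factored : ∀ N {x} f → (∀ {d} → d < N → Coprime x (Φ d)) → Coprime x (factored Φ N f)
    coprime-factored zero    f c = coprime-1 _
    coprime-factored (suc N) f c = coprime-*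
      (coprime-factored N f (λ d<N → c (ℕ.m<n⇒m<1+n d<N)))
      (coprime-^ (c (ℕ.n<1+n N)) (f N))

    -- Pairwise coprime factors have their product as least common multiple; this is what allows
    -- each Φ to be treated separately.
    factored-least : ∀ N {x} f → (∀ {d} → d < N → Primitive (Φ d)) →
                     (∀ {d e} → d < e → e < N → Coprime (Φ d) (Φ e)) →
                     (∀ {d} → d < N → Φ d ^ f d ∣ x) → factored Φ N f ∣ x
    factored-least zero    {x} f pΦ c Φ∣x = x , *-identityʳ x
    factored-least (suc N) {x} f pΦ c Φ∣x = coprime-*-∣
      (primitive-^ (pΦ (ℕ.n<1+n N)) (f N))
      (coprime-^ (coprime-sym (coprime-factored N f λ d<N → coprime-sym (c d<N (ℕ.n<1+n N)))) (f N))
      (factored-least N f (λ d<N → pΦ (ℕ.m<n⇒m<1+n d<N))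
        (λ d<e e<N → c d<e (ℕ.m<n⇒m<1+n e<N)) (λ d<N → Φ∣x (ℕ.m<n⇒m<1+n d<N)))
      (Φ∣x (ℕ.n<1+n N))

-- Cyclotomic factorisation of 1 - q^m

module Geometric {c ℓ : Level} (R : CommutativeRing c ℓ) where

  open Base R

  geometric : ℕ → Carrier → Carrier
  geometric zero    x = 0#
  geometric (suc m) x = 1# + x * geometric m x

  geometric-* : ∀ m x → geometric m x * (1# - x) ≈ 1# - x ^ m
  geometric-* zero    x = trans (zeroˡ _) (sym (-‿inverseʳ 1#))
  geometric-* (suc m) x = begin
    (1# + x * geometric m x) * (1# - x)
      ≈⟨ solve 3 (λ x y z → (con 1 :+ x :* y) :* z := z :+ x :* (y :* z)) refl x _ _ ⟩
    (1# - x) + x * (geometric m x * (1# - x))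
      ≈⟨ +-congˡ (*-congˡ (geometric-* m x)) ⟩
    (1# - x) + x * (1# - x ^ m)
      ≈⟨ 1-xy≈1-x+x[1-y] x (x ^ m) ⟨
    1# - x * x ^ m ∎

  -- Every power of `x` is 1 modulo `1 - x`. This supplies the positive constant in `coprime-via`.
  geometric≡m : ∀ m x → ∃ λ w → geometric m x + w * (1# - x) ≈ m ×ᵣ 1#
  geometric≡m zero    x = 0# , trans (+-identityˡ _) (zeroˡ _)
  geometric≡m (suc m) x with w , eq ← geometric≡m m x = geometric m x + w , (begin
    (1# + x * geometric m x) + (geometric m x + w) * (1# - x)
      ≈⟨ solve 4 (λ x y w z → (con 1 :+ x :* y) :+ (y :+ w) :* z :=
           con 1 :+ ((x :+ z) :* y :+ w :* z)) refl x (geometric m x) w (1# - x) ⟩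
    1# + ((x + (1# - x)) * geometric m x + w * (1# - x))
      ≈⟨ +-congˡ (+-congʳ (trans (*-congʳ (x+[1-x]≈1 x)) (*-identityˡ _))) ⟩
    1# + (geometric m x + w * (1# - x))
      ≈⟨ +-congˡ eq ⟩
    1# + m ×ᵣ 1# ∎)

  1+x∣1+x^odd : ∀ x m → 1# + x ∣ 1# + x ^ (1 ℕ.+ 2 ℕ.* m)
  1+x∣1+x^odd x zero    = ∣ʳ-reflexive (+-congˡ (sym (*-identityʳ x)))
  -- The witness comes from 1 + x^(k+2) = x^2 (1 + x^k) + (1 - x)(1 + x).
  1+x∣1+x^odd x (suc m) with u , eq ← 1+x∣1+x^odd x m = x * x * u + (1# - x) , (begin
    (x * x * u + (1# - x)) * (1# + x)
      ≈⟨ solve 3 (λ x u z → (x :* x :* u :+ z) :* (con 1 :+ x) :=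
           x :* x :* (u :* (con 1 :+ x)) :+ z :* (con 1 :+ x)) refl x u (1# - x) ⟩
    x * x * (u * (1# + x)) + (1# - x) * (1# + x)
      ≈⟨ +-congʳ (*-congˡ eq) ⟩
    x * x * (1# + x ^ (1 ℕ.+ 2 ℕ.* m)) + (1# - x) * (1# + x)
      ≈⟨ solve 3 (λ x y z → x :* x :* (con 1 :+ y) :+ z :* (con 1 :+ x) :=
           x :* (x :+ z) :+ z :+ x :* (x :* y)) refl x _ (1# - x) ⟩
    x * (x + (1# - x)) + (1# - x) + x * (x * x ^ (1 ℕ.+ 2 ℕ.* m))
      ≈⟨ +-congʳ (trans (+-congʳ (trans (*-congˡ (x+[1-x]≈1 x)) (*-identityʳ x))) (x+[1-x]≈1 x)) ⟩
    1# + x ^ (1 ℕ.+ (2 ℕ.+ 2 ℕ.* m))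
      ≈⟨ +-congˡ (reflexive (≡.cong (λ k → x ^ (1 ℕ.+ k)) (ℕ.*-suc 2 m))) ⟨
    1# + x ^ (1 ℕ.+ 2 ℕ.* suc m) ∎)

module Cyclotomic {c ℓ : Level} (R : CommutativeRing c ℓ) (q : CommutativeRing.Carrier R)
                  (1-q^m-primitive : Base.PowersPrimitive R q) where

  open Base R
  open Products R
  open Geometric R

  1-q^-∣ : ∀ a {b} → a ℕ.∣ b → 1# - q ^ a ∣ 1# - q ^ b
  1-q^-∣ a (ℕ.divides k ≡.refl) = geometric k (q ^ a) ,
    trans (geometric-* k (q ^ a))
      (+-congˡ (-‿cong (trans (^-assocʳ q a k) (reflexive (≡.cong (q ^_) (ℕ.*-comm a k))))))

  -- Since x = g + y, the identity 1 - q^g = (1 - q^x) - q^g (1 - q^y) lifts a Bézout identity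
  -- between exponents to one between `1 - q^a` and `1 - q^b`.
  bézout-lemma : ∀ a b x y g → 1# - q ^ a ∣ 1# - q ^ x → 1# - q ^ b ∣ 1# - q ^ y →
                 g ℕ.+ y ≡ x →
                 ∃ λ u → ∃ λ v → u * (1# - q ^ a) + v * (1# - q ^ b) ≈ 1# - q ^ g
  bézout-lemma a b x y g (u , eq) (v , eq′) ≡.refl = u , - (q ^ g) * v , (begin
    u * (1# - q ^ a) + - (q ^ g) * v * (1# - q ^ b)
      ≈⟨ +-cong eq (trans (*-assoc (- (q ^ g)) v _) (*-congˡ eq′)) ⟩
    (1# - q ^ (g ℕ.+ y)) + - (q ^ g) * (1# - q ^ y)
      ≈⟨ +-congʳ (trans (+-congˡ (-‿cong (^-homo-* q g y))) (1-xy≈1-x+x[1-y] (q ^ g) (q ^ y))) ⟩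
    (1# - q ^ g) + q ^ g * (1# - q ^ y) + - (q ^ g) * (1# - q ^ y)
      ≈⟨ solve 4 (λ a b b′ c → a :+ b :* c :+ b′ :* c := a :+ (b :+ b′) :* c) refl _ _ _ _ ⟩
    (1# - q ^ g) + (q ^ g - q ^ g) * (1# - q ^ y)
      ≈⟨ +-congˡ (trans (*-congʳ (-‿inverseʳ _)) (zeroˡ _)) ⟩
    (1# - q ^ g) + 0#
      ≈⟨ +-identityʳ _ ⟩
    1# - q ^ g ∎)

  bézout : ∀ a b g → ℕ.GCD a b g → ∃ λ u → ∃ λ v →
           u * (1# - q ^ a) + v * (1# - q ^ b) ≈ 1# - q ^ g
  bézout a b g gcd with ℕ.Bézout.identity gcd
  ... | ℕ.Bézout.+- x y eq =
    bézout-lemma a b (x ℕ.* a) (y ℕ.* b) g (1-q^-∣ a (ℕ.n∣m*n x)) (1-q^-∣ b (ℕ.n∣m*n y)) eq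
  ... | ℕ.Bézout.-+ x y eq
    with u , v , eq′ ← bézout-lemma b a (y ℕ.* b) (x ℕ.* a) g
                         (1-q^-∣ b (ℕ.n∣m*n y)) (1-q^-∣ a (ℕ.n∣m*n x)) eq
    = v , u , trans (+-comm _ _) eq′

  record Factorisation (N : ℕ) : Set (c ⊔ ℓ) where
    field
      Φ      : ℕ → Carrier
      1-q^≈Φ : ∀ {m} → m < N → 1# - q ^ suc m ≈ factored Φ N (λ d → ⟦ suc d ∣ suc m ⟧)

    Φ∣1-q^ : ∀ {d} → d < N → Φ d ∣ 1# - q ^ suc d
    Φ∣1-q^ {d} d<N = ∣-respˡ-≈
      (trans (reflexive (≡.cong (Φ d ^_) (⟦∣⟧-yes (ℕ.∣-refl {suc d})))) (*-identityʳ _))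
      (∣-respʳ-≈ (sym (1-q^≈Φ d<N)) (∣-factored Φ _ d<N))

    Φ-primitive : ∀ {d} → d < N → Primitive (Φ d)
    Φ-primitive {d} d<N = primitive-∣ (Φ∣1-q^ d<N) (1-q^m-primitive d)

    -- Exponents show that `1 - q^g` times Φ of index d divides `1 - q^d`: the divisors of the
    -- proper divisor g divide d and differ from d. Then `1 - q^g` is cancelled.
    Φ∣geometric : ∀ {d} → d < N → ∀ g k → suc d ≡ k ℕ.* suc g → suc g < suc d →
                  Φ d ∣ geometric k (q ^ suc g)
    Φ∣geometric {d} d<N g k d≡kg g<d = ∣-cancel (1# - q ^ suc g) (1-q^m-primitive g)
      (∣-respˡ-≈ lhs (∣-respʳ-≈ rhs (factored-∣ Φ N (λ {e} _ → bound e))))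
      where
      lhs = begin
        factored Φ N (λ e → ⟦ suc e ∣ suc g ⟧ ℕ.+ ⟦ d ≡ e ⟧)
          ≈⟨ factored-+ Φ N (λ e → ⟦ suc e ∣ suc g ⟧) ⟦ d ≡_⟧ ⟩
        factored Φ N (λ e → ⟦ suc e ∣ suc g ⟧) * factored Φ N ⟦ d ≡_⟧
          ≈⟨ *-cong (sym (1-q^≈Φ (ℕ.<-trans (ℕ.s<s⁻¹ g<d) d<N))) (factored-single Φ d<N) ⟩
        (1# - q ^ suc g) * Φ d ∎
      rhs = begin
        factored Φ N (λ e → ⟦ suc e ∣ suc d ⟧)  ≈⟨ 1-q^≈Φ d<N ⟨
        1# - q ^ suc d                          ≡⟨ ≡.cong (λ e → 1# - q ^ e) (≡.trans d≡kg (ℕ.*-comm k (suc g))) ⟩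
        1# - q ^ (suc g ℕ.* k)                  ≈⟨ +-congˡ (-‿cong (^-assocʳ q (suc g) k)) ⟨
        1# - (q ^ suc g) ^ k                    ≈⟨ geometric-* k (q ^ suc g) ⟨
        geometric k (q ^ suc g) * (1# - q ^ suc g) ≈⟨ *-comm _ _ ⟩
        (1# - q ^ suc g) * geometric k (q ^ suc g) ∎
      bound : ∀ e → ⟦ suc e ∣ suc g ⟧ ℕ.+ ⟦ d ≡ e ⟧ ≤ ⟦ suc e ∣ suc d ⟧
      bound e with d ℕ.≟ e
      ... | no d≢e rewrite ⟦≡⟧-no d≢e | ℕ.+-identityʳ ⟦ suc e ∣ suc g ⟧ = ⟦∣⟧-mono (suc e) (ℕ.divides k d≡kg)
      ... | yes ≡.refl rewrite ⟦≡⟧-yes d | ⟦∣⟧-no (ℕ.>⇒∤ g<d) | ⟦∣⟧-yes (ℕ.∣-refl {suc d}) = ℕ.≤-refl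

    -- With g = gcd(a, e), 1 - q^g is a combination of 1 - q^a and 1 - q^e,
    -- and (1 - q^e) / (1 - q^g) is e / g modulo 1 - q^g.
    1-q^-coprime : ∀ {a d} → d < N → ¬ suc d ℕ.∣ suc a → Coprime (1# - q ^ suc a) (Φ d)
    1-q^-coprime {a} {d} d<N d∤a with ℕ.mkGCD (suc a) (suc d)
    ... | zero  , gcd = ⊥-elim (ℕ.1+n≢0 (ℕ.0∣⇒≡0 (ℕ.GCD.gcd∣n gcd)))
    ... | suc g , gcd with ℕ.GCD.gcd∣n gcd
    ... | ℕ.divides zero ()
    ... | ℕ.divides (suc k) eq =
      coprime-∣ ∣ʳ-refl (Φ∣geometric d<N g (suc k) eq (ℕ.≤∧≢⇒< (ℕ.∣⇒≤ (ℕ.GCD.gcd∣n gcd)) g≢d)) coprime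
      where
      g≢d : suc g ≢ suc d
      g≢d g≡d = d∤a (≡.subst (ℕ._∣ suc a) g≡d (ℕ.GCD.gcd∣m gcd))
      Ψ = geometric (suc k) (q ^ suc g)
      Ψ* : Ψ * (1# - q ^ suc g) ≈ 1# - q ^ suc d
      Ψ* = trans (geometric-* (suc k) (q ^ suc g)) (+-congˡ (-‿cong (trans (^-assocʳ q (suc g) (suc k))
        (reflexive (≡.cong (q ^_) (≡.trans (ℕ.*-comm (suc g) (suc k)) (≡.sym eq)))))))
      coprime : Coprime (1# - q ^ suc a) Ψ
      coprime = coprime-via k (bézout (suc a) (suc d) (suc g) gcd) Ψ* (geometric≡m (suc k) (q ^ suc g))

    Φ-coprime : ∀ {d e} → d < e → e < N → Coprime (Φ d) (Φ e)
    Φ-coprime d<e e<N = coprime-∣ (Φ∣1-q^ (ℕ.<-trans d<e e<N)) ∣ʳ-refl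
      (1-q^-coprime e<N (ℕ.>⇒∤ (ℕ.s<s d<e)))

  -- The new Φ is the cofactor in `1 - q^(N+1)` of the Φ of all proper divisors of N + 1. By the
  -- previous stage these are primitive and pairwise coprime, so their product does divide.
  factorisation : ∀ N → Factorisation N
  factorisation zero    = record { Φ = λ _ → 1# ; 1-q^≈Φ = λ () }
  factorisation (suc N) = extend (factored-least Φ N (λ d → ⟦ suc d ∣ suc N ⟧) Φ-primitive Φ-coprime Φ^∣)
    where
    open Factorisation (factorisation N)
    Φ^∣ : ∀ {d} → d < N → Φ d ^ ⟦ suc d ∣ suc N ⟧ ∣ 1# - q ^ suc N
    Φ^∣ {d} d<N with suc d ℕ.∣? suc N
    ... | yes d∣N = ∣-respˡ-≈
      (sym (trans (reflexive (≡.cong (Φ d ^_) (⟦∣⟧-yes d∣N))) (*-identityʳ _)))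
      (∣ʳ-trans (Φ∣1-q^ d<N) (1-q^-∣ (suc d) d∣N))
    ... | no  d∤N = ∣-respˡ-≈ (reflexive (≡.cong (Φ d ^_) (≡.sym (⟦∣⟧-no d∤N)))) (_ , *-identityʳ _)
    extend : factored Φ N (λ d → ⟦ suc d ∣ suc N ⟧) ∣ 1# - q ^ suc N → Factorisation (suc N)
    extend (x , eq) = record { Φ = Φ′ ; 1-q^≈Φ = 1-q^≈Φ′ }
      where
      Φ′ : ℕ → Carrier
      Φ′ d = if does (d ℕ.≟ N) then x else Φ d
      Φ′N≡x : Φ′ N ≡ x
      Φ′N≡x = ≡.cong (if_then x else Φ N) (dec-true (N ℕ.≟ N) ≡.refl)
      Φ′≗Φ : ∀ {d} → d < N → Φ′ d ≡ Φ d
      Φ′≗Φ {d} d<N = ≡.cong (if_then x else Φ d) (dec-false (d ℕ.≟ N) (ℕ.<⇒≢ d<N))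
      1-q^≈Φ′ : ∀ {m} → m < suc N →
                1# - q ^ suc m ≈ factored Φ′ (suc N) (λ d → ⟦ suc d ∣ suc m ⟧)
      1-q^≈Φ′ {m} m<1+N with m ℕ.≟ N
      ... | yes ≡.refl = begin
        1# - q ^ suc N
          ≈⟨ eq ⟨
        x * factored Φ N (λ d → ⟦ suc d ∣ suc N ⟧)
          ≈⟨ *-comm _ _ ⟩
        factored Φ N (λ d → ⟦ suc d ∣ suc N ⟧) * x
          ≈⟨ *-cong (reflexive (factored-cong N Φ′≗Φ (λ _ → ≡.refl))) (*-identityʳ x) ⟨
        factored Φ′ N (λ d → ⟦ suc d ∣ suc N ⟧) * x ^ 1
          ≡⟨ ≡.cong₂ (λ y k → factored Φ′ N (λ d → ⟦ suc d ∣ suc N ⟧) * y ^ k)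
               Φ′N≡x (⟦∣⟧-yes (ℕ.∣-refl {suc N})) ⟨
        factored Φ′ (suc N) (λ d → ⟦ suc d ∣ suc N ⟧) ∎
      ... | no m≢N = begin
        1# - q ^ suc m
          ≈⟨ 1-q^≈Φ m<N ⟩
        factored Φ N (λ d → ⟦ suc d ∣ suc m ⟧)
          ≡⟨ factored-cong N Φ′≗Φ (λ _ → ≡.refl) ⟨
        factored Φ′ N (λ d → ⟦ suc d ∣ suc m ⟧)
          ≈⟨ *-identityʳ _ ⟨
        factored Φ′ N (λ d → ⟦ suc d ∣ suc m ⟧) * 1#
          ≡⟨ ≡.cong (λ k → factored Φ′ N (λ d → ⟦ suc d ∣ suc m ⟧) * Φ′ N ^ k) (⟦∣⟧-no (ℕ.>⇒∤ (ℕ.s<s m<N))) ⟨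
        factored Φ′ (suc N) (λ d → ⟦ suc d ∣ suc m ⟧) ∎
        where
        m<N : m < N
        m<N = ℕ.≤∧≢⇒< (ℕ.s≤s⁻¹ m<1+N) m≢N

-- Floors and carries

[r+x*d]/d≡x : ∀ r x d .{{_ : NonZero d}} → r < d → (r ℕ.+ x ℕ.* d) / d ≡ x
[r+x*d]/d≡x r x d r<d = ≡.trans (ℕ.+-distrib-/-∣ʳ r (ℕ.n∣m*n x))
  (≡.cong₂ ℕ._+_ (ℕ.m<n⇒m/n≡0 r<d) (ℕ.m*n/n≡m x d))

-- The floor jumps exactly at the multiples of the divisor. Accumulated over `k`, this gives
-- Legendre's exponents for the q-factorial.
suc-/ : ∀ k d → suc k / suc d ≡ k / suc d ℕ.+ ⟦ suc d ∣ suc k ⟧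
suc-/ k d = by-remainder (suc k % suc d) ≡.refl
  where
  by-remainder : ∀ r → suc k % suc d ≡ r → suc k / suc d ≡ k / suc d ℕ.+ ⟦ suc d ∣ suc k ⟧
  by-remainder zero eq = begin
    suc k / suc d                             ≡⟨ ≡.cong (_/ suc d) suc-k ⟩
    (suc (k / suc d) ℕ.* suc d) / suc d       ≡⟨ ℕ.m*n/n≡m (suc (k / suc d)) (suc d) ⟩
    suc (k / suc d)                           ≡⟨ ℕ.+-comm 1 (k / suc d) ⟩
    k / suc d ℕ.+ 1                           ≡⟨ ≡.cong (k / suc d ℕ.+_) (⟦∣⟧-yes (ℕ.m%n≡0⇒n∣m (suc k) (suc d) eq)) ⟨
    k / suc d ℕ.+ ⟦ suc d ∣ suc k ⟧           ∎
    where
    open ≡.≡-Reasoning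
    suc-k : suc k ≡ suc (k / suc d) ℕ.* suc d
    suc-k = ≡.cong suc (≡.trans (ℕ.m≡m%n+[m/n]*n k (suc d))
      (≡.cong (ℕ._+ k / suc d ℕ.* suc d) (ℕ.%-pred-≡0 {k} {suc d} eq)))
  by-remainder (suc r) eq = begin
    x                                 ≡⟨ [r+x*d]/d≡x r x (suc d) r<d ⟨
    (r ℕ.+ x ℕ.* suc d) / suc d       ≡⟨ ≡.cong (_/ suc d) (ℕ.suc-injective suc-k) ⟨
    k / suc d                         ≡⟨ ℕ.+-identityʳ _ ⟨
    k / suc d ℕ.+ 0                   ≡⟨ ≡.cong (k / suc d ℕ.+_) (⟦∣⟧-no d∤k) ⟨
    k / suc d ℕ.+ ⟦ suc d ∣ suc k ⟧   ∎
    where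
    open ≡.≡-Reasoning
    x = suc k / suc d
    suc-k : suc k ≡ suc r ℕ.+ x ℕ.* suc d
    suc-k = ≡.trans (ℕ.m≡m%n+[m/n]*n (suc k) (suc d)) (≡.cong (ℕ._+ x ℕ.* suc d) eq)
    r<d : r < suc d
    r<d = ℕ.<-trans (ℕ.n<1+n r) (≡.subst (_< suc d) eq (ℕ.m%n<n (suc k) (suc d)))
    d∤k : ¬ suc d ℕ.∣ suc k
    d∤k d∣k = ℕ.1+n≢0 (≡.trans (≡.sym eq) (ℕ.n∣m⇒m%n≡0 (suc k) (suc d) d∣k))

/-superadditive : ∀ k l d .{{_ : NonZero d}} → k / d ℕ.+ l / d ≤ (k ℕ.+ l) / d
/-superadditive k l d = begin
  k / d ℕ.+ l / d                          ≡⟨ ℕ.m*n/n≡m (k / d ℕ.+ l / d) d ⟨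
  (k / d ℕ.+ l / d) ℕ.* d / d              ≡⟨ ≡.cong (_/ d) (ℕ.*-distribʳ-+ d (k / d) (l / d)) ⟩
  (k / d ℕ.* d ℕ.+ l / d ℕ.* d) / d        ≤⟨ ℕ./-monoˡ-≤ d (ℕ.+-mono-≤ (ℕ.m/n*n≤m k d) (ℕ.m/n*n≤m l d)) ⟩
  (k ℕ.+ l) / d                            ∎
  where open ℕ.≤-Reasoning

-- The divisor is d + 1, in accordance with the indexing of Φ.
carry : ℕ → ℕ → ℕ → ℕ
carry k l d = (k ℕ.+ l) / suc d ∸ (k / suc d ℕ.+ l / suc d)

carry-+ : ∀ k l d → carry k l d ℕ.+ (k / suc d ℕ.+ l / suc d) ≡ (k ℕ.+ l) / suc d
carry-+ k l d = ℕ.m∸n+n≡m (/-superadditive k l (suc d))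

carry-comm : ∀ k l d → carry k l d ≡ carry l k d
carry-comm k l d = ≡.cong₂ (λ x y → x / suc d ∸ y) (ℕ.+-comm k l) (ℕ.+-comm (k / suc d) (l / suc d))

carry-zero : ∀ k l d → carry k l d ≡ 0 → (k ℕ.+ l) / suc d ≡ k / suc d ℕ.+ l / suc d
carry-zero k l d eq = ≡.trans (≡.sym (carry-+ k l d)) (≡.cong (ℕ._+ (k / suc d ℕ.+ l / suc d)) eq)

-- Each argument lies less than one divisor above its rounded-down multiple, so the sum lies less
-- than two above.
carry≤1 : ∀ k l d → carry k l d ≤ 1
carry≤1 k l d = ℕ.m≤n+o⇒m∸n≤o ((k ℕ.+ l) / suc d) (k / suc d ℕ.+ l / suc d)
  (ℕ.s≤s⁻¹ (≡.subst ((k ℕ.+ l) / suc d <_) (ℕ.+-suc _ 1) (ℕ.m<n*o⇒m/o<n bound)))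
  where
  open ℕ.≤-Reasoning
  open +-*-Solver
  D = suc d
  below : ∀ m → m < D ℕ.+ m / D ℕ.* D
  below m = begin-strict
    m                          ≡⟨ ℕ.m≡m%n+[m/n]*n m D ⟩
    m % D ℕ.+ m / D ℕ.* D      <⟨ ℕ.+-monoˡ-< (m / D ℕ.* D) (ℕ.m%n<n m D) ⟩
    D ℕ.+ m / D ℕ.* D          ∎
  bound : k ℕ.+ l < (k / D ℕ.+ l / D ℕ.+ 2) ℕ.* D
  bound = begin-strict
    k ℕ.+ l                                              <⟨ ℕ.+-mono-< (below k) (below l) ⟩
    (D ℕ.+ k / D ℕ.* D) ℕ.+ (D ℕ.+ l / D ℕ.* D)
      ≡⟨ solve 3 (λ D x y → (D :+ x :* D) :+ (D :+ y :* D) := (x :+ y :+ con 2) :* D)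
           ≡.refl D (k / D) (l / D) ⟩
    (k / D ℕ.+ l / D ℕ.+ 2) ℕ.* D                        ∎

-- Without a carry the rounded-down multiples of `k` and `l` would already add up to `k + l`, which
-- leaves no remainder for `k`.
carry-positive : ∀ {k l d} → suc d ℕ.∣ k ℕ.+ l → ¬ suc d ℕ.∣ k → 0 < carry k l d
carry-positive {k} {l} {d} d∣k+l d∤k = ℕ.n≢0⇒n>0 λ carry≡0 → d∤k (ℕ.divides (k / D)
  (ℕ.≤-antisym (ℕ.+-cancelʳ-≤ (l / D ℕ.* D) k (k / D ℕ.* D) (begin
    k ℕ.+ l / D ℕ.* D              ≤⟨ ℕ.+-monoʳ-≤ k (ℕ.m/n*n≤m l D) ⟩
    k ℕ.+ l                        ≡⟨ ℕ.m/n*n≡m d∣k+l ⟨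
    (k ℕ.+ l) / D ℕ.* D            ≡⟨ ≡.cong (ℕ._* D) (carry-zero k l d carry≡0) ⟩
    (k / D ℕ.+ l / D) ℕ.* D        ≡⟨ ℕ.*-distribʳ-+ D (k / D) (l / D) ⟩
    k / D ℕ.* D ℕ.+ l / D ℕ.* D    ∎)) (ℕ.m/n*n≤m k D)))
  where
  open ℕ.≤-Reasoning
  D = suc d

carry-∣ : ∀ {k d} l → suc d ℕ.∣ k → carry k l d ≡ 0
carry-∣ {k} {d} l d∣k = ℕ.m≤n⇒m∸n≡0 (ℕ.≤-reflexive (ℕ.+-distrib-/-∣ˡ l d∣k))

-- Adding `z` and `k` carries because they complete a multiple, and adding `l` to a multiple does
-- not carry. In the special cases this relation is refuted by explicit values of the floors, which
-- proves that `k + l` has a carry.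
carry-shift : ∀ {z k l d} → suc d ℕ.∣ z ℕ.+ k → ¬ suc d ℕ.∣ z → carry k l d ≡ 0 →
              (z ℕ.+ (k ℕ.+ l)) / suc d ≡ 1 ℕ.+ (z / suc d ℕ.+ (k ℕ.+ l) / suc d)
carry-shift {z} {k} {l} {d} d∣z+k d∤z carry≡0 = begin
  (z ℕ.+ (k ℕ.+ l)) / D                ≡⟨ ≡.cong (_/ D) (ℕ.+-assoc z k l) ⟨
  (z ℕ.+ k ℕ.+ l) / D                  ≡⟨ ℕ.+-distrib-/-∣ˡ l d∣z+k ⟩
  (z ℕ.+ k) / D ℕ.+ l / D              ≡⟨ ≡.cong (ℕ._+ l / D) (carry-+ z k d) ⟨
  carry z k d ℕ.+ (z / D ℕ.+ k / D) ℕ.+ l / D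
    ≡⟨ ≡.cong (λ x → x ℕ.+ (z / D ℕ.+ k / D) ℕ.+ l / D) carry≡1 ⟩
  1 ℕ.+ (z / D ℕ.+ k / D) ℕ.+ l / D    ≡⟨ ≡.cong suc (ℕ.+-assoc (z / D) (k / D) (l / D)) ⟩
  1 ℕ.+ (z / D ℕ.+ (k / D ℕ.+ l / D))  ≡⟨ ≡.cong (λ x → 1 ℕ.+ (z / D ℕ.+ x)) (carry-zero k l d carry≡0) ⟨
  1 ℕ.+ (z / D ℕ.+ (k ℕ.+ l) / D)      ∎
  where
  open ≡.≡-Reasoning
  D = suc d
  carry≡1 : carry z k d ≡ 1
  carry≡1 = ℕ.≤-antisym (carry≤1 z k d) (carry-positive d∣z+k d∤z)

-- Gaussian binomials and their cyclotomic factorisation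

module Gauss {c ℓ : Level} (R : CommutativeRing c ℓ) (q : CommutativeRing.Carrier R) where

  open Base R

  -- The recursion is the one by which `denominator∣numerator` builds its quotient, whence
  -- `quotient≡gauss`. It also makes sense in a quotient ring where the denominators vanish.
  gauss : ℕ → ℕ → Carrier
  gauss m       zero    = 1#
  gauss zero    (suc k) = 0#
  gauss (suc m) (suc k) = gauss m k + q ^ suc k * gauss m (suc k)

  gauss-zero : ∀ {m k} → m < k → gauss m k ≈ 0#
  gauss-zero {zero}  {suc k} _         = refl
  gauss-zero {suc m} {suc k} (s≤s m<k) = begin
    gauss m k + q ^ suc k * gauss m (suc k)
      ≈⟨ +-cong (gauss-zero m<k) (*-congˡ (gauss-zero (ℕ.m<n⇒m<1+n m<k))) ⟩
    0# + q ^ suc k * 0#  ≈⟨ trans (+-identityˡ _) (zeroʳ _) ⟩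
    0#                   ∎

  gauss-diagonal : ∀ m → gauss m m ≈ 1#
  gauss-diagonal zero    = refl
  gauss-diagonal (suc m) = begin
    gauss m m + q ^ suc m * gauss m (suc m)
      ≈⟨ +-cong (gauss-diagonal m) (*-congˡ (gauss-zero (ℕ.n<1+n m))) ⟩
    1# + q ^ suc m * 0#  ≈⟨ +-congˡ (zeroʳ _) ⟩
    1# + 0#              ≈⟨ +-identityʳ 1# ⟩
    1#                   ∎

  -- The consequences of Φ_d(q) = 0 that are used: the vanishing of the inner Gaussian binomials
  -- drives q-Lucas, and the value at d/2 fixes the sign of q^C(d,2) for even d.
  record IsRootOfUnity (d : ℕ) : Set ℓ where
    field
      q^d≈1      : q ^ d ≈ 1#
      q^[d/2]≈-1 : ∀ g → d ≡ 2 ℕ.* g → q ^ g ≈ - 1#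
      gauss-d≈0  : ∀ k → suc k < d → gauss d (suc k) ≈ 0#

  qFactorial : ℕ → Carrier
  qFactorial zero    = 1#
  qFactorial (suc k) = qFactorial k * (1# - q ^ suc k)

  gauss-qFactorial : ∀ k l → gauss (k ℕ.+ l) k * (qFactorial k * qFactorial l) ≈ qFactorial (k ℕ.+ l)
  gauss-qFactorial zero    l = trans (*-identityˡ _) (*-identityˡ _)
  gauss-qFactorial (suc k) zero rewrite ℕ.+-identityʳ k =
    trans (*-cong (gauss-diagonal (suc k)) (*-identityʳ _)) (*-identityˡ _)
  gauss-qFactorial (suc k) (suc l) = begin
    (gauss (k ℕ.+ suc l) k + x * gauss (k ℕ.+ suc l) (suc k)) * (F * (1# - x) * (G * (1# - y)))
      ≈⟨ solve 7 (λ g h x x′ F G y′ → (g :+ x :* h) :* (F :* x′ :* (G :* y′)) :=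
           g :* (F :* (G :* y′)) :* x′ :+ x :* (h :* (F :* x′ :* G) :* y′)) refl _ _ x _ F G _ ⟩
    gauss (k ℕ.+ suc l) k * (F * (G * (1# - y))) * (1# - x)
      + x * (gauss (k ℕ.+ suc l) (suc k) * (F * (1# - x) * G) * (1# - y))
      ≈⟨ +-cong (*-congʳ (gauss-qFactorial k (suc l)))
           (*-congˡ (*-congʳ (trans (reflexive (≡.cong (λ m → gauss m (suc k) * (F * (1# - x) * G)) (ℕ.+-suc k l)))
             (trans (gauss-qFactorial (suc k) l) (reflexive (≡.cong qFactorial (≡.sym (ℕ.+-suc k l)))))))) ⟩
    H * (1# - x) + x * (H * (1# - y))
      ≈⟨ solve 4 (λ H x x′ y′ → H :* x′ :+ x :* (H :* y′) := H :* (x′ :+ x :* y′)) refl H x _ _ ⟩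
    H * ((1# - x) + x * (1# - y))
      ≈⟨ *-congˡ (1-xy≈1-x+x[1-y] x y) ⟨
    H * (1# - x * y)
      ≈⟨ *-congˡ (+-congˡ (-‿cong (^-homo-* q (suc k) (suc l)))) ⟨
    H * (1# - q ^ (suc k ℕ.+ suc l)) ∎
    where
    x = q ^ suc k
    y = q ^ suc l
    F = qFactorial k
    G = qFactorial l
    H = qFactorial (k ℕ.+ suc l)

module GaussFactorisation
  {c ℓ : Level} (R : CommutativeRing c ℓ) (q : CommutativeRing.Carrier R)
  (1-q^m-primitive : Base.PowersPrimitive R q) (N : ℕ) where

  open Base R
  open Products R public
  open Geometric R public
  open Gauss R q public
  open Cyclotomic R q 1-q^m-primitive public
  open Factorisation (factorisation N) public

  F : (ℕ → ℕ) → Carrier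
  F = factored Φ N

  F-cong : ∀ {f g} → (∀ {d} → d < N → f d ≡ g d) → F f ≈ F g
  F-cong f≗g = reflexive (factored-cong N (λ _ → ≡.refl) f≗g)

  F-primitive : ∀ f → Primitive (F f)
  F-primitive f = factored-primitive Φ N f Φ-primitive

  qFactorial≈F : ∀ k → k ≤ N → qFactorial k ≈ F (λ d → k / suc d)
  qFactorial≈F zero    _   = sym (factored-zero Φ N (λ {d} _ → ℕ.0/n≡0 (suc d)))
  qFactorial≈F (suc k) k<N = begin
    qFactorial k * (1# - q ^ suc k)
      ≈⟨ *-cong (qFactorial≈F k (ℕ.<⇒≤ k<N)) (1-q^≈Φ k<N) ⟩
    F (λ d → k / suc d) * F (λ d → ⟦ suc d ∣ suc k ⟧)
      ≈⟨ factored-+ Φ N (λ d → k / suc d) (λ d → ⟦ suc d ∣ suc k ⟧) ⟨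
    F (λ d → k / suc d ℕ.+ ⟦ suc d ∣ suc k ⟧)
      ≈⟨ F-cong (λ {d} _ → suc-/ k d) ⟨
    F (λ d → suc k / suc d) ∎

  gauss≈F : ∀ {m} k l → k ℕ.+ l ≡ m → m ≤ N → gauss m k ≈ F (carry k l)
  gauss≈F k l ≡.refl k+l≤N = cancel (F-primitive f) (begin
    F f * gauss (k ℕ.+ l) k
      ≈⟨ *-comm _ _ ⟩
    gauss (k ℕ.+ l) k * F f
      ≈⟨ *-congˡ (factored-+ Φ N (λ d → k / suc d) (λ d → l / suc d)) ⟩
    gauss (k ℕ.+ l) k * (F (λ d → k / suc d) * F (λ d → l / suc d))
      ≈⟨ *-congˡ (*-cong (qFactorial≈F k (ℕ.m+n≤o⇒m≤o k k+l≤N)) (qFactorial≈F l (ℕ.m+n≤o⇒n≤o k k+l≤N))) ⟨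
    gauss (k ℕ.+ l) k * (qFactorial k * qFactorial l)
      ≈⟨ gauss-qFactorial k l ⟩
    qFactorial (k ℕ.+ l)
      ≈⟨ qFactorial≈F (k ℕ.+ l) k+l≤N ⟩
    F (λ d → (k ℕ.+ l) / suc d)
      ≈⟨ F-cong (λ {d} _ → carry-+ k l d) ⟨
    F (λ d → carry k l d ℕ.+ f d)
      ≈⟨ factored-+ Φ N (carry k l) f ⟩
    F (carry k l) * F f
      ≈⟨ *-comm _ _ ⟩
    F f * F (carry k l) ∎)
    where
    f : ℕ → ℕ
    f d = k / suc d ℕ.+ l / suc d

  -- Carries are symmetric, so both sides have the same cyclotomic exponents.
  gauss-symmetric : ∀ {m} k l → k ℕ.+ l ≡ m → m ≤ N → gauss m k ≈ gauss m l
  gauss-symmetric k l k+l≡m m≤N = trans (gauss≈F k l k+l≡m m≤N)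
    (trans (F-cong (λ {d} _ → carry-comm k l d))
      (sym (gauss≈F l k (≡.trans (ℕ.+-comm l k) k+l≡m) m≤N)))

  Φ∣gauss : ∀ {d m} k l → k ℕ.+ l ≡ m → m ≤ N → d < N → 0 < carry k l d → Φ d ∣ gauss m k
  Φ∣gauss {d} k l k+l≡m m≤N d<N 0<carry = ∣-respʳ-≈ (sym (gauss≈F k l k+l≡m m≤N))
    (∣ʳ-trans (Φ∣Φ^ (carry k l d) 0<carry) (∣-factored Φ (carry k l) d<N))
    where
    Φ∣Φ^ : ∀ m → 0 < m → Φ d ∣ Φ d ^ m
    Φ∣Φ^ (suc m) _ = x∣xy _ _

-- Triangular numbers, finite sums and signs

-- This is C(m,2), in a form without division.
triangle : ℕ → ℕ
triangle zero    = 0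
triangle (suc m) = triangle m ℕ.+ m

2*triangle : ∀ m → 2 ℕ.* triangle m ℕ.+ m ≡ m ℕ.* m
2*triangle zero    = ≡.refl
2*triangle (suc m) = begin
  2 ℕ.* (triangle m ℕ.+ m) ℕ.+ suc m
    ≡⟨ solve 2 (λ t m → con 2 :* (t :+ m) :+ (con 1 :+ m) := con 2 :* t :+ m :+ (con 1 :+ con 2 :* m))
         ≡.refl (triangle m) m ⟩
  2 ℕ.* triangle m ℕ.+ m ℕ.+ (1 ℕ.+ 2 ℕ.* m)
    ≡⟨ ≡.cong (ℕ._+ (1 ℕ.+ 2 ℕ.* m)) (2*triangle m) ⟩
  m ℕ.* m ℕ.+ (1 ℕ.+ 2 ℕ.* m)
    ≡⟨ solve 1 (λ m → m :* m :+ (con 1 :+ con 2 :* m) := (con 1 :+ m) :* (con 1 :+ m)) ≡.refl m ⟩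
  suc m ℕ.* suc m ∎
  where
  open ≡.≡-Reasoning
  open +-*-Solver

triangle-unique : ∀ m {x} → 2 ℕ.* x ℕ.+ m ≡ m ℕ.* m → triangle m ≡ x
triangle-unique m {x} eq = ℕ.*-cancelˡ-≡ (triangle m) x 2
  (ℕ.+-cancelʳ-≡ m _ _ (≡.trans (2*triangle m) (≡.sym eq)))

triangle-odd : ∀ g → triangle (1 ℕ.+ 2 ℕ.* g) ≡ (1 ℕ.+ 2 ℕ.* g) ℕ.* g
triangle-odd g = triangle-unique (1 ℕ.+ 2 ℕ.* g)
  (solve 1 (λ g → con 2 :* ((con 1 :+ con 2 :* g) :* g) :+ (con 1 :+ con 2 :* g) :=
     (con 1 :+ con 2 :* g) :* (con 1 :+ con 2 :* g)) ≡.refl g)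
  where open +-*-Solver

triangle-even : ∀ g → triangle (2 ℕ.* suc g) ≡ suc g ℕ.* (1 ℕ.+ 2 ℕ.* g)
triangle-even g = triangle-unique (2 ℕ.* suc g)
  (solve 1 (λ g → con 2 :* ((con 1 :+ g) :* (con 1 :+ con 2 :* g)) :+ con 2 :* (con 1 :+ g) :=
     con 2 :* (con 1 :+ g) :* (con 2 :* (con 1 :+ g))) ≡.refl g)
  where open +-*-Solver

parity : ∀ m → ∃ λ g → m ≡ 2 ℕ.* g ⊎ m ≡ 1 ℕ.+ 2 ℕ.* g
parity zero = 0 , inj₁ ≡.refl
parity (suc m) with parity m
... | g , inj₁ ≡.refl = g , inj₂ ≡.refl
... | g , inj₂ ≡.refl = suc g , inj₁ (≡.sym (ℕ.*-suc 2 g))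

module Sums {c ℓ : Level} (R : CommutativeRing c ℓ) where

  open Base R
  open SemiringSum semiring using (sum; sum-cong-≋; sum-init-last; ∑-distrib-+; sum-replicate-zero; sum-cong-≗)

  ∑ : ℕ → (ℕ → Carrier) → Carrier
  ∑ n f = sum {n} (λ i → f (toℕ i))

  ∑-cong : ∀ n {f g : ℕ → Carrier} → (∀ {i} → i < n → f i ≈ g i) → ∑ n f ≈ ∑ n g
  ∑-cong n f≈g = sum-cong-≋ {n} (λ i → f≈g (toℕ<n i))

  ∑-zero : ∀ n {f : ℕ → Carrier} → (∀ {i} → i < n → f i ≈ 0#) → ∑ n f ≈ 0#
  ∑-zero n f≈0 = trans (∑-cong n f≈0) (sum-replicate-zero n)

  ∑-+ : ∀ n (f g : ℕ → Carrier) → ∑ n (λ i → f i + g i) ≈ ∑ n f + ∑ n g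
  ∑-+ n f g = ∑-distrib-+ {n} _ _

  ∑-last : ∀ n f → ∑ (suc n) f ≈ ∑ n f + f n
  ∑-last n f = trans (sum-init-last {n} (λ i → f (toℕ i))) (reflexive (≡.cong₂ _+_
    (sum-cong-≗ {n} λ i → ≡.cong f (toℕ-inject₁ i)) (≡.cong f (toℕ-fromℕ n))))

  ∑-split : ∀ m n f → ∑ (m ℕ.+ n) f ≈ ∑ m f + ∑ n (λ i → f (m ℕ.+ i))
  ∑-split zero    n f = sym (+-identityˡ _)
  ∑-split (suc m) n f = trans (+-congˡ (∑-split m n (λ i → f (suc i)))) (sym (+-assoc _ _ _))

  ∑-blocks : ∀ m d f → ∑ (m ℕ.* d) f ≈ ∑ m (λ p → ∑ d (λ w → f (p ℕ.* d ℕ.+ w)))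
  ∑-blocks zero    d f = refl
  ∑-blocks (suc m) d f = trans (∑-split d (m ℕ.* d) f)
    (+-congˡ (trans (∑-blocks m d (λ i → f (d ℕ.+ i)))
      (∑-cong m (λ {p} _ → ∑-cong d (λ {w} _ →
        reflexive (≡.cong f (≡.sym (ℕ.+-assoc d (p ℕ.* d) w))))))))

  ∑-reverse : ∀ n f → ∑ n f ≈ ∑ n (λ i → f (n ∸ suc i))
  ∑-reverse zero    f = refl
  ∑-reverse (suc n) f = begin
    ∑ (suc n) f                          ≈⟨ ∑-last n f ⟩
    ∑ n f + f n                          ≈⟨ +-comm _ _ ⟩
    f n + ∑ n f                          ≈⟨ +-congˡ (∑-reverse n f) ⟩
    f n + ∑ n (λ i → f (n ∸ suc i))      ∎

  ∣-∑ : ∀ n {x} f → (∀ {i} → i < n → x ∣ f i) → x ∣ ∑ n f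
  ∣-∑ zero    f x∣f = _ ∣0
  ∣-∑ (suc n) f x∣f = ∣x∣y⇒∣x+y (x∣f (s≤s z≤n)) (∣-∑ n (λ i → f (suc i)) (λ i<n → x∣f (s≤s i<n)))

  -- The sum is added to its own reversal.
  ∣-∑-paired : ∀ n {x} f → (∀ i j → i ℕ.+ j ≡ n → x ∣ f i + f j) → x ∣ ∑ (suc n) f + ∑ (suc n) f
  ∣-∑-paired n f x∣f = ∣-respʳ-≈
    (trans (∑-+ (suc n) f (λ i → f (n ∸ i))) (+-congˡ (sym (∑-reverse (suc n) f))))
    (∣-∑ (suc n) _ (λ {i} i≤n → x∣f i (n ∸ i) (ℕ.m+[n∸m]≡n (ℕ.s≤s⁻¹ i≤n))))

module Signs {c ℓ : Level} (R : CommutativeRing c ℓ) where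

  open Base R

  [-1]^even : ∀ g → (- 1#) ^ (2 ℕ.* g) ≈ 1#
  [-1]^even g = begin
    (- 1#) ^ (2 ℕ.* g)   ≈⟨ ^-assocʳ (- 1#) 2 g ⟨
    ((- 1#) ^ 2) ^ g     ≈⟨ ^-congˡ g (trans (-1*x≈-x _) (trans (-‿cong (*-identityʳ _)) (-‿involutive 1#))) ⟩
    1# ^ g               ≈⟨ 1^ g ⟩
    1#                   ∎

  [-1]^odd : ∀ g → (- 1#) ^ (1 ℕ.+ 2 ℕ.* g) ≈ - 1#
  [-1]^odd g = trans (*-congˡ ([-1]^even g)) (*-identityʳ _)

  -- The sequences i ↦ ± (-1)^i q^C(i-n,2) satisfy this, and the equation
  -- involves no negative exponent.
  Alternating : Carrier → ℕ → (ℕ → Carrier) → Set ℓ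
  Alternating q n ε = ∀ i → q ^ n * ε (suc i) ≈ - (q ^ i * ε i)

-- Gaussian binomials and signed powers at a root of unity

module RootOfUnity
  {c ℓ : Level} (R : CommutativeRing c ℓ) (q : CommutativeRing.Carrier R) (d′ : ℕ)
  (isRoot : Gauss.IsRootOfUnity R q (suc d′)) where

  open Base R
  open Gauss R q
  open IsRootOfUnity isRoot
  open Sums R
  open Signs R

  private
    d : ℕ
    d = suc d′
    G : ℕ → ℕ → Carrier
    G = gauss

  q^[k+d] : ∀ k → q ^ (k ℕ.+ d) ≈ q ^ k
  q^[k+d] k = trans (^-homo-* q k d) (trans (*-congˡ q^d≈1) (*-identityʳ _))

  q^[d*k]≈1 : ∀ k → q ^ (d ℕ.* k) ≈ 1#
  q^[d*k]≈1 k = trans (sym (^-assocʳ q d k)) (trans (^-congˡ k q^d≈1) (1^ k))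

  gauss-shift-low : ∀ m k → k < d → G (m ℕ.+ d) k ≈ G m k
  gauss-shift-low m       zero    _   = refl
  gauss-shift-low zero    (suc k) k<d = gauss-d≈0 k k<d
  gauss-shift-low (suc m) (suc k) k<d =
    +-cong (gauss-shift-low m k (ℕ.<-trans (ℕ.n<1+n k) k<d)) (*-congˡ (gauss-shift-low m (suc k) k<d))

  -- (1 + z)^d ≡ 1 + z^d in the q-Vandermonde identity.
  gauss-shift : ∀ m k → G (m ℕ.+ d) (k ℕ.+ d) ≈ G m (k ℕ.+ d) + G m k
  gauss-shift zero    zero    = trans (gauss-diagonal d) (sym (+-identityˡ 1#))
  gauss-shift zero    (suc k) =
    trans (gauss-zero (s≤s (ℕ.m≤n+m d k))) (sym (+-identityˡ 0#))
  gauss-shift (suc m) zero    = begin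
    G (m ℕ.+ d) d′ + q ^ d * G (m ℕ.+ d) d
      ≈⟨ +-cong (gauss-shift-low m d′ (ℕ.n<1+n d′)) (*-congˡ (gauss-shift m zero)) ⟩
    G m d′ + q ^ d * (G m d + 1#)
      ≈⟨ solve 3 (λ x y z → x :+ y :* (z :+ con 1) := x :+ y :* z :+ y) refl _ _ _ ⟩
    G m d′ + q ^ d * G m d + q ^ d
      ≈⟨ +-congˡ q^d≈1 ⟩
    G (suc m) d + 1# ∎
  gauss-shift (suc m) (suc k) = begin
    G (m ℕ.+ d) (k ℕ.+ d) + q ^ (suc k ℕ.+ d) * G (m ℕ.+ d) (suc k ℕ.+ d)
      ≈⟨ +-cong (gauss-shift m k) (*-congˡ (gauss-shift m (suc k))) ⟩
    (G m (k ℕ.+ d) + G m k) + q ^ (suc k ℕ.+ d) * (G m (suc k ℕ.+ d) + G m (suc k))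
      ≈⟨ solve 5 (λ a b x y z → (a :+ b) :+ x :* (y :+ z) := (a :+ x :* y) :+ (b :+ x :* z)) refl _ _ _ _ _ ⟩
    G (suc m) (suc k ℕ.+ d) + (G m k + q ^ (suc k ℕ.+ d) * G m (suc k))
      ≈⟨ +-congˡ (+-congˡ (*-congʳ (q^[k+d] (suc k)))) ⟩
    G (suc m) (suc k ℕ.+ d) + G (suc m) (suc k) ∎

  module _ {b c : ℕ} (c<d : c < d) where

    private
      g : ℕ → ℕ → Carrier
      g M j = G (M ℕ.* d ℕ.+ b) (j ℕ.* d ℕ.+ c)
      rotate : ∀ M b → suc M ℕ.* d ℕ.+ b ≡ M ℕ.* d ℕ.+ b ℕ.+ d
      rotate M b = ≡.trans (ℕ.+-assoc d _ b) (ℕ.+-comm d _)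

    digits-low : ∀ M → g (suc M) 0 ≈ g M 0
    digits-low M = trans (reflexive (≡.cong (λ m → G m c) (rotate M b)))
      (gauss-shift-low (M ℕ.* d ℕ.+ b) c c<d)

    -- This is the form of q-Lucas that is used: with the low digits `b` and `c` fixed, the high
    -- digits obey the ordinary Pascal rule, so that facts about the row `M = 0` spread to all rows.
    digits-step : ∀ M j → g (suc M) (suc j) ≈ g M (suc j) + g M j
    digits-step M j = trans (reflexive (≡.cong₂ G (rotate M b) (rotate j c)))
      (trans (gauss-shift (M ℕ.* d ℕ.+ b) (j ℕ.* d ℕ.+ c))
        (+-congʳ (reflexive (≡.cong (G (M ℕ.* d ℕ.+ b)) (≡.sym (rotate j c))))))

    digits-zero : b < c → ∀ M j → g M j ≈ 0#
    digits-zero b<c zero    j    = gauss-zero (ℕ.<-≤-trans b<c (ℕ.m≤n+m c (j ℕ.* d)))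
    digits-zero b<c (suc M) zero = trans (digits-low M) (digits-zero b<c M 0)
    digits-zero b<c (suc M) (suc j) = trans (digits-step M j)
      (trans (+-cong (digits-zero b<c M (suc j)) (digits-zero b<c M j)) (+-identityˡ 0#))

    digits-edge : b < d → ∀ M → g M 0 ≈ g M M → g (suc M) 0 ≈ g (suc M) (suc M)
    digits-edge b<d M eq = begin
      g (suc M) 0          ≈⟨ digits-low M ⟩
      g M 0                ≈⟨ eq ⟩
      g M M                ≈⟨ +-identityˡ _ ⟨
      0# + g M M           ≈⟨ +-congʳ (gauss-zero M<) ⟨
      g M (suc M) + g M M  ≈⟨ digits-step M M ⟨
      g (suc M) (suc M)    ∎
      where
      M< : M ℕ.* d ℕ.+ b < suc M ℕ.* d ℕ.+ c
      M< = ℕ.<-≤-trans (≡.subst (M ℕ.* d ℕ.+ b <_) (ℕ.+-comm _ d) (ℕ.+-monoʳ-< (M ℕ.* d) b<d))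
             (ℕ.m≤m+n (suc M ℕ.* d) c)

    -- Pascal's rule is symmetric, and `digits-edge` settles the two ends of a row. Only the high
    -- digit is reflected; the low digit `c` stays.
    digits-symmetric : b < d → ∀ M j j′ → j ℕ.+ j′ ≡ M → g M j ≈ g M j′
    digits-symmetric b<d zero zero zero _ = refl
    digits-symmetric b<d (suc M) zero (suc j′) ≡.refl =
      digits-edge b<d M (digits-symmetric b<d M 0 M ≡.refl)
    digits-symmetric b<d (suc M) (suc j) zero eq with ≡.trans (ℕ.+-comm 0 j) (ℕ.suc-injective eq)
    ... | ≡.refl = sym (digits-edge b<d M (digits-symmetric b<d M 0 M ≡.refl))
    digits-symmetric b<d (suc M) (suc j) (suc j′) eq = begin
      g (suc M) (suc j)      ≈⟨ digits-step M j ⟩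
      g M (suc j) + g M j    ≈⟨ +-cong
        (digits-symmetric b<d M (suc j) j′ (≡.trans (≡.sym (ℕ.+-suc j j′)) (ℕ.suc-injective eq)))
        (digits-symmetric b<d M j (suc j′) (ℕ.suc-injective eq)) ⟩
      g M j′ + g M (suc j′)  ≈⟨ +-comm _ _ ⟩
      g M (suc j′) + g M j′  ≈⟨ digits-step M j′ ⟨
      g (suc M) (suc j′)     ∎

  -- For even `d` the exponent is d/2 times an odd number and the sign is 1; for odd `d` the
  -- exponent is a multiple of `d` and the sign is -1.
  [-1]^d*q^triangle : (- 1#) ^ d * q ^ triangle d ≈ - 1#
  [-1]^d*q^triangle with parity d
  ... | zero  , inj₁ ()
  ... | suc g , inj₁ d≡2g = begin
    (- 1#) ^ d * q ^ triangle d
      ≡⟨ ≡.cong (λ k → (- 1#) ^ k * q ^ triangle k) d≡2g ⟩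
    (- 1#) ^ (2 ℕ.* suc g) * q ^ triangle (2 ℕ.* suc g)
      ≈⟨ *-cong ([-1]^even (suc g)) (reflexive (≡.cong (q ^_) (triangle-even g))) ⟩
    1# * q ^ (suc g ℕ.* (1 ℕ.+ 2 ℕ.* g))
      ≈⟨ *-identityˡ _ ⟩
    q ^ (suc g ℕ.* (1 ℕ.+ 2 ℕ.* g))
      ≈⟨ ^-assocʳ q (suc g) (1 ℕ.+ 2 ℕ.* g) ⟨
    (q ^ suc g) ^ (1 ℕ.+ 2 ℕ.* g)
      ≈⟨ ^-congˡ (1 ℕ.+ 2 ℕ.* g) (q^[d/2]≈-1 (suc g) d≡2g) ⟩
    (- 1#) ^ (1 ℕ.+ 2 ℕ.* g)
      ≈⟨ [-1]^odd g ⟩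
    - 1# ∎
  ... | g , inj₂ d≡1+2g = begin
    (- 1#) ^ d * q ^ triangle d
      ≡⟨ ≡.cong₂ (λ k l → (- 1#) ^ k * q ^ l) d≡1+2g
           (≡.trans (≡.cong triangle d≡1+2g)
             (≡.trans (triangle-odd g) (≡.cong (ℕ._* g) (≡.sym d≡1+2g)))) ⟩
    (- 1#) ^ (1 ℕ.+ 2 ℕ.* g) * q ^ (d ℕ.* g)
      ≈⟨ *-cong ([-1]^odd g) (q^[d*k]≈1 g) ⟩
    - 1# * 1#
      ≈⟨ *-identityʳ _ ⟩
    - 1# ∎

  module _ {n : ℕ} {ε : ℕ → Carrier} (alternating : Alternating q n ε) where

    -- A step from index j contributes -q^j, and i, ..., i + m - 1 add up to m i + C(m,2).
    alternating-steps : ∀ m i →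
      q ^ (n ℕ.* m) * ε (m ℕ.+ i) ≈ (- 1#) ^ m * q ^ (m ℕ.* i ℕ.+ triangle m) * ε i
    alternating-steps zero i rewrite ℕ.*-zeroʳ n = *-congʳ (sym (*-identityˡ 1#))
    alternating-steps (suc m) i = begin
      q ^ (n ℕ.* suc m) * ε (suc (m ℕ.+ i))
        ≈⟨ *-congʳ (trans (reflexive (≡.cong (q ^_) (ℕ.*-suc n m))) (^-homo-* q n (n ℕ.* m))) ⟩
      q ^ n * q ^ (n ℕ.* m) * ε (suc (m ℕ.+ i))
        ≈⟨ solve 3 (λ x y z → x :* y :* z := y :* (x :* z)) refl _ _ _ ⟩
      q ^ (n ℕ.* m) * (q ^ n * ε (suc (m ℕ.+ i)))
        ≈⟨ *-congˡ (trans (alternating (m ℕ.+ i)) (sym (-1*x≈-x _))) ⟩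
      q ^ (n ℕ.* m) * (- 1# * (q ^ (m ℕ.+ i) * ε (m ℕ.+ i)))
        ≈⟨ solve 4 (λ x y z w → x :* (y :* (z :* w)) := y :* z :* (x :* w)) refl _ _ _ _ ⟩
      - 1# * q ^ (m ℕ.+ i) * (q ^ (n ℕ.* m) * ε (m ℕ.+ i))
        ≈⟨ *-congˡ (alternating-steps m i) ⟩
      - 1# * q ^ (m ℕ.+ i) * ((- 1#) ^ m * q ^ (m ℕ.* i ℕ.+ triangle m) * ε i)
        ≈⟨ solve 5 (λ a b c d e → a :* b :* (c :* d :* e) := a :* c :* (b :* d) :* e) refl _ _ _ _ _ ⟩
      (- 1#) ^ suc m * (q ^ (m ℕ.+ i) * q ^ (m ℕ.* i ℕ.+ triangle m)) * ε i
        ≈⟨ *-congʳ (*-congˡ (trans (sym (^-homo-* q (m ℕ.+ i) _)) (reflexive (≡.cong (q ^_)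
             (+-*-Solver.solve 3 (λ m i t → (m ⊕ i) ⊕ (m ⊗ i ⊕ t) ⊜ (i ⊕ m ⊗ i) ⊕ (t ⊕ m))
               ≡.refl m i (triangle m)))))) ⟩
      (- 1#) ^ suc m * q ^ (suc m ℕ.* i ℕ.+ triangle (suc m)) * ε i ∎
      where open +-*-Solver using () renaming (_:+_ to _⊕_; _:*_ to _⊗_; _:=_ to _⊜_)

    alternating-d : ∀ i → ε (d ℕ.+ i) ≈ - ε i
    alternating-d i = begin
      ε (d ℕ.+ i)
        ≈⟨ *-identityˡ _ ⟨
      1# * ε (d ℕ.+ i)
        ≈⟨ *-congʳ (trans (reflexive (≡.cong (q ^_) (ℕ.*-comm n d))) (q^[d*k]≈1 n)) ⟨
      q ^ (n ℕ.* d) * ε (d ℕ.+ i)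
        ≈⟨ alternating-steps d i ⟩
      (- 1#) ^ d * q ^ (d ℕ.* i ℕ.+ triangle d) * ε i
        ≈⟨ *-congʳ (*-congˡ (trans (^-homo-* q (d ℕ.* i) (triangle d))
             (trans (*-congʳ (q^[d*k]≈1 i)) (*-identityˡ _)))) ⟩
      (- 1#) ^ d * q ^ triangle d * ε i
        ≈⟨ *-congʳ [-1]^d*q^triangle ⟩
      - 1# * ε i
        ≈⟨ -1*x≈-x _ ⟩
      - ε i ∎

    alternating-blocks : ∀ p i → ε (p ℕ.* d ℕ.+ i) ≈ (- 1#) ^ p * ε i
    alternating-blocks zero    i = sym (*-identityˡ _)
    alternating-blocks (suc p) i = begin
      ε (d ℕ.+ p ℕ.* d ℕ.+ i)    ≡⟨ ≡.cong ε (ℕ.+-assoc d _ i) ⟩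
      ε (d ℕ.+ (p ℕ.* d ℕ.+ i))  ≈⟨ alternating-d _ ⟩
      - ε (p ℕ.* d ℕ.+ i)        ≈⟨ -‿cong (alternating-blocks p i) ⟩
      - ((- 1#) ^ p * ε i)       ≈⟨ -1*x≈-x _ ⟨
      - 1# * ((- 1#) ^ p * ε i)  ≈⟨ *-assoc _ _ _ ⟨
      (- 1#) ^ suc p * ε i       ∎

    -- An odd sum makes the parities of `p` and `p′` opposite, and each block of length `d`
    -- contributes a factor -1.
    alternating-cancel : ∀ {p p′} w i → p ℕ.+ p′ ≡ 1 ℕ.+ 2 ℕ.* w →
                         ε (p ℕ.* d ℕ.+ i) + ε (p′ ℕ.* d ℕ.+ i) ≈ 0#
    alternating-cancel {p} {p′} w i p+p′≡1+2w = begin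
      ε (p ℕ.* d ℕ.+ i) + ε (p′ ℕ.* d ℕ.+ i)
        ≈⟨ +-cong (alternating-blocks p i) (alternating-blocks p′ i) ⟩
      (- 1#) ^ p * ε i + (- 1#) ^ p′ * ε i
        ≈⟨ +-congˡ (*-congʳ opposite) ⟩
      (- 1#) ^ p * ε i + - 1# * (- 1#) ^ p * ε i
        ≈⟨ +-congˡ (trans (*-assoc _ _ _) (-1*x≈-x _)) ⟩
      (- 1#) ^ p * ε i - (- 1#) ^ p * ε i
        ≈⟨ -‿inverseʳ _ ⟩
      0# ∎
      where
      opposite : (- 1#) ^ p′ ≈ - 1# * (- 1#) ^ p
      opposite = begin
        (- 1#) ^ p′                          ≈⟨ *-identityˡ _ ⟨
        1# * (- 1#) ^ p′                     ≈⟨ *-congʳ ([-1]^even p) ⟨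
        (- 1#) ^ (2 ℕ.* p) * (- 1#) ^ p′     ≈⟨ ^-homo-* (- 1#) (2 ℕ.* p) p′ ⟨
        (- 1#) ^ (2 ℕ.* p ℕ.+ p′)            ≡⟨ ≡.cong ((- 1#) ^_)
          (≡.trans (+-*-Solver.solve 2 (λ p p′ → con′ 2 ⊗ p ⊕ p′ ⊜ (p ⊕ p′) ⊕ p) ≡.refl p p′)
            (≡.cong (ℕ._+ p) p+p′≡1+2w)) ⟩
        (- 1#) ^ (1 ℕ.+ 2 ℕ.* w ℕ.+ p)       ≈⟨ ^-homo-* (- 1#) (1 ℕ.+ 2 ℕ.* w) p ⟩
        (- 1#) ^ (1 ℕ.+ 2 ℕ.* w) * (- 1#) ^ p ≈⟨ *-congʳ ([-1]^odd w) ⟩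
        - 1# * (- 1#) ^ p                    ∎
        where open +-*-Solver using () renaming (_:+_ to _⊕_; _:*_ to _⊗_; _:=_ to _⊜_; con to con′)

-- The sums, and the cancellation of blocks modulo Φ_d

module Terms {c ℓ : Level} (R : CommutativeRing c ℓ) (q : CommutativeRing.Carrier R) where

  open Base R

  open Gauss R q
  open Sums R

  weighted : ℕ → ℕ → ℕ → Carrier → Carrier → Carrier → Carrier → Carrier
  weighted r s t ε x y z = ε * x ^ r * y ^ s * z ^ t

  -- The summand of index k = i - n.  S₆ is the case a = 2 and S₈ the case a = 3.
  term : (a n r s t : ℕ) → (ℕ → Carrier) → ℕ → Carrier
  term a n r s t ε i = weighted r s t (ε i)
    (gauss (2 ℕ.* suc a ℕ.* n) (a ℕ.* n ℕ.+ i)) (gauss (4 ℕ.* n) (n ℕ.+ i)) (gauss (2 ℕ.* n) i)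

  S : (a n r s t : ℕ) → (ℕ → Carrier) → Carrier
  S a n r s t ε = ∑ (suc (2 ℕ.* n)) (term a n r s t ε)

  private
    0^ : ∀ {r} → 0 < r → 0# ^ r ≈ 0#
    0^ {suc r} _ = zeroˡ _

  module _ (r s t : ℕ) where

    weighted-cong : ∀ {ε x x′ y y′ z z′} → x ≈ x′ → y ≈ y′ → z ≈ z′ →
                    weighted r s t ε x y z ≈ weighted r s t ε x′ y′ z′
    weighted-cong x≈x′ y≈y′ z≈z′ =
      *-cong (*-cong (*-congˡ (^-congˡ r x≈x′)) (^-congˡ s y≈y′)) (^-congˡ t z≈z′)

    weighted-+ : ∀ {ε ε′ x y z} → weighted r s t ε x y z + weighted r s t ε′ x y z ≈
                 (ε + ε′) * (x ^ r * y ^ s * z ^ t)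
    weighted-+ {ε} {ε′} {x} {y} {z} =
      solve 5 (λ ε ε′ x y z → ε :* x :* y :* z :+ ε′ :* x :* y :* z := (ε :+ ε′) :* (x :* y :* z))
        refl ε ε′ (x ^ r) (y ^ s) (z ^ t)

    weighted-zero₁ : ∀ {ε x y z} → 0 < r → x ≈ 0# → weighted r s t ε x y z ≈ 0#
    weighted-zero₁ {ε} {x} {y} {z} 0<r x≈0 = begin
      ε * x ^ r * y ^ s * z ^ t   ≈⟨ *-congʳ (*-congʳ (*-congˡ (trans (^-congˡ r x≈0) (0^ 0<r)))) ⟩
      ε * 0# * y ^ s * z ^ t      ≈⟨ *-congʳ (*-congʳ (zeroʳ ε)) ⟩
      0# * y ^ s * z ^ t          ≈⟨ trans (*-congʳ (zeroˡ _)) (zeroˡ _) ⟩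
      0#                          ∎

    weighted-zero₃ : ∀ {ε x y z} → 0 < t → z ≈ 0# → weighted r s t ε x y z ≈ 0#
    weighted-zero₃ 0<t z≈0 = trans (*-congˡ (trans (^-congˡ t z≈0) (0^ 0<t))) (zeroʳ _)

-- The case e = d - n mod d with 2(a+1)e ≤ d, written so that no subtraction occurs.
module BlockIndices
  (a′ w b e′ : ℕ) {d n : ℕ} (d≡ : d ≡ b ℕ.+ 2 ℕ.* suc (suc a′) ℕ.* suc e′)
  (n≡ : n ≡ w ℕ.* d ℕ.+ (b ℕ.+ (1 ℕ.+ 2 ℕ.* suc a′) ℕ.* suc e′)) where

  open +-*-Solver

  private
    a e : ℕ
    a = suc a′
    e = suc e′
    subst₂ : ∀ (P : ℕ → ℕ → Set) →
             P (b ℕ.+ 2 ℕ.* suc a ℕ.* e) (w ℕ.* (b ℕ.+ 2 ℕ.* suc a ℕ.* e) ℕ.+ (b ℕ.+ (1 ℕ.+ 2 ℕ.* a) ℕ.* e)) →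
             P d n
    subst₂ P p rewrite n≡ | d≡ = p

  -- Since n = (w + 1)d - e, the `top` and `bottom` identities are base-d expansions of the upper
  -- and lower indices. The low digit here is d - 2(a + 1)e = b.
  top₁ : 2 ℕ.* suc a ℕ.* n ≡ (1 ℕ.+ 2 ℕ.* a ℕ.+ 2 ℕ.* suc a ℕ.* w) ℕ.* d ℕ.+ b
  top₁ = subst₂ (λ d n → 2 ℕ.* suc a ℕ.* n ≡ (1 ℕ.+ 2 ℕ.* a ℕ.+ 2 ℕ.* suc a ℕ.* w) ℕ.* d ℕ.+ b)
    (solve 4 (λ a w b e → let d = b :+ con 2 :* (con 1 :+ a) :* e
                              n = w :* d :+ (b :+ (con 1 :+ con 2 :* a) :* e) in
      con 2 :* (con 1 :+ a) :* n := (con 1 :+ con 2 :* a :+ con 2 :* (con 1 :+ a) :* w) :* d :+ b)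
      ≡.refl a w b e)

  top₂ : 4 ℕ.* n ≡ (3 ℕ.+ 4 ℕ.* w) ℕ.* d ℕ.+ (b ℕ.+ 2 ℕ.* a′ ℕ.* e)
  top₂ = subst₂ (λ d n → 4 ℕ.* n ≡ (3 ℕ.+ 4 ℕ.* w) ℕ.* d ℕ.+ (b ℕ.+ 2 ℕ.* a′ ℕ.* e))
    (solve 4 (λ a′ w b e → let a = con 1 :+ a′
                               d = b :+ con 2 :* (con 1 :+ a) :* e
                               n = w :* d :+ (b :+ (con 1 :+ con 2 :* a) :* e) in
      con 4 :* n := (con 3 :+ con 4 :* w) :* d :+ (b :+ con 2 :* a′ :* e))
      ≡.refl a′ w b e)

  top₃ : 2 ℕ.* n ≡ (1 ℕ.+ 2 ℕ.* w) ℕ.* d ℕ.+ (b ℕ.+ 2 ℕ.* a ℕ.* e)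
  top₃ = subst₂ (λ d n → 2 ℕ.* n ≡ (1 ℕ.+ 2 ℕ.* w) ℕ.* d ℕ.+ (b ℕ.+ 2 ℕ.* a ℕ.* e))
    (solve 4 (λ a w b e → let d = b :+ con 2 :* (con 1 :+ a) :* e
                              n = w :* d :+ (b :+ (con 1 :+ con 2 :* a) :* e) in
      con 2 :* n := (con 1 :+ con 2 :* w) :* d :+ (b :+ con 2 :* a :* e))
      ≡.refl a w b e)

  -- Writing i = ae + pd + x makes `x` the low digit of the first lower index. Then k = i - n equals
  -- (p - w - 1)d + (a + 1)e + x, so that u ↦ -1 - u becomes p ↦ 1 + 2w - p.
  bottom₁ : ∀ p x → a ℕ.* n ℕ.+ (a ℕ.* e ℕ.+ (p ℕ.* d ℕ.+ x)) ≡ (a ℕ.* suc w ℕ.+ p) ℕ.* d ℕ.+ x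
  bottom₁ p x = subst₂ (λ d n → a ℕ.* n ℕ.+ (a ℕ.* e ℕ.+ (p ℕ.* d ℕ.+ x)) ≡ (a ℕ.* suc w ℕ.+ p) ℕ.* d ℕ.+ x)
    (solve 6 (λ a w b e p x → let d = b :+ con 2 :* (con 1 :+ a) :* e
                                  n = w :* d :+ (b :+ (con 1 :+ con 2 :* a) :* e) in
      a :* n :+ (a :* e :+ (p :* d :+ x)) := (a :* (con 1 :+ w) :+ p) :* d :+ x)
      ≡.refl a w b e p x)

  bottom₂ : ∀ p x → n ℕ.+ (a ℕ.* e ℕ.+ (p ℕ.* d ℕ.+ x)) ≡ (suc w ℕ.+ p) ℕ.* d ℕ.+ (x ℕ.+ a′ ℕ.* e)
  bottom₂ p x = subst₂ (λ d n → n ℕ.+ (a ℕ.* e ℕ.+ (p ℕ.* d ℕ.+ x)) ≡ (suc w ℕ.+ p) ℕ.* d ℕ.+ (x ℕ.+ a′ ℕ.* e))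
    (solve 6 (λ a′ w b e p x → let a = con 1 :+ a′
                                   d = b :+ con 2 :* (con 1 :+ a) :* e
                                   n = w :* d :+ (b :+ (con 1 :+ con 2 :* a) :* e) in
      n :+ (a :* e :+ (p :* d :+ x)) := ((con 1 :+ w) :+ p) :* d :+ (x :+ a′ :* e))
      ≡.refl a′ w b e p x)

  bottom₃ : ∀ p x → a ℕ.* e ℕ.+ (p ℕ.* d ℕ.+ x) ≡ p ℕ.* d ℕ.+ (x ℕ.+ a ℕ.* e)
  bottom₃ p x = solve 3 (λ u v x → u :+ (v :+ x) := v :+ (x :+ u)) ≡.refl (a ℕ.* e) (p ℕ.* d) x

  bottom₁-initial : ∀ i → a ℕ.* n ℕ.+ i ≡ (a ℕ.* w ℕ.+ a′) ℕ.* d ℕ.+ (b ℕ.+ (2 ℕ.+ a) ℕ.* e ℕ.+ i)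
  bottom₁-initial i = subst₂ (λ d n → a ℕ.* n ℕ.+ i ≡ (a ℕ.* w ℕ.+ a′) ℕ.* d ℕ.+ (b ℕ.+ (2 ℕ.+ a) ℕ.* e ℕ.+ i))
    (solve 5 (λ a′ w b e i → let a = con 1 :+ a′
                                 d = b :+ con 2 :* (con 1 :+ a) :* e
                                 n = w :* d :+ (b :+ (con 1 :+ con 2 :* a) :* e) in
      a :* n :+ i := (a :* w :+ a′) :* d :+ (b :+ (con 2 :+ a) :* e :+ i))
      ≡.refl a′ w b e i)

  -- After the first `ae` indices, 2w + 2 blocks of length `d` cover the range and overshoot it; the
  -- excess terms vanish by `term-beyond`.
  length : a ℕ.* e ℕ.+ (2 ℕ.+ 2 ℕ.* w) ℕ.* d ≡ suc (2 ℕ.* n) ℕ.+ (e′ ℕ.+ suc a ℕ.* e)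
  length = subst₂ (λ d n → a ℕ.* e ℕ.+ (2 ℕ.+ 2 ℕ.* w) ℕ.* d ≡ suc (2 ℕ.* n) ℕ.+ (e′ ℕ.+ suc a ℕ.* e))
    (solve 4 (λ a w b e′ → let e = con 1 :+ e′
                               d = b :+ con 2 :* (con 1 :+ a) :* e
                               n = w :* d :+ (b :+ (con 1 :+ con 2 :* a) :* e) in
      a :* e :+ (con 2 :+ con 2 :* w) :* d := (con 1 :+ con 2 :* n) :+ (e′ :+ (con 1 :+ a) :* e))
      ≡.refl a w b e′)

  reflect₁ : ∀ p p′ → p ℕ.+ p′ ≡ 1 ℕ.+ 2 ℕ.* w →
             (a ℕ.* suc w ℕ.+ p) ℕ.+ (a ℕ.* suc w ℕ.+ p′) ≡ 1 ℕ.+ 2 ℕ.* a ℕ.+ 2 ℕ.* suc a ℕ.* w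
  reflect₁ p p′ eq = ≡.trans
    (solve 3 (λ x p p′ → (x :+ p) :+ (x :+ p′) := (p :+ p′) :+ con 2 :* x) ≡.refl (a ℕ.* suc w) p p′)
    (≡.trans (≡.cong (ℕ._+ 2 ℕ.* (a ℕ.* suc w)) eq)
      (solve 2 (λ a w → (con 1 :+ con 2 :* w) :+ con 2 :* (a :* (con 1 :+ w)) :=
         con 1 :+ con 2 :* a :+ con 2 :* (con 1 :+ a) :* w) ≡.refl a w))

  reflect₂ : ∀ p p′ → p ℕ.+ p′ ≡ 1 ℕ.+ 2 ℕ.* w → (suc w ℕ.+ p) ℕ.+ (suc w ℕ.+ p′) ≡ 3 ℕ.+ 4 ℕ.* w
  reflect₂ p p′ eq = ≡.trans
    (solve 3 (λ x p p′ → (x :+ p) :+ (x :+ p′) := (p :+ p′) :+ con 2 :* x) ≡.refl (suc w) p p′)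
    (≡.trans (≡.cong (ℕ._+ 2 ℕ.* suc w) eq)
      (solve 1 (λ w → (con 1 :+ con 2 :* w) :+ con 2 :* (con 1 :+ w) := con 3 :+ con 4 :* w) ≡.refl w))

  b+ke<d : ∀ {k x} → k < 2 ℕ.* suc a → x ≤ b → x ℕ.+ k ℕ.* e < d
  b+ke<d {k} {x} k<2a+2 x≤b = ≡.subst (x ℕ.+ k ℕ.* e <_) (≡.sym d≡)
    (ℕ.+-mono-≤-< x≤b (ℕ.*-monoˡ-< e k<2a+2))

  2a<2a+2 : 2 ℕ.* a < 2 ℕ.* suc a
  2a<2a+2 = ℕ.*-monoʳ-< 2 (ℕ.n<1+n a)

  b<d : b < d
  b<d = ≡.subst (_< d) (ℕ.+-identityʳ b) (b+ke<d {0} (s≤s z≤n) ℕ.≤-refl)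

  initial<d : ∀ {i} → i < a ℕ.* e → b ℕ.+ (2 ℕ.+ a) ℕ.* e ℕ.+ i < d
  initial<d {i} i<ae = ≡.subst (b ℕ.+ (2 ℕ.+ a) ℕ.* e ℕ.+ i <_)
    (≡.trans (solve 3 (λ a b e → b :+ (con 2 :+ a) :* e :+ a :* e := b :+ con 2 :* (con 1 :+ a) :* e)
        ≡.refl a b e) (≡.sym d≡))
    (ℕ.+-monoʳ-< (b ℕ.+ (2 ℕ.+ a) ℕ.* e) i<ae)

module Blocks
  {c ℓ : Level} (R : CommutativeRing c ℓ) (q : CommutativeRing.Carrier R) (d′ : ℕ)
  (isRoot : Gauss.IsRootOfUnity R q (suc d′)) (a′ w b e′ : ℕ) {n : ℕ}
  (d≡ : suc d′ ≡ b ℕ.+ 2 ℕ.* suc (suc a′) ℕ.* suc e′)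
  (n≡ : n ≡ w ℕ.* suc d′ ℕ.+ (b ℕ.+ (1 ℕ.+ 2 ℕ.* suc a′) ℕ.* suc e′))
  (r s t : ℕ) (0<r : 0 < r) (0<t : 0 < t)
  {ε : ℕ → CommutativeRing.Carrier R} (alternating : Signs.Alternating R q n ε)
  where

  open Base R
  open Gauss R q using (gauss; gauss-zero)
  open Sums R
  open Terms R q
  open RootOfUnity R q d′ isRoot
  open BlockIndices a′ w b e′ d≡ n≡

  private
    a e d : ℕ
    a = suc a′
    e = suc e′
    d = suc d′
    T : ℕ → Carrier
    T = term a n r s t ε
    G : ℕ → ℕ → Carrier
    G = gauss

  -- Ahead of the first block the low digit of the first lower index is at least b + (a + 2)e, above
  -- the low digit `b` of the upper index, so the first binomial vanishes.
  term-initial : ∀ {i} → i < a ℕ.* e → T i ≈ 0#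
  term-initial {i} i<ae = weighted-zero₁ r s t 0<r (trans (reflexive (≡.cong₂ G top₁ (bottom₁-initial i)))
    (digits-zero c<d b<c (1 ℕ.+ 2 ℕ.* a ℕ.+ 2 ℕ.* suc a ℕ.* w) (a ℕ.* w ℕ.+ a′)))
    where
    b<c : b < b ℕ.+ (2 ℕ.+ a) ℕ.* e ℕ.+ i
    b<c = ℕ.<-≤-trans (ℕ.m<m+n b (s≤s z≤n)) (ℕ.m≤m+n _ i)
    c<d : b ℕ.+ (2 ℕ.+ a) ℕ.* e ℕ.+ i < d
    c<d = initial<d i<ae

  term-beyond : ∀ i → T (suc (2 ℕ.* n) ℕ.+ i) ≈ 0#
  term-beyond i = weighted-zero₃ r s t 0<t (gauss-zero {2 ℕ.* n} (s≤s (ℕ.m≤m+n (2 ℕ.* n) i)))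

  term-large : ∀ p {x} → b < x → x < d → T (a ℕ.* e ℕ.+ (p ℕ.* d ℕ.+ x)) ≈ 0#
  term-large p {x} b<x x<d = weighted-zero₁ r s t 0<r
    (trans (reflexive (≡.cong₂ G top₁ (bottom₁ p x)))
      (digits-zero x<d b<x (1 ℕ.+ 2 ℕ.* a ℕ.+ 2 ℕ.* suc a ℕ.* w) (a ℕ.* suc w ℕ.+ p)))

  -- Exchanging the blocks `p` and `p′` reflects the high digits and thus preserves all three
  -- binomials, while the signed power changes its sign.
  term-small : ∀ {p p′ x} → p ℕ.+ p′ ≡ 1 ℕ.+ 2 ℕ.* w → x ≤ b →
               T (a ℕ.* e ℕ.+ (p ℕ.* d ℕ.+ x)) + T (a ℕ.* e ℕ.+ (p′ ℕ.* d ℕ.+ x)) ≈ 0#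
  term-small {p} {p′} {x} eq x≤b = begin
    T (a ℕ.* e ℕ.+ (p ℕ.* d ℕ.+ x)) + T (a ℕ.* e ℕ.+ (p′ ℕ.* d ℕ.+ x))
      ≈⟨ +-congˡ (weighted-cong r s t same₁ same₂ same₃) ⟨
    _ ≈⟨ weighted-+ r s t ⟩
    (ε (a ℕ.* e ℕ.+ (p ℕ.* d ℕ.+ x)) + ε (a ℕ.* e ℕ.+ (p′ ℕ.* d ℕ.+ x))) * _
      ≈⟨ *-congʳ (trans (reflexive (≡.cong₂ (λ i j → ε i + ε j) (bottom₃ p x) (bottom₃ p′ x)))
           (alternating-cancel {n} alternating {p} {p′} w (x ℕ.+ a ℕ.* e) eq)) ⟩
    0# * _
      ≈⟨ zeroˡ _ ⟩
    0# ∎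
    where
    k<2a+2 : ∀ {k} → k ≤ 2 ℕ.* a → k < 2 ℕ.* suc a
    k<2a+2 k≤2a = ℕ.≤-<-trans k≤2a 2a<2a+2
    same₁ : G (2 ℕ.* suc a ℕ.* n) (a ℕ.* n ℕ.+ (a ℕ.* e ℕ.+ (p ℕ.* d ℕ.+ x))) ≈
            G (2 ℕ.* suc a ℕ.* n) (a ℕ.* n ℕ.+ (a ℕ.* e ℕ.+ (p′ ℕ.* d ℕ.+ x)))
    same₁ = trans (reflexive (≡.cong₂ G top₁ (bottom₁ p x)))
      (trans (digits-symmetric (ℕ.≤-<-trans x≤b b<d) b<d (1 ℕ.+ 2 ℕ.* a ℕ.+ 2 ℕ.* suc a ℕ.* w)
                (a ℕ.* suc w ℕ.+ p) (a ℕ.* suc w ℕ.+ p′) (reflect₁ p p′ eq))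
        (reflexive (≡.sym (≡.cong₂ G top₁ (bottom₁ p′ x)))))
    same₂ : G (4 ℕ.* n) (n ℕ.+ (a ℕ.* e ℕ.+ (p ℕ.* d ℕ.+ x))) ≈
            G (4 ℕ.* n) (n ℕ.+ (a ℕ.* e ℕ.+ (p′ ℕ.* d ℕ.+ x)))
    same₂ = trans (reflexive (≡.cong₂ G top₂ (bottom₂ p x)))
      (trans (digits-symmetric (b+ke<d (k<2a+2 (ℕ.≤-trans (ℕ.n≤1+n a′) (ℕ.m≤m+n a _))) x≤b)
                (b+ke<d (k<2a+2 (ℕ.*-monoʳ-≤ 2 (ℕ.n≤1+n a′))) ℕ.≤-refl)
                (3 ℕ.+ 4 ℕ.* w) (suc w ℕ.+ p) (suc w ℕ.+ p′) (reflect₂ p p′ eq))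
        (reflexive (≡.sym (≡.cong₂ G top₂ (bottom₂ p′ x)))))
    same₃ : G (2 ℕ.* n) (a ℕ.* e ℕ.+ (p ℕ.* d ℕ.+ x)) ≈ G (2 ℕ.* n) (a ℕ.* e ℕ.+ (p′ ℕ.* d ℕ.+ x))
    same₃ = trans (reflexive (≡.cong₂ G top₃ (bottom₃ p x)))
      (trans (digits-symmetric (b+ke<d (k<2a+2 (ℕ.m≤m+n a _)) x≤b)
                (b+ke<d 2a<2a+2 ℕ.≤-refl) (1 ℕ.+ 2 ℕ.* w) p p′ eq)
        (reflexive (≡.sym (≡.cong₂ G top₃ (bottom₃ p′ x)))))

  S+S≈0 : S a n r s t ε + S a n r s t ε ≈ 0#
  -- Divisibility by 0 means equality with 0, so the pairing lemma applies with divisor 0.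
  S+S≈0 = trans (+-cong S≈blocks S≈blocks) (0∣x⇒x≈0 (∣-∑-paired (1 ℕ.+ 2 ℕ.* w) B (λ p p′ eq →
    ∣ʳ-reflexive (sym (block-cancel {p} {p′} eq)))))
    where
    B : ℕ → Carrier
    B p = ∑ d (λ x → T (a ℕ.* e ℕ.+ (p ℕ.* d ℕ.+ x)))
    block-cancel : ∀ {p p′} → p ℕ.+ p′ ≡ 1 ℕ.+ 2 ℕ.* w → B p + B p′ ≈ 0#
    block-cancel {p} {p′} eq = trans (sym (∑-+ d (λ x → T (a ℕ.* e ℕ.+ (p ℕ.* d ℕ.+ x)))
        (λ x → T (a ℕ.* e ℕ.+ (p′ ℕ.* d ℕ.+ x))))) (∑-zero d cancels)
      where
      cancels : ∀ {x} → x < d → T (a ℕ.* e ℕ.+ (p ℕ.* d ℕ.+ x)) + T (a ℕ.* e ℕ.+ (p′ ℕ.* d ℕ.+ x)) ≈ 0#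
      cancels {x} x<d with x ℕ.≤? b
      ... | yes x≤b = term-small {p} {p′} eq x≤b
      ... | no  x≰b = trans (+-cong (term-large p (ℕ.≰⇒> x≰b) x<d) (term-large p′ (ℕ.≰⇒> x≰b) x<d)) (+-identityˡ 0#)
    S≈blocks : S a n r s t ε ≈ ∑ (2 ℕ.+ 2 ℕ.* w) B
    S≈blocks = begin
      ∑ (suc (2 ℕ.* n)) T
        ≈⟨ +-identityʳ _ ⟨
      ∑ (suc (2 ℕ.* n)) T + 0#
        ≈⟨ +-congˡ (∑-zero (e′ ℕ.+ suc a ℕ.* e) (λ {i} _ → term-beyond i)) ⟨
      ∑ (suc (2 ℕ.* n)) T + ∑ (e′ ℕ.+ suc a ℕ.* e) (λ i → T (suc (2 ℕ.* n) ℕ.+ i))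
        ≈⟨ ∑-split (suc (2 ℕ.* n)) (e′ ℕ.+ suc a ℕ.* e) T ⟨
      ∑ (suc (2 ℕ.* n) ℕ.+ (e′ ℕ.+ suc a ℕ.* e)) T
        ≡⟨ ≡.cong (λ m → ∑ m T) length ⟨
      ∑ (a ℕ.* e ℕ.+ (2 ℕ.+ 2 ℕ.* w) ℕ.* d) T
        ≈⟨ ∑-split (a ℕ.* e) ((2 ℕ.+ 2 ℕ.* w) ℕ.* d) T ⟩
      ∑ (a ℕ.* e) T + ∑ ((2 ℕ.+ 2 ℕ.* w) ℕ.* d) (λ i → T (a ℕ.* e ℕ.+ i))
        ≈⟨ +-congʳ (∑-zero (a ℕ.* e) term-initial) ⟩
      0# + ∑ ((2 ℕ.+ 2 ℕ.* w) ℕ.* d) (λ i → T (a ℕ.* e ℕ.+ i))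
        ≈⟨ +-identityˡ _ ⟩
      ∑ ((2 ℕ.+ 2 ℕ.* w) ℕ.* d) (λ i → T (a ℕ.* e ℕ.+ i))
        ≈⟨ ∑-blocks (2 ℕ.+ 2 ℕ.* w) d (λ i → T (a ℕ.* e ℕ.+ i)) ⟩
      ∑ (2 ℕ.+ 2 ℕ.* w) B ∎

-- Computation in the quotient ring

module Quotient {c ℓ : Level} (R : CommutativeRing c ℓ) (m : CommutativeRing.Carrier R) where

  open Base R

  infix 4 _≈ₘ_

  _≈ₘ_ : Carrier → Carrier → Set (c ⊔ ℓ)
  x ≈ₘ y = m ∣ x - y

  ≈⇒≈ₘ : ∀ {x y} → x ≈ y → x ≈ₘ y
  ≈⇒≈ₘ {x} {y} x≈y = ∣-respʳ-≈ (sym (trans (+-congʳ x≈y) (-‿inverseʳ y))) (m ∣0)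

  ∣⇒≈ₘ0 : ∀ {x} → m ∣ x → x ≈ₘ 0#
  ∣⇒≈ₘ0 {x} = ∣-respʳ-≈ (sym (trans (+-congˡ -0#≈0#) (+-identityʳ x)))

  ≈ₘ0⇒∣ : ∀ {x} → x ≈ₘ 0# → m ∣ x
  ≈ₘ0⇒∣ {x} = ∣-respʳ-≈ (trans (+-congˡ -0#≈0#) (+-identityʳ x))

  ∣⇒∣- : ∀ {x} → m ∣ x → m ∣ - x
  ∣⇒∣- {x} m∣x = ∣-respʳ-≈ (-1*x≈-x x) (x∣ʳy⇒x∣ʳzy (- 1#) m∣x)

  private
    through : ∀ x y z → (x - y) + (y - z) ≈ x - z
    through x y z = begin
      (x - y) + (y - z)
        ≈⟨ solve 4 (λ x y y′ z′ → (x :+ y′) :+ (y :+ z′) := (y :+ y′) :+ (x :+ z′))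
             refl x y (- y) (- z) ⟩
      (y - y) + (x - z)    ≈⟨ +-congʳ (-‿inverseʳ y) ⟩
      0# + (x - z)         ≈⟨ +-identityˡ _ ⟩
      x - z                ∎

  ≈ₘ-trans : ∀ {x y z} → x ≈ₘ y → y ≈ₘ z → x ≈ₘ z
  ≈ₘ-trans {x} {y} {z} x≈y y≈z = ∣-respʳ-≈ (through x y z) (∣x∣y⇒∣x+y x≈y y≈z)

  ≈ₘ-sym : ∀ {x y} → x ≈ₘ y → y ≈ₘ x
  ≈ₘ-sym {x} {y} x≈y = ∣-respʳ-≈
    (trans (sym (-‿+-comm x (- y))) (trans (+-congˡ (-‿involutive y)) (+-comm (- x) y))) (∣⇒∣- x≈y)

  +-congₘ : ∀ {x y u v} → x ≈ₘ y → u ≈ₘ v → x + u ≈ₘ y + v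
  +-congₘ {x} {y} {u} {v} x≈y u≈v = ∣-respʳ-≈ (begin
    (x - y) + (u - v)
      ≈⟨ solve 4 (λ x y′ u v′ → (x :+ y′) :+ (u :+ v′) := (x :+ u) :+ (y′ :+ v′))
           refl x (- y) u (- v) ⟩
    x + u + (- y - v)    ≈⟨ +-congˡ (-‿+-comm y v) ⟩
    x + u - (y + v)      ∎) (∣x∣y⇒∣x+y x≈y u≈v)

  *-congₘ : ∀ {x y u v} → x ≈ₘ y → u ≈ₘ v → x * u ≈ₘ y * v
  *-congₘ {x} {y} {u} {v} x≈y u≈v = ≈ₘ-trans
    (∣-respʳ-≈ ([y-z]x≈yx-zx u x y) (∣x⇒∣x*y u x≈y))
    (∣-respʳ-≈ (x[y-z]≈xy-xz y u v) (x∣ʳy⇒x∣ʳzy y u≈v))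

  -‿congₘ : ∀ {x y} → x ≈ₘ y → - x ≈ₘ - y
  -‿congₘ {x} {y} x≈y = ∣-respʳ-≈ (sym (-‿+-comm x (- y))) (∣⇒∣- x≈y)

  ring/ : CommutativeRing c (c ⊔ ℓ)
  ring/ = record
    { Carrier = Carrier
    ; _≈_ = _≈ₘ_
    ; _+_ = _+_
    ; _*_ = _*_
    ; -_  = -_
    ; 0#  = 0#
    ; 1#  = 1#
    ; isCommutativeRing = record
      { isRing = record
        { +-isAbelianGroup = record
          { isGroup = record
            { isMonoid = record
              { isSemigroup = record
                { isMagma = record
                  { isEquivalence = record { refl = ≈⇒≈ₘ refl ; sym = ≈ₘ-sym ; trans = ≈ₘ-trans }
                  ; ∙-cong = +-congₘ
                  }
                ; assoc = λ x y z → ≈⇒≈ₘ (+-assoc x y z)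
                }
              ; identity = (λ x → ≈⇒≈ₘ (+-identityˡ x)) , (λ x → ≈⇒≈ₘ (+-identityʳ x))
              }
            ; inverse = (λ x → ≈⇒≈ₘ (-‿inverseˡ x)) , (λ x → ≈⇒≈ₘ (-‿inverseʳ x))
            ; ⁻¹-cong = -‿congₘ
            }
          ; comm = λ x y → ≈⇒≈ₘ (+-comm x y)
          }
        ; *-cong = *-congₘ
        ; *-assoc = λ x y z → ≈⇒≈ₘ (*-assoc x y z)
        ; *-identity = (λ x → ≈⇒≈ₘ (*-identityˡ x)) , (λ x → ≈⇒≈ₘ (*-identityʳ x))
        ; distrib = (λ x y z → ≈⇒≈ₘ (distribˡ x y z)) , (λ x y z → ≈⇒≈ₘ (distribʳ x y z))
        }
      ; *-comm = λ x y → ≈⇒≈ₘ (*-comm x y)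
      }
    }

  private
    module M = Base ring/

  -- The quotient has the same operations, but the functions defined from
  -- them are only propositionally equal because they mention the ring.
  ^-quotient : ∀ x k → x M.^ k ≡ x ^ k
  ^-quotient x zero    = ≡.refl
  ^-quotient x (suc k) = ≡.cong (x *_) (^-quotient x k)

  gauss-quotient : ∀ q k l → Gauss.gauss ring/ q k l ≡ Gauss.gauss R q k l
  gauss-quotient q k       zero    = ≡.refl
  gauss-quotient q zero    (suc l) = ≡.refl
  gauss-quotient q (suc k) (suc l) = ≡.cong₂ _+_ (gauss-quotient q k l)
    (≡.cong₂ _*_ (^-quotient q (suc l)) (gauss-quotient q k (suc l)))

  ∑-quotient : ∀ k {f g} → (∀ i → f i ≡ g i) → Sums.∑ ring/ k f ≡ Sums.∑ R k g
  ∑-quotient zero    f≗g = ≡.refl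
  ∑-quotient (suc k) f≗g = ≡.cong₂ _+_ (f≗g 0) (∑-quotient k (λ i → f≗g (suc i)))

  S-quotient : ∀ q a n r s t ε → Terms.S ring/ q a n r s t ε ≡ Terms.S R q a n r s t ε
  S-quotient q a n r s t ε = ∑-quotient (suc (2 ℕ.* n)) (λ i →
    ≡.cong₂ _*_ (≡.cong₂ _*_ (≡.cong (ε i *_)
      (power (2 ℕ.* suc a ℕ.* n) (a ℕ.* n ℕ.+ i) r))
      (power (4 ℕ.* n) (n ℕ.+ i) s))
      (power (2 ℕ.* n) i t))
    where
    power : ∀ k l r → Gauss.gauss ring/ q k l M.^ r ≡ Gauss.gauss R q k l ^ r
    power k l r = ≡.trans (^-quotient _ r) (≡.cong (_^ r) (gauss-quotient q k l))

  alternating-quotient : ∀ {q n ε} → Signs.Alternating R q n ε → Signs.Alternating ring/ q n ε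
  alternating-quotient {q} {n} {ε} alternating i
    rewrite ^-quotient q n | ^-quotient q i = ≈⇒≈ₘ (alternating i)

module Divisors
  {c ℓ : Level} (R : CommutativeRing c ℓ) (q : CommutativeRing.Carrier R)
  (1-q^m-primitive : Base.PowersPrimitive R q) (N : ℕ) where

  open Base R
  open GaussFactorisation R q 1-q^m-primitive N public
  open Terms R q public
  open Sums R public
  open Signs R public

  -- `1 + q^g` is `geometric 2 (q ^ g)`, and d/2 is a proper divisor of d.
  Φ-half : ∀ {d} g → d < N → suc d ≡ 2 ℕ.* g → Φ d ∣ 1# + q ^ g
  Φ-half {d} (suc g) d<N d≡2g = ∣-respʳ-≈
    (+-congˡ (trans (*-congˡ (trans (+-congˡ (zeroʳ _)) (+-identityʳ 1#))) (*-identityʳ _)))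
    (Φ∣geometric d<N g 2 d≡2g (≡.subst (suc g <_) (≡.sym d≡2g) (ℕ.m<m+n (suc g) (s≤s z≤n))))

  Φ∣gauss-d : ∀ {d} k → d < N → suc k < suc d → Φ d ∣ gauss (suc d) (suc k)
  Φ∣gauss-d {d} k d<N k<d = Φ∣gauss (suc k) (suc d ∸ suc k) eq d<N d<N
    (carry-positive (ℕ.∣-reflexive (≡.sym eq)) (ℕ.>⇒∤ k<d))
    where
    eq : suc k ℕ.+ (suc d ∸ suc k) ≡ suc d
    eq = ℕ.m+[n∸m]≡n (ℕ.<⇒≤ k<d)

  -- The blocks cancel in the ring modulo Φ, where twice the sum is 0; saturation of Φ then removes
  -- the 2.
  Φ∣S-blocks : ∀ a′ w b e′ (let a = suc a′) (let e = suc e′) {d n} (r s t : ℕ) {ε} → d < N →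
               suc d ≡ b ℕ.+ 2 ℕ.* suc a ℕ.* e → n ≡ w ℕ.* suc d ℕ.+ (b ℕ.+ (1 ℕ.+ 2 ℕ.* a) ℕ.* e) →
               0 < r → 0 < t → Alternating q n ε → Φ d ∣ S a n r s t ε
  Φ∣S-blocks a′ w b e′ {d} {n} r s t {ε} d<N d≡ n≡ 0<r 0<t alternating =
    primitive-half (Φ-primitive d<N) (≈ₘ0⇒∣
      (≡.subst (λ x → x + x ≈ₘ 0#) (S-quotient q (suc a′) n r s t ε)
        (Blocks.S+S≈0 ring/ q d isRoot a′ w b e′ d≡ n≡ r s t 0<r 0<t
          (alternating-quotient {n = n} alternating))))
    where
    open Quotient R (Φ d)
    module M = Base ring/
    isRoot : Gauss.IsRootOfUnity ring/ q (suc d)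
    isRoot = record { q^d≈1 = q^d≈1 ; q^[d/2]≈-1 = q^[d/2]≈-1 ; gauss-d≈0 = gauss-d≈0 }
      where
      q^d≈1 : q M.^ suc d ≈ₘ 1#
      q^d≈1 = ≡.subst (_≈ₘ 1#) (≡.sym (^-quotient q (suc d))) (≈ₘ-sym (Φ∣1-q^ d<N))
      q^[d/2]≈-1 : ∀ g → suc d ≡ 2 ℕ.* g → q M.^ g ≈ₘ - 1#
      q^[d/2]≈-1 g d≡2g = ≡.subst (_≈ₘ - 1#) (≡.sym (^-quotient q g))
        (∣-respʳ-≈ (trans (+-comm _ _) (+-congˡ (sym (-‿involutive 1#)))) (Φ-half g d<N d≡2g))
      gauss-d≈0 : ∀ k → suc k < suc d → Gauss.gauss ring/ q (suc d) (suc k) ≈ₘ 0#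
      gauss-d≈0 k k<d = ≡.subst (_≈ₘ 0#) (≡.sym (gauss-quotient q (suc d) (suc k))) (∣⇒≈ₘ0 (Φ∣gauss-d k d<N k<d))

-- Odd multiples and divisors of prime powers

∣-∣-cases : ∀ a b → a ≡ b ℕ.+ ∣ a - b ∣ ⊎ b ≡ a ℕ.+ ∣ a - b ∣
∣-∣-cases a b with ℕ.≤-total a b
... | inj₁ a≤b = inj₂ (≡.sym (≡.trans (≡.cong (a ℕ.+_) (ℕ.m≤n⇒∣m-n∣≡n∸m a≤b)) (ℕ.m+[n∸m]≡n a≤b)))
... | inj₂ b≤a = inj₁ (≡.sym (≡.trans (≡.cong (b ℕ.+_) (ℕ.m≤n⇒∣n-m∣≡n∸m b≤a)) (ℕ.m+[n∸m]≡n b≤a)))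

∣∣m-n∣∣m⇒∣n : ∀ {d} m n → d ℕ.∣ ∣ m - n ∣ → d ℕ.∣ m → d ℕ.∣ n
∣∣m-n∣∣m⇒∣n {d} m n d∣m-n d∣m with ∣-∣-cases m n
... | inj₁ eq = ℕ.∣m+n∣m⇒∣n (≡.subst (d ℕ.∣_) (≡.trans eq (ℕ.+-comm n _)) d∣m) d∣m-n
... | inj₂ eq = ≡.subst (d ℕ.∣_) (≡.sym eq) (ℕ.∣m∣n⇒∣m+n d∣m d∣m-n)

OddMultiple : ℕ → ℕ → Set
OddMultiple g x = ∃ λ m → x ≡ g ℕ.* (1 ℕ.+ 2 ℕ.* m)

-- After division by `g`, an even difference would make the quotient of `y` even as well.
oddMultiple-difference : ∀ {g x y} → 2 ℕ.* g ℕ.∣ x → g ℕ.∣ y → ¬ 2 ℕ.* g ℕ.∣ y → OddMultiple g ∣ x - y ∣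
oddMultiple-difference {g} (ℕ.divides k ≡.refl) (ℕ.divides l ≡.refl) 2g∤y
  with parity ∣ 2 ℕ.* k - l ∣
... | m , inj₁ even = ⊥-elim (2g∤y (ℕ.*-monoˡ-∣ g (∣∣m-n∣∣m⇒∣n (2 ℕ.* k) l
  (≡.subst (2 ℕ.∣_) (≡.sym even) (ℕ.m∣m*n m)) (ℕ.m∣m*n k))))
... | m , inj₂ odd = m , (begin
  ∣ k ℕ.* (2 ℕ.* g) - l ℕ.* g ∣      ≡⟨ ≡.cong (λ x → ∣ x - l ℕ.* g ∣)
    (≡.trans (≡.sym (ℕ.*-assoc k 2 g)) (≡.cong (ℕ._* g) (ℕ.*-comm k 2))) ⟩
  ∣ 2 ℕ.* k ℕ.* g - l ℕ.* g ∣        ≡⟨ ℕ.*-distribʳ-∣-∣ g (2 ℕ.* k) l ⟨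
  ∣ 2 ℕ.* k - l ∣ ℕ.* g              ≡⟨ ≡.cong (ℕ._* g) odd ⟩
  (1 ℕ.+ 2 ℕ.* m) ℕ.* g              ≡⟨ ℕ.*-comm _ g ⟩
  g ℕ.* (1 ℕ.+ 2 ℕ.* m)              ∎)
  where open ≡.≡-Reasoning

module _ {p : ℕ} (p-prime : Prime p) where

  private instance _ = prime⇒nonZero p-prime

  *≡p^⇒≡1⊎p∣ : ∀ k {c d} → c ℕ.* d ≡ p ℕ.^ k → c ≡ 1 ⊎ p ℕ.∣ c
  *≡p^⇒≡1⊎p∣ zero {c} {d} cd≡1 = inj₁ (ℕ.m*n≡1⇒m≡1 c d cd≡1)
  *≡p^⇒≡1⊎p∣ (suc k) {c} {d} cd≡p^
    with euclidsLemma c d p-prime (≡.subst (p ℕ.∣_) (≡.sym cd≡p^) (ℕ.m∣m*n (p ℕ.^ k)))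
  ... | inj₁ p∣c = inj₂ p∣c
  ... | inj₂ (ℕ.divides e ≡.refl) = *≡p^⇒≡1⊎p∣ k (ℕ.*-cancelʳ-≡ (c ℕ.* e) (p ℕ.^ k) p
    (≡.trans (ℕ.*-assoc c e p) (≡.trans cd≡p^ (ℕ.*-comm p (p ℕ.^ k)))))

  -- The cofactor of `d` is 1 or divisible by `p`, and in the latter case one `p` cancels. For
  -- `geometric≈Φ` this isolates the single new divisor.
  ∣p^[1+k]⇒≡⊎∣p^k : ∀ k {d} → d ℕ.∣ p ℕ.^ suc k → d ≡ p ℕ.^ suc k ⊎ d ℕ.∣ p ℕ.^ k
  ∣p^[1+k]⇒≡⊎∣p^k k {d} (ℕ.divides c eq) with *≡p^⇒≡1⊎p∣ (suc k) {c} {d} (≡.sym eq)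
  ... | inj₁ ≡.refl = inj₁ (≡.sym (≡.trans eq (ℕ.*-identityˡ d)))
  ... | inj₂ (ℕ.divides e ≡.refl) = inj₂ (ℕ.divides e (ℕ.*-cancelˡ-≡ (p ℕ.^ k) (e ℕ.* d) p
    (≡.trans eq (≡.trans (≡.cong (ℕ._* d) (ℕ.*-comm e p)) (ℕ.*-assoc p e d)))))

-- Three carry-free additions force inequalities between the ⌊jn/(d+1)⌋, because
-- the summands can be recombined crosswise.
/-cross : ∀ {x x′ y y′ m} d .{{_ : NonZero d}} → x ℕ.+ y′ ≡ m → x′ ℕ.+ y ≡ m →
          (x / d ℕ.+ x′ / d) ℕ.+ (y / d ℕ.+ y′ / d) ≤ 2 ℕ.* (m / d)
/-cross {x} {x′} {y} {y′} {m} d x+y′≡m x′+y≡m = begin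
  (x / d ℕ.+ x′ / d) ℕ.+ (y / d ℕ.+ y′ / d)
    ≡⟨ solve 4 (λ a b c e → (a :+ b) :+ (c :+ e) := (a :+ e) :+ (b :+ c))
         ≡.refl (x / d) (x′ / d) (y / d) (y′ / d) ⟩
  (x / d ℕ.+ y′ / d) ℕ.+ (x′ / d ℕ.+ y / d)
    ≤⟨ ℕ.+-mono-≤ (/-superadditive x y′ d) (/-superadditive x′ y d) ⟩
  (x ℕ.+ y′) / d ℕ.+ (x′ ℕ.+ y) / d
    ≡⟨ ≡.cong₂ (λ u v → u / d ℕ.+ v / d) x+y′≡m x′+y≡m ⟩
  m / d ℕ.+ m / d
    ≡⟨ ≡.cong (m / d ℕ.+_) (ℕ.+-identityʳ (m / d)) ⟨
  2 ℕ.* (m / d) ∎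
  where
  open ℕ.≤-Reasoning
  open +-*-Solver

-- Carry-free summands and inequalities between floors

module Multiples (n d : ℕ) where

  D = suc d

  ⌊_n⌋ : ℕ → ℕ
  ⌊ j n⌋ = (j ℕ.* n) / D

  -- Beyond `j * (n / D)` only the remainder of `n` matters, and its floor may be read off after
  -- scaling by `k` because nested floors compose.
  /-multiple : ∀ j k → .{{_ : NonZero k}} → ⌊ j n⌋ ≡ j ℕ.* (n / D) ℕ.+ (k ℕ.* j ℕ.* (n % D)) / D / k
  /-multiple j k@(suc _) = begin
    (j ℕ.* n) / D
      ≡⟨ ≡.cong (λ m → (j ℕ.* m) / D) (ℕ.m≡m%n+[m/n]*n n D) ⟩
    (j ℕ.* (n % D ℕ.+ n / D ℕ.* D)) / D
      ≡⟨ ≡.cong (_/ D) (solve 4 (λ j r w D → j :* (r :+ w :* D) := j :* w :* D :+ j :* r)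
           ≡.refl j (n % D) (n / D) D) ⟩
    (j ℕ.* (n / D) ℕ.* D ℕ.+ j ℕ.* (n % D)) / D
      ≡⟨ ℕ.+-distrib-/-∣ˡ (j ℕ.* (n % D)) (ℕ.n∣m*n (j ℕ.* (n / D))) ⟩
    (j ℕ.* (n / D) ℕ.* D) / D ℕ.+ (j ℕ.* (n % D)) / D
      ≡⟨ ≡.cong₂ ℕ._+_ (ℕ.m*n/n≡m (j ℕ.* (n / D)) D) scale ⟩
    j ℕ.* (n / D) ℕ.+ (k ℕ.* j ℕ.* (n % D)) / D / k ∎
    where
    open ≡.≡-Reasoning
    open +-*-Solver
    scale : (j ℕ.* (n % D)) / D ≡ (k ℕ.* j ℕ.* (n % D)) / D / k
    scale = begin
      (j ℕ.* (n % D)) / D                   ≡⟨ ℕ.m*n/o*n≡m/o (j ℕ.* (n % D)) k D ⟨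
      (j ℕ.* (n % D) ℕ.* k) / (D ℕ.* k)     ≡⟨ ≡.cong (_/ (D ℕ.* k))
        (solve 3 (λ j r k → j :* r :* k := k :* j :* r) ≡.refl j (n % D) k) ⟩
      (k ℕ.* j ℕ.* (n % D)) / (D ℕ.* k)     ≡⟨ ℕ.m/n/o≡m/[n*o] (k ℕ.* j ℕ.* (n % D)) D k ⟨
      (k ℕ.* j ℕ.* (n % D)) / D / k         ∎

  -- Up to multiples of n / D, all ⌊jn/D⌋ with j ∣ L are determined by u alone,
  -- which leaves finitely many cases.
  module Residues (L : ℕ) where

    u = (L ℕ.* (n % D)) / D
    w = n / D

    residue : ∀ j k → .{{_ : NonZero k}} → k ℕ.* j ≡ L → ⌊ j n⌋ ≡ j ℕ.* w ℕ.+ u / k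
    residue j k ≡.refl = /-multiple j k

    cancel-≤ : ∀ i j m {x y z} → ⌊ i n⌋ ≡ i ℕ.* w ℕ.+ x → ⌊ j n⌋ ≡ j ℕ.* w ℕ.+ y → ⌊ m n⌋ ≡ m ℕ.* w ℕ.+ z →
               i ℕ.+ j ≡ 2 ℕ.* m → ⌊ i n⌋ ℕ.+ ⌊ j n⌋ ≤ 2 ℕ.* ⌊ m n⌋ → x ℕ.+ y ≤ 2 ℕ.* z
    cancel-≤ i j m {x} {y} {z} eqi eqj eqm i+j≡2m h =
      ℕ.+-cancelˡ-≤ (2 ℕ.* m ℕ.* w) (x ℕ.+ y) (2 ℕ.* z) (≡.subst₂ _≤_
        (≡.trans (≡.cong₂ ℕ._+_ eqi eqj) (≡.trans
          (solve 5 (λ i j w x y → (i :* w :+ x) :+ (j :* w :+ y) := (i :+ j) :* w :+ (x :+ y)) ≡.refl i j w x y)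
          (≡.cong (λ k → k ℕ.* w ℕ.+ (x ℕ.+ y)) i+j≡2m)))
        (≡.trans (≡.cong (2 ℕ.*_) eqm)
          (solve 3 (λ m w z → con 2 :* (m :* w :+ z) := con 2 :* m :* w :+ con 2 :* z) ≡.refl m w z))
        h)
      where open +-*-Solver

    uncancel : ∀ i j m {x y z} → ⌊ i n⌋ ≡ i ℕ.* w ℕ.+ x → ⌊ j n⌋ ≡ j ℕ.* w ℕ.+ y → ⌊ m n⌋ ≡ m ℕ.* w ℕ.+ z →
               i ℕ.+ j ≡ m → z ≤ x ℕ.+ y → ⌊ m n⌋ ≤ ⌊ i n⌋ ℕ.+ ⌊ j n⌋
    uncancel i j m {x} {y} {z} eqi eqj eqm ≡.refl z≤ = ≡.subst₂ _≤_ (≡.sym eqm)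
      (≡.trans (solve 5 (λ i j w x y → (i :+ j) :* w :+ (x :+ y) := (i :* w :+ x) :+ (j :* w :+ y)) ≡.refl i j w x y)
        (≡.sym (≡.cong₂ ℕ._+_ eqi eqj)))
      (ℕ.+-monoʳ-≤ ((i ℕ.+ j) ℕ.* w) z≤)
      where open +-*-Solver

  open Residues public using (residue; cancel-≤; uncancel)

-- For 0 ≤ x < 5/6 and u = ⌊60x⌋, the number ⌊jx⌋ is u / (60 / j).
finite-check₆ : ∀ {u} → u < 50 →
  (u / 10 ℕ.+ u / 15 ≤ 2 ℕ.* (u / 12)) × (u / 10 ℕ.+ u / 30 ≤ 2 ℕ.* (u / 15)) ×
    (u / 15 ℕ.+ u / 30 ≤ 2 ℕ.* (u / 20)) →
  (u / 10 ≤ u / 60 ℕ.+ u / 12) × (u / 10 ≤ u / 20 ℕ.+ u / 20) × u ≢ 20 × u ≢ 40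
finite-check₆ = toWitness {a? = ℕ.allUpTo? (λ u →
  ((u / 10 ℕ.+ u / 15 ℕ.≤? 2 ℕ.* (u / 12)) ×-dec (u / 10 ℕ.+ u / 30 ℕ.≤? 2 ℕ.* (u / 15)) ×-dec
    (u / 15 ℕ.+ u / 30 ℕ.≤? 2 ℕ.* (u / 20))) →-dec
  ((u / 10 ℕ.≤? u / 60 ℕ.+ u / 12) ×-dec (u / 10 ℕ.≤? u / 20 ℕ.+ u / 20) ×-dec
    (¬? (u ℕ.≟ 20)) ×-dec (¬? (u ℕ.≟ 40)))) 50} tt

-- For 0 ≤ x < 7/8 and u = ⌊120x⌋, the number ⌊jx⌋ is u / (120 / j).
finite-check₈ : ∀ {u} → u < 105 →
  (u / 15 ℕ.+ u / 30 ≤ 2 ℕ.* (u / 20)) × (u / 15 ℕ.+ u / 60 ≤ 2 ℕ.* (u / 24)) ×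
    (u / 30 ℕ.+ u / 60 ≤ 2 ℕ.* (u / 40)) →
  u / 15 ≤ u / 40 ℕ.+ u / 24
finite-check₈ = toWitness {a? = ℕ.allUpTo? (λ u →
  ((u / 15 ℕ.+ u / 30 ℕ.≤? 2 ℕ.* (u / 20)) ×-dec (u / 15 ℕ.+ u / 60 ℕ.≤? 2 ℕ.* (u / 24)) ×-dec
    (u / 30 ℕ.+ u / 60 ℕ.≤? 2 ℕ.* (u / 40))) →-dec
  (u / 15 ℕ.≤? u / 40 ℕ.+ u / 24)) 105} tt

-- `e` counts the copies of Φ taken from a power with exponent `bound`, and `P` is the condition
-- that makes Φ divide the base.
Supported : ℕ → ℕ → Set → Set
Supported bound e P = e ≡ 0 ⊎ (e ≤ bound × P)

none : ∀ {bound P} → Supported bound 0 P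
none = inj₁ ≡.refl

some : ∀ {bound e P} → e ≤ bound → P → Supported bound e P
some e≤bound p = inj₂ (e≤bound , p)

-- A lower bound f for the multiplicity of the cyclotomic polynomial of index
-- d + 1 in the sum of the summands with i = n + k and j = n - k: e₀ counts
-- the factor 1 + q^k, and e₁, e₂, e₃ the three q-binomial coefficients.
record Enough (a n r s t d f i j : ℕ) : Set where
  constructor enough
  field
    e₀ e₁ e₂ e₃ : ℕ
    supported₀ : Supported 1 e₀ (∃ λ g → suc d ≡ 2 ℕ.* g × OddMultiple g ∣ i - n ∣)
    supported₁ : Supported r e₁ (0 < carry (a ℕ.* n ℕ.+ i) (a ℕ.* n ℕ.+ j) d)
    supported₂ : Supported s e₂ (0 < carry (n ℕ.+ i) (n ℕ.+ j) d)
    supported₃ : Supported t e₃ (0 < carry i j d)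
    bound : f ≤ e₀ ℕ.+ e₁ ℕ.+ e₂ ℕ.+ e₃

module Pair {n i j : ℕ} (i+j≡2n : i ℕ.+ j ≡ 2 ℕ.* n) where

  pair : ∀ x y {m} → x ℕ.+ y ℕ.+ 2 ℕ.* n ≡ m → (x ℕ.+ i) ℕ.+ (y ℕ.+ j) ≡ m
  pair x y eq = ≡.trans
    (solve 4 (λ x y i j → (x :+ i) :+ (y :+ j) := x :+ y :+ (i :+ j)) ≡.refl x y i j)
    (≡.trans (≡.cong (x ℕ.+ y ℕ.+_) i+j≡2n) eq)
    where open +-*-Solver

  pair′ : ∀ x y {m} → x ℕ.+ y ℕ.+ 2 ℕ.* n ≡ m → (x ℕ.+ j) ℕ.+ (y ℕ.+ i) ≡ m
  pair′ x y eq = ≡.trans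
    (solve 4 (λ x y i j → (x :+ j) :+ (y :+ i) := x :+ y :+ (i :+ j)) ≡.refl x y i j)
    (≡.trans (≡.cong (x ℕ.+ y ℕ.+_) i+j≡2n) eq)
    where open +-*-Solver

  cross : ∀ x y d {m} → x ℕ.+ y ℕ.+ 2 ℕ.* n ≡ m →
          ((x ℕ.+ i) / suc d ℕ.+ (x ℕ.+ j) / suc d) ℕ.+ ((y ℕ.+ i) / suc d ℕ.+ (y ℕ.+ j) / suc d) ≤ 2 ℕ.* (m / suc d)
  cross x y d eq = /-cross {x ℕ.+ i} {x ℕ.+ j} {y ℕ.+ i} {y ℕ.+ j} (suc d) (pair x y eq) (pair′ x y eq)

  total₁ : ∀ a → (a ℕ.* n ℕ.+ i) ℕ.+ (a ℕ.* n ℕ.+ j) ≡ 2 ℕ.* suc a ℕ.* n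
  total₁ a = pair (a ℕ.* n) (a ℕ.* n)
    (solve 2 (λ a n → a :* n :+ a :* n :+ con 2 :* n := con 2 :* (con 1 :+ a) :* n) ≡.refl a n)
    where open +-*-Solver

  total₂ : (n ℕ.+ i) ℕ.+ (n ℕ.+ j) ≡ 4 ℕ.* n
  total₂ = pair n n (solve 1 (λ n → n :+ n :+ con 2 :* n := con 4 :* n) ≡.refl n)
    where open +-*-Solver

<-scale : ∀ c k {r e D} → r ℕ.+ e ≡ D → D < suc k ℕ.* e → suc c ℕ.* suc k ℕ.* r < suc c ℕ.* k ℕ.* D
<-scale c k {r} {e} ≡.refl D<[1+k]e = begin-strict
  suc c ℕ.* suc k ℕ.* r
    ≡⟨ solve 3 (λ c k r → (con 1 :+ c) :* (con 1 :+ k) :* r :=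
         (con 1 :+ c) :* r :+ (con 1 :+ c) :* k :* r) ≡.refl c k r ⟩
  suc c ℕ.* r ℕ.+ suc c ℕ.* k ℕ.* r
    <⟨ ℕ.+-monoˡ-< (suc c ℕ.* k ℕ.* r) (ℕ.*-monoʳ-< (suc c) r<ke) ⟩
  suc c ℕ.* (k ℕ.* e) ℕ.+ suc c ℕ.* k ℕ.* r
    ≡⟨ solve 4 (λ c k r e → (con 1 :+ c) :* (k :* e) :+ (con 1 :+ c) :* k :* r :=
         (con 1 :+ c) :* k :* (r :+ e)) ≡.refl c k r e ⟩
  suc c ℕ.* k ℕ.* (r ℕ.+ e) ∎
  where
  open ℕ.≤-Reasoning
  open +-*-Solver
  r<ke : r < k ℕ.* e
  r<ke = ℕ.+-cancelʳ-< e r (k ℕ.* e) (≡.subst (r ℕ.+ e <_) (ℕ.+-comm e (k ℕ.* e)) D<[1+k]e)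

-- If (k + 1)e > d, then the remainder d - e is below kd/(k + 1), which is the range of the finite
-- check.
%-small : ∀ c k n d → ¬ suc k ℕ.* (suc d ∸ n % suc d) ≤ suc d →
          (suc c ℕ.* suc k ℕ.* (n % suc d)) / suc d < suc c ℕ.* k
%-small c k n d large = ℕ.m<n*o⇒m/o<n
  (<-scale c k (ℕ.m+[n∸m]≡n (ℕ.m%n≤n n (suc d))) (ℕ.≰⇒> large))

module CarryFree₆ {n d i j : ℕ} (i+j≡2n : i ℕ.+ j ≡ 2 ℕ.* n)
  (c₁ : carry (2 ℕ.* n ℕ.+ i) (2 ℕ.* n ℕ.+ j) d ≡ 0)
  (c₂ : carry (n ℕ.+ i) (n ℕ.+ j) d ≡ 0)
  (c₃ : carry i j d ≡ 0)
  (u<50 : (60 ℕ.* (n % suc d)) / suc d < 50)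
  where

  open Pair {n} {i} {j} i+j≡2n
  open Multiples n d
  open +-*-Solver

  private
    q₆ : (2 ℕ.* n ℕ.+ i) / D ℕ.+ (2 ℕ.* n ℕ.+ j) / D ≡ ⌊ 6 n⌋
    q₆ = ≡.trans (≡.sym (carry-zero (2 ℕ.* n ℕ.+ i) (2 ℕ.* n ℕ.+ j) d c₁)) (≡.cong (_/ D) (total₁ 2))
    q₄ : (n ℕ.+ i) / D ℕ.+ (n ℕ.+ j) / D ≡ ⌊ 4 n⌋
    q₄ = ≡.trans (≡.sym (carry-zero (n ℕ.+ i) (n ℕ.+ j) d c₂)) (≡.cong (_/ D) total₂)
    q₂ : i / D ℕ.+ j / D ≡ ⌊ 2 n⌋
    q₂ = ≡.trans (≡.sym (carry-zero i j d c₃)) (≡.cong (_/ D) i+j≡2n)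
    5n = solve 1 (λ n → con 2 :* n :+ n :+ con 2 :* n := con 5 :* n) ≡.refl n
    4n = solve 1 (λ n → con 2 :* n :+ con 0 :+ con 2 :* n := con 4 :* n) ≡.refl n
    3n = solve 1 (λ n → n :+ con 0 :+ con 2 :* n := con 3 :* n) ≡.refl n
    h₁ : ⌊ 6 n⌋ ℕ.+ ⌊ 4 n⌋ ≤ 2 ℕ.* ⌊ 5 n⌋
    h₁ = ≡.subst (_≤ 2 ℕ.* ⌊ 5 n⌋) (≡.cong₂ ℕ._+_ q₆ q₄)
      (cross (2 ℕ.* n) n d 5n)
    h₂ : ⌊ 6 n⌋ ℕ.+ ⌊ 2 n⌋ ≤ 2 ℕ.* ⌊ 4 n⌋
    h₂ = ≡.subst (_≤ 2 ℕ.* ⌊ 4 n⌋) (≡.cong₂ ℕ._+_ q₆ q₂)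
      (cross (2 ℕ.* n) 0 d 4n)
    h₃ : ⌊ 4 n⌋ ℕ.+ ⌊ 2 n⌋ ≤ 2 ℕ.* ⌊ 3 n⌋
    h₃ = ≡.subst (_≤ 2 ℕ.* ⌊ 3 n⌋) (≡.cong₂ ℕ._+_ q₄ q₂)
      (cross n 0 d 3n)
    -- 60 is the least common multiple of 1, ..., 6, so `u` determines all floors that occur.
    r₁ = residue 60 1 60 ≡.refl
    r₂ = residue 60 2 30 ≡.refl
    r₃ = residue 60 3 20 ≡.refl
    r₄ = residue 60 4 15 ≡.refl
    r₅ = residue 60 5 12 ≡.refl
    r₆ = residue 60 6 10 ≡.refl
    checked = finite-check₆ u<50
      ( cancel-≤ 60 6 4 5 r₆ r₄ r₅ ≡.refl h₁
      , cancel-≤ 60 6 2 4 r₆ r₂ r₄ ≡.refl h₂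
      , cancel-≤ 60 4 2 3 r₄ r₂ r₃ ≡.refl h₃ )

  carry-n-5n : carry n (5 ℕ.* n) d ≡ 0
  carry-n-5n = ℕ.m≤n⇒m∸n≡0 (≡.subst (λ m → ⌊ 6 n⌋ ≤ m / D ℕ.+ ⌊ 5 n⌋) (ℕ.*-identityˡ n)
    (uncancel 60 1 5 6 r₁ r₅ r₆ ≡.refl (proj₁ checked)))

  carry-3n-3n : carry (3 ℕ.* n) (3 ℕ.* n) d ≡ 0
  carry-3n-3n = ℕ.m≤n⇒m∸n≡0 (≡.subst (λ m → m / D ≤ ⌊ 3 n⌋ ℕ.+ ⌊ 3 n⌋)
    (ℕ.*-distribʳ-+ n 3 3) (uncancel 60 3 3 6 r₃ r₃ r₆ ≡.refl (proj₁ (proj₂ checked))))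

  -- 20 and 40 are the values of `u` when n mod d is d/3 or 2d/3; excluding them serves the modulus
  -- with [3].
  not-third : ((60 ℕ.* (n % suc d)) / suc d ≢ 20) × ((60 ℕ.* (n % suc d)) / suc d ≢ 40)
  not-third = proj₂ (proj₂ checked)

module CarryFree₈ {n d i j : ℕ} (i+j≡2n : i ℕ.+ j ≡ 2 ℕ.* n)
  (c₁ : carry (3 ℕ.* n ℕ.+ i) (3 ℕ.* n ℕ.+ j) d ≡ 0)
  (c₂ : carry (n ℕ.+ i) (n ℕ.+ j) d ≡ 0)
  (c₃ : carry i j d ≡ 0)
  (u<105 : (120 ℕ.* (n % suc d)) / suc d < 105)
  where

  open Pair {n} {i} {j} i+j≡2n
  open Multiples n d
  open +-*-Solver

  private
    q₈ : (3 ℕ.* n ℕ.+ i) / D ℕ.+ (3 ℕ.* n ℕ.+ j) / D ≡ ⌊ 8 n⌋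
    q₈ = ≡.trans (≡.sym (carry-zero (3 ℕ.* n ℕ.+ i) (3 ℕ.* n ℕ.+ j) d c₁)) (≡.cong (_/ D) (total₁ 3))
    q₄ : (n ℕ.+ i) / D ℕ.+ (n ℕ.+ j) / D ≡ ⌊ 4 n⌋
    q₄ = ≡.trans (≡.sym (carry-zero (n ℕ.+ i) (n ℕ.+ j) d c₂)) (≡.cong (_/ D) total₂)
    q₂ : i / D ℕ.+ j / D ≡ ⌊ 2 n⌋
    q₂ = ≡.trans (≡.sym (carry-zero i j d c₃)) (≡.cong (_/ D) i+j≡2n)
    6n = solve 1 (λ n → con 3 :* n :+ n :+ con 2 :* n := con 6 :* n) ≡.refl n
    5n = solve 1 (λ n → con 3 :* n :+ con 0 :+ con 2 :* n := con 5 :* n) ≡.refl n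
    3n = solve 1 (λ n → n :+ con 0 :+ con 2 :* n := con 3 :* n) ≡.refl n
    h₁ : ⌊ 8 n⌋ ℕ.+ ⌊ 4 n⌋ ≤ 2 ℕ.* ⌊ 6 n⌋
    h₁ = ≡.subst (_≤ 2 ℕ.* ⌊ 6 n⌋) (≡.cong₂ ℕ._+_ q₈ q₄)
      (cross (3 ℕ.* n) n d 6n)
    h₂ : ⌊ 8 n⌋ ℕ.+ ⌊ 2 n⌋ ≤ 2 ℕ.* ⌊ 5 n⌋
    h₂ = ≡.subst (_≤ 2 ℕ.* ⌊ 5 n⌋) (≡.cong₂ ℕ._+_ q₈ q₂)
      (cross (3 ℕ.* n) 0 d 5n)
    h₃ : ⌊ 4 n⌋ ℕ.+ ⌊ 2 n⌋ ≤ 2 ℕ.* ⌊ 3 n⌋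
    h₃ = ≡.subst (_≤ 2 ℕ.* ⌊ 3 n⌋) (≡.cong₂ ℕ._+_ q₄ q₂)
      (cross n 0 d 3n)
    -- 120 is the least common multiple of 2, 3, 4, 5, 6 and 8.
    r₂ = residue 120 2 60 ≡.refl
    r₃ = residue 120 3 40 ≡.refl
    r₄ = residue 120 4 30 ≡.refl
    r₅ = residue 120 5 24 ≡.refl
    r₆ = residue 120 6 20 ≡.refl
    r₈ = residue 120 8 15 ≡.refl
    checked = finite-check₈ u<105
      ( cancel-≤ 120 8 4 6 r₈ r₄ r₆ ≡.refl h₁
      , cancel-≤ 120 8 2 5 r₈ r₂ r₅ ≡.refl h₂
      , cancel-≤ 120 4 2 3 r₄ r₂ r₃ ≡.refl h₃ )

  carry-3n-5n : carry (3 ℕ.* n) (5 ℕ.* n) d ≡ 0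
  carry-3n-5n = ℕ.m≤n⇒m∸n≡0 (≡.subst (λ m → m / D ≤ ⌊ 3 n⌋ ℕ.+ ⌊ 5 n⌋)
    (ℕ.*-distribʳ-+ n 3 5) (uncancel 120 3 5 8 r₃ r₅ r₈ ≡.refl checked))

private
  positive : ∀ {m k} → m ≡ suc k → 0 < m
  positive ≡.refl = s≤s z≤n

module _ {a n r s t d i j : ℕ} (0<r : 0 < r) (0<s : 0 < s) (0<t : 0 < t) where

  enough-one : ∀ {f} → f ≤ 1 →
    ¬ (carry (a ℕ.* n ℕ.+ i) (a ℕ.* n ℕ.+ j) d ≡ 0 × carry (n ℕ.+ i) (n ℕ.+ j) d ≡ 0 × carry i j d ≡ 0) →
    Enough a n r s t d f i j
  enough-one f≤1 not-all
    with carry (a ℕ.* n ℕ.+ i) (a ℕ.* n ℕ.+ j) d in eq₁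
       | carry (n ℕ.+ i) (n ℕ.+ j) d in eq₂
       | carry i j d in eq₃
  ... | suc _ | _     | _     = enough 0 1 0 0 none (some 0<r (positive eq₁)) none none f≤1
  ... | zero  | suc _ | _     = enough 0 0 1 0 none none (some 0<s (positive eq₂)) none f≤1
  ... | zero  | zero  | suc _ = enough 0 0 0 1 none none none (some 0<t (positive eq₃)) f≤1
  ... | zero  | zero  | zero  = contradiction (≡.refl , ≡.refl , ≡.refl) not-all

-- The required exponent of each Φ_d

-- The constructors are the ways to certify the exponent `f` of Φ in the sum: it is zero, blocks
-- cancel, or every pair of summands suffices. Cancellation of blocks yields one factor, hence
-- `f ≤ 1` there.
data Status (a n r s t d : ℕ) : ℕ → Set where
  absent : Status a n r s t d 0
  blocks : ∀ {f} → f ≤ 1 → 2 ℕ.* suc a ℕ.* (suc d ∸ n % suc d) ≤ suc d → Status a n r s t d f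
  pairs  : ∀ {f} → (∀ i j → i ℕ.+ j ≡ 2 ℕ.* n → Enough a n r s t d f i j) → Status a n r s t d f

-- The common factor `h` drops out, so the floors become explicit once n/d is c/k.
scaled-/ : ∀ n h d k c → suc d ≡ k ℕ.* h → n ≡ c ℕ.* h → ∀ j r x →
           j ℕ.* c ≡ r ℕ.+ x ℕ.* k → r < k → (j ℕ.* n) / suc d ≡ x
scaled-/ n zero d k c d≡kh n≡ch j r x jc≡ r<k = contradiction (≡.trans d≡kh (ℕ.*-zeroʳ k)) ℕ.1+n≢0
scaled-/ n h@(suc _) d k@(suc _) c ≡.refl ≡.refl j r x jc≡ r<k = begin
  (j ℕ.* (c ℕ.* h)) / (k ℕ.* h)  ≡⟨ ≡.cong (_/ (k ℕ.* h)) (≡.sym (ℕ.*-assoc j c h)) ⟩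
  (j ℕ.* c ℕ.* h) / (k ℕ.* h)    ≡⟨ ℕ.m*n/o*n≡m/o (j ℕ.* c) h k ⟩
  (j ℕ.* c) / k                  ≡⟨ ≡.cong (_/ k) jc≡ ⟩
  (r ℕ.+ x ℕ.* k) / k            ≡⟨ [r+x*d]/d≡x r x k r<k ⟩
  x                              ∎
  where open ≡.≡-Reasoning

third-/ : ∀ n h v d → n ≡ v ℕ.* h → suc d ≡ 3 ℕ.* h → (60 ℕ.* (n % suc d)) / suc d ≡ 20 ℕ.* (v % 3)
third-/ n zero v d n≡vh ()
third-/ n h@(suc _) v d n≡vh d≡3h = scaled-/ (n % suc d) h d 3 (v % 3) d≡3h n%d≡ 60 0 (20 ℕ.* (v % 3))
  (solve 1 (λ c → con 60 :* c := con 20 :* c :* con 3) ≡.refl (v % 3)) (s≤s z≤n)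
  where
  open +-*-Solver
  n%d≡ : n % suc d ≡ v % 3 ℕ.* h
  n%d≡ rewrite n≡vh = ≡.trans (ℕ.%-congʳ {m = suc d} {n = 3 ℕ.* h} {o = v ℕ.* h} d≡3h)
    (≡.sym (ℕ.m%n*o≡m*o%[n*o] v 3 h))

module _ {n r s t : ℕ} (0<r : 0 < r) (0<s : 0 < s) (0<t : 0 < t) where

  generic₆ : ∀ d {f} → f ≤ 1 → f ≡ carry n (5 ℕ.* n) d ⊎ f ≡ carry (3 ℕ.* n) (3 ℕ.* n) d →
             Status 2 n r s t d f
  generic₆ d {zero}  _   _ = absent
  generic₆ d {suc f} f≤1 f≡carry with 6 ℕ.* (suc d ∸ n % suc d) ℕ.≤? suc d
  ... | yes small = blocks f≤1 small
  ... | no  large = pairs λ i j i+j≡2n → enough-one 0<r 0<s 0<t f≤1 λ (c₁ , c₂ , c₃) →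
    -- 10 * 6 = 60 is the scale and 10 * 5 = 50 the bound of the finite check.
    let open CarryFree₆ {n} {d} {i} {j} i+j≡2n c₁ c₂ c₃ (%-small 9 5 n d large) in
    [ (λ eq → ℕ.1+n≢0 (≡.trans eq carry-n-5n)) , (λ eq → ℕ.1+n≢0 (≡.trans eq carry-3n-3n)) ]′ f≡carry

  generic₈ : ∀ d {f} → f ≤ 1 → f ≡ carry (3 ℕ.* n) (5 ℕ.* n) d → Status 3 n r s t d f
  generic₈ d {zero}  _   _ = absent
  generic₈ d {suc f} f≤1 f≡carry with 8 ℕ.* (suc d ∸ n % suc d) ℕ.≤? suc d
  ... | yes small = blocks f≤1 small
  ... | no  large = pairs λ i j i+j≡2n → enough-one 0<r 0<s 0<t f≤1 λ (c₁ , c₂ , c₃) →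
    -- Here the scale is 15 * 8 = 120 and the bound 15 * 7 = 105.
    let open CarryFree₈ {n} {d} {i} {j} i+j≡2n c₁ c₂ c₃ (%-small 14 7 n d large) in
    ℕ.1+n≢0 (≡.trans f≡carry carry-3n-5n)

  module _ {h d : ℕ} (h∣n : h ℕ.∣ n) (2h∤n : ¬ 2 ℕ.* h ℕ.∣ n) where

    private
      even : ∀ {D} k → D ℕ.∣ 2 ℕ.* n → D ℕ.∣ 2 ℕ.* k ℕ.* n
      even {D} k D∣2n = ≡.subst (D ℕ.∣_) (solve 2 (λ k n → k :* (con 2 :* n) := con 2 :* k :* n) ≡.refl k n)
        (ℕ.∣n⇒∣m*n k D∣2n)
        where open +-*-Solver

      multiple : ∀ {D m} l k → D ℕ.∣ m ℕ.* n → l ℕ.* m ≡ k → D ℕ.∣ k ℕ.* n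
      multiple {D} {m} l k D∣mn ≡.refl = ≡.subst (D ℕ.∣_) (≡.sym (ℕ.*-assoc l m n)) (ℕ.∣n⇒∣m*n l D∣mn)

      regroup : ∀ k i → suc k ℕ.* n ℕ.+ i ≡ k ℕ.* n ℕ.+ (n ℕ.+ i)
      regroup k i = solve 3 (λ k n i → (con 1 :+ k) :* n :+ i := k :* n :+ (n :+ i)) ≡.refl k n i
        where open +-*-Solver

      4h∤2n : ¬ 4 ℕ.* h ℕ.∣ 2 ℕ.* n
      4h∤2n 4h∣2n = 2h∤n (ℕ.*-cancelˡ-∣ 2 (≡.subst (ℕ._∣ 2 ℕ.* n) (ℕ.*-assoc 2 2 h) 4h∣2n))

      8h∤4n : ¬ 8 ℕ.* h ℕ.∣ 4 ℕ.* n
      8h∤4n 8h∣4n = 4h∤2n (ℕ.*-cancelˡ-∣ 2 (≡.subst₂ ℕ._∣_ (ℕ.*-assoc 2 4 h) (ℕ.*-assoc 2 2 n) 8h∣4n))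

    module _ (d≡2h : suc d ≡ 2 ℕ.* h) where

      private
        D = suc d
        D∣2n : D ℕ.∣ 2 ℕ.* n
        D∣2n = ≡.subst (ℕ._∣ 2 ℕ.* n) (≡.sym d≡2h) (ℕ.*-monoʳ-∣ 2 h∣n)
        D∤n : ¬ D ℕ.∣ n
        D∤n D∣n = 2h∤n (≡.subst (ℕ._∣ n) d≡2h D∣n)

      -- `n` is an odd multiple of h = D/2. If D divides `i`, then i - n is an odd multiple of h and
      -- n + i is no multiple of D, so 1 + q^k and the second binomial give a factor each; otherwise
      -- the first and third binomials do.
      special₆ : ∀ i j → i ℕ.+ j ≡ 2 ℕ.* n → Enough 2 n r s t d 2 i j
      special₆ i j i+j≡2n with D ℕ.∣? i
      ... | yes D∣i = enough 1 0 1 0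
        (some ℕ.≤-refl (h , d≡2h , oddMultiple-difference (≡.subst (ℕ._∣ i) d≡2h D∣i) h∣n 2h∤n))
        none
        (some 0<s (carry-positive (≡.subst (D ℕ.∣_) (≡.sym total₂) (even 2 D∣2n)) λ D∣n+i →
          D∤n (ℕ.∣m+n∣m⇒∣n (≡.subst (D ℕ.∣_) (ℕ.+-comm n i) D∣n+i) D∣i)))
        none ℕ.≤-refl
        where open Pair {n} {i} {j} i+j≡2n
      ... | no  D∤i = enough 0 1 0 1 none
        (some 0<r (carry-positive (≡.subst (D ℕ.∣_) (≡.sym (total₁ 2)) (even 3 D∣2n)) λ D∣2n+i →
          D∤i (ℕ.∣m+n∣m⇒∣n D∣2n+i D∣2n)))
        none
        (some 0<t (carry-positive (≡.subst (D ℕ.∣_) (≡.sym i+j≡2n) D∣2n) D∤i))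
        ℕ.≤-refl
        where open Pair {n} {i} {j} i+j≡2n

      -- 3n + i and n + i agree modulo D = 2h. If D divides them, it does not divide `i`, and the
      -- third binomial counts twice; otherwise the first and second give a factor each.
      special₈-t : 2 ≤ t → ∀ i j → i ℕ.+ j ≡ 2 ℕ.* n → Enough 3 n r s t d 2 i j
      special₈-t 2≤t i j i+j≡2n with D ℕ.∣? n ℕ.+ i
      ... | yes D∣n+i = enough 0 0 0 2 none none none
        (some 2≤t (carry-positive (≡.subst (D ℕ.∣_) (≡.sym i+j≡2n) D∣2n) λ D∣i →
          D∤n (ℕ.∣m+n∣m⇒∣n (≡.subst (D ℕ.∣_) (ℕ.+-comm n i) D∣n+i) D∣i)))
        ℕ.≤-refl
      ... | no  D∤n+i = enough 0 1 1 0 none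
        (some 0<r (carry-positive (≡.subst (D ℕ.∣_) (≡.sym (total₁ 3)) (even 4 D∣2n)) λ D∣3n+i →
          D∤n+i (ℕ.∣m+n∣m⇒∣n (≡.subst (D ℕ.∣_) (regroup 2 i) D∣3n+i) D∣2n)))
        (some 0<s (carry-positive (≡.subst (D ℕ.∣_) (≡.sym total₂) (even 2 D∣2n)) D∤n+i))
        none ℕ.≤-refl
        where open Pair {n} {i} {j} i+j≡2n

    module _ (d≡4h : suc d ≡ 4 ℕ.* h) where

      private
        D = suc d
        D∣4n : D ℕ.∣ 4 ℕ.* n
        D∣4n = ≡.subst (ℕ._∣ 4 ℕ.* n) (≡.sym d≡4h) (ℕ.*-monoʳ-∣ 4 h∣n)
        D∤2n : ¬ D ℕ.∣ 2 ℕ.* n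
        D∤2n D∣2n = 4h∤2n (≡.subst (ℕ._∣ 2 ℕ.* n) d≡4h D∣2n)
        d≡2[2h] : suc d ≡ 2 ℕ.* (2 ℕ.* h)
        d≡2[2h] = ≡.trans d≡4h (ℕ.*-assoc 2 2 h)

      -- Here D = 4h. If D divides n + i, then k = (n + i) - 2n is an odd multiple of 2h, and D does
      -- not divide 3n + i, so the first binomial helps. Otherwise the second binomial gives one
      -- factor, and the other comes from s ≥ 2, from the first binomial, or from the third when D
      -- divides 3n + i.
      special₈-s : 2 ≤ s ⊎ (2 ≤ r × ∃ λ y → n ≡ (3 ℕ.+ y ℕ.* 4) ℕ.* h) →
                   ∀ i j → i ℕ.+ j ≡ 2 ℕ.* n → Enough 3 n r s t d 2 i j
      special₈-s cases i j i+j≡2n = by-cases (D ℕ.∣? n ℕ.+ i) cases (D ℕ.∣? 3 ℕ.* n ℕ.+ i)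
        where
        open Pair {n} {i} {j} i+j≡2n
        total₁-∣ : D ℕ.∣ (3 ℕ.* n ℕ.+ i) ℕ.+ (3 ℕ.* n ℕ.+ j)
        total₁-∣ = ≡.subst (D ℕ.∣_) (≡.sym (total₁ 3)) (multiple {D} {4} 2 8 D∣4n ≡.refl)
        total₂-∣ : D ℕ.∣ (n ℕ.+ i) ℕ.+ (n ℕ.+ j)
        total₂-∣ = ≡.subst (D ℕ.∣_) (≡.sym total₂) D∣4n
        D∤3n : ¬ D ℕ.∣ 3 ℕ.* n
        D∤3n D∣3n = D∤2n (ℕ.∣m+n∣m⇒∣n {m = 2 ℕ.* (2 ℕ.* n)} {n = 2 ℕ.* n}
          (≡.subst (D ℕ.∣_) (solve 1 (λ n → con 2 :* (con 3 :* n) := con 2 :* (con 2 :* n) :+ con 2 :* n) ≡.refl n)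
            (ℕ.∣n⇒∣m*n 2 D∣3n))
          (≡.subst (D ℕ.∣_) (ℕ.*-assoc 2 2 n) D∣4n))
          where open +-*-Solver
        -- Without a carry, ⌊5n/D⌋ would be 1 + ⌊3n/D⌋ + ⌊2n/D⌋; but n/D = (3 + 4y)/4 gives 3 + 5y,
        -- 2 + 3y and 1 + 2y for these floors.
        c₃≢0 : ∀ y → n ≡ (3 ℕ.+ y ℕ.* 4) ℕ.* h → D ℕ.∣ 3 ℕ.* n ℕ.+ i → carry i j d ≢ 0
        c₃≢0 y n≡ D∣3n+i c₃≡0 = ℕ.m+1+n≢m (3 ℕ.+ 5 ℕ.* y) {0} (begin
          3 ℕ.+ 5 ℕ.* y ℕ.+ 1
            ≡⟨ solve 1 (λ y → con 3 :+ con 5 :* y :+ con 1 :=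
                 con 1 :+ ((con 2 :+ con 3 :* y) :+ (con 1 :+ con 2 :* y))) ≡.refl y ⟩
          1 ℕ.+ ((2 ℕ.+ 3 ℕ.* y) ℕ.+ (1 ℕ.+ 2 ℕ.* y))
            ≡⟨ ≡.cong₂ (λ u v → 1 ℕ.+ (u ℕ.+ v))
                 (⌊n⌋ 3 1 (2 ℕ.+ 3 ℕ.* y)
                   (solve 1 (λ y → con 3 :* (con 3 :+ y :* con 4) := con 1 :+ (con 2 :+ con 3 :* y) :* con 4) ≡.refl y) 1<4)
                 (⌊n⌋ 2 2 (1 ℕ.+ 2 ℕ.* y)
                   (solve 1 (λ y → con 2 :* (con 3 :+ y :* con 4) := con 2 :+ (con 1 :+ con 2 :* y) :* con 4) ≡.refl y) 2<4) ⟨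
          1 ℕ.+ ((3 ℕ.* n) / D ℕ.+ (2 ℕ.* n) / D)
            ≡⟨ ≡.cong (λ m → 1 ℕ.+ ((3 ℕ.* n) / D ℕ.+ m / D)) i+j≡2n ⟨
          1 ℕ.+ ((3 ℕ.* n) / D ℕ.+ (i ℕ.+ j) / D)
            ≡⟨ carry-shift D∣3n+i D∤3n c₃≡0 ⟨
          (3 ℕ.* n ℕ.+ (i ℕ.+ j)) / D
            ≡⟨ ≡.cong (λ m → (3 ℕ.* n ℕ.+ m) / D) i+j≡2n ⟩
          (3 ℕ.* n ℕ.+ 2 ℕ.* n) / D
            ≡⟨ ≡.cong (_/ D) (ℕ.*-distribʳ-+ n 3 2) ⟨
          (5 ℕ.* n) / D
            ≡⟨ ⌊n⌋ 5 3 (3 ℕ.+ 5 ℕ.* y)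
                   (solve 1 (λ y → con 5 :* (con 3 :+ y :* con 4) := con 3 :+ (con 3 :+ con 5 :* y) :* con 4) ≡.refl y) 3<4 ⟩
          3 ℕ.+ 5 ℕ.* y ∎)
          where
          open ≡.≡-Reasoning
          open +-*-Solver
          ⌊n⌋ = scaled-/ n h d 4 (3 ℕ.+ y ℕ.* 4) d≡4h n≡
          1<4 = s≤s (s≤s z≤n)
          2<4 = s≤s (s≤s (s≤s z≤n))
          3<4 = s≤s (s≤s (s≤s (s≤s z≤n)))
        by-cases : Dec (D ℕ.∣ n ℕ.+ i) → 2 ≤ s ⊎ (2 ≤ r × ∃ λ y → n ≡ (3 ℕ.+ y ℕ.* 4) ℕ.* h) →
                   Dec (D ℕ.∣ 3 ℕ.* n ℕ.+ i) → Enough 3 n r s t d 2 i j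
        by-cases (yes D∣n+i) _ _ = enough 1 1 0 0
          (some ℕ.≤-refl (2 ℕ.* h , d≡2[2h] , ≡.subst (OddMultiple (2 ℕ.* h)) difference
            (oddMultiple-difference (≡.subst (ℕ._∣ n ℕ.+ i) d≡2[2h] D∣n+i) (ℕ.*-monoʳ-∣ 2 h∣n)
              (λ 4h∣2n → D∤2n (≡.subst (ℕ._∣ 2 ℕ.* n) (≡.sym d≡2[2h]) 4h∣2n)))))
          (some 0<r (carry-positive total₁-∣ λ D∣3n+i → D∤2n
            (ℕ.∣m+n∣m⇒∣n (≡.subst (D ℕ.∣_) (≡.trans (regroup 2 i) (ℕ.+-comm _ (n ℕ.+ i))) D∣3n+i) D∣n+i)))
          none none ℕ.≤-refl
          where
          difference : ∣ n ℕ.+ i - 2 ℕ.* n ∣ ≡ ∣ i - n ∣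
          difference = ≡.trans (≡.cong (λ m → ∣ n ℕ.+ i - n ℕ.+ m ∣) (ℕ.+-identityʳ n)) (ℕ.∣m+n-m+o∣≡∣n-o∣ n i n)
        by-cases (no D∤n+i) (inj₁ 2≤s) _ = enough 0 0 2 0 none none
          (some 2≤s (carry-positive total₂-∣ D∤n+i)) none ℕ.≤-refl
        by-cases (no D∤n+i) (inj₂ _) (no D∤3n+i) = enough 0 1 1 0 none
          (some 0<r (carry-positive total₁-∣ D∤3n+i))
          (some 0<s (carry-positive total₂-∣ D∤n+i)) none ℕ.≤-refl
        by-cases (no D∤n+i) (inj₂ (_ , y , n≡)) (yes D∣3n+i) = enough 0 0 1 1 none none
          (some 0<s (carry-positive total₂-∣ D∤n+i))
          (some 0<t (ℕ.n≢0⇒n>0 (c₃≢0 y n≡ D∣3n+i))) ℕ.≤-refl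

    module _ (d≡8h : suc d ≡ 8 ℕ.* h) where

      private
        D = suc d
        D∤4n : ¬ D ℕ.∣ 4 ℕ.* n
        D∤4n D∣4n = 8h∤4n (≡.subst (ℕ._∣ 4 ℕ.* n) d≡8h D∣4n)
        d≡2[4h] : suc d ≡ 2 ℕ.* (4 ℕ.* h)
        d≡2[4h] = ≡.trans d≡8h (ℕ.*-assoc 2 4 h)

      -- Here D = 8h. If D does not divide 3n + i, the first binomial counts twice. Otherwise k =
      -- (3n + i) - 4n is an odd multiple of 4h, and the second binomial has a carry.
      special₈-r : 2 ≤ r → ∀ y → n ≡ (1 ℕ.+ y ℕ.* 4) ℕ.* h →
                   ∀ i j → i ℕ.+ j ≡ 2 ℕ.* n → Enough 3 n r s t d 2 i j
      special₈-r 2≤r y n≡ i j i+j≡2n with D ℕ.∣? 3 ℕ.* n ℕ.+ i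
      ... | no D∤3n+i = enough 0 2 0 0 none
        (some 2≤r (carry-positive (≡.subst₂ ℕ._∣_ (≡.sym d≡8h) (≡.sym (total₁ 3)) (ℕ.*-monoʳ-∣ 8 h∣n)) D∤3n+i))
        none none ℕ.≤-refl
        where open Pair {n} {i} {j} i+j≡2n
      ... | yes D∣3n+i = enough 1 0 1 0
        (some ℕ.≤-refl (4 ℕ.* h , d≡2[4h] , ≡.subst (OddMultiple (4 ℕ.* h)) difference
          (oddMultiple-difference (≡.subst (ℕ._∣ 3 ℕ.* n ℕ.+ i) d≡2[4h] D∣3n+i) (ℕ.*-monoʳ-∣ 4 h∣n)
            (λ 8h∣4n → D∤4n (≡.subst (ℕ._∣ 4 ℕ.* n) (≡.sym d≡2[4h]) 8h∣4n)))))
        none (some 0<s (ℕ.n≢0⇒n>0 c₂≢0)) none ℕ.≤-refl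
        where
        open Pair {n} {i} {j} i+j≡2n
        open +-*-Solver
        difference : ∣ 3 ℕ.* n ℕ.+ i - 4 ℕ.* n ∣ ≡ ∣ i - n ∣
        difference = ≡.trans (≡.cong (λ m → ∣ 3 ℕ.* n ℕ.+ i - m ∣)
          (solve 1 (λ n → con 4 :* n := con 3 :* n :+ n) ≡.refl n)) (ℕ.∣m+n-m+o∣≡∣n-o∣ (3 ℕ.* n) i n)
        -- Without a carry, ⌊6n/D⌋ would be 1 + ⌊2n/D⌋ + ⌊4n/D⌋; but n/D = (1 + 4y)/8 gives 3y, y
        -- and 2y.
        c₂≢0 : carry (n ℕ.+ i) (n ℕ.+ j) d ≢ 0
        c₂≢0 c₂≡0 = ℕ.m+1+n≢m (3 ℕ.* y) {0} (begin
          3 ℕ.* y ℕ.+ 1                ≡⟨ solve 1 (λ y → con 3 :* y :+ con 1 := con 1 :+ (y :+ con 2 :* y)) ≡.refl y ⟩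
          1 ℕ.+ (y ℕ.+ 2 ℕ.* y)
            ≡⟨ ≡.cong₂ (λ u v → 1 ℕ.+ (u ℕ.+ v))
                 (⌊n⌋ 2 2 y
                   (solve 1 (λ y → con 2 :* (con 1 :+ y :* con 4) := con 2 :+ y :* con 8) ≡.refl y) 2<8)
                 (⌊n⌋ 4 4 (2 ℕ.* y)
                   (solve 1 (λ y → con 4 :* (con 1 :+ y :* con 4) := con 4 :+ con 2 :* y :* con 8) ≡.refl y) 4<8) ⟨
          1 ℕ.+ ((2 ℕ.* n) / D ℕ.+ (4 ℕ.* n) / D)
            ≡⟨ ≡.cong (λ m → 1 ℕ.+ ((2 ℕ.* n) / D ℕ.+ m / D)) total₂ ⟨
          1 ℕ.+ ((2 ℕ.* n) / D ℕ.+ ((n ℕ.+ i) ℕ.+ (n ℕ.+ j)) / D)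
            ≡⟨ carry-shift (≡.subst (D ℕ.∣_) (regroup 2 i) D∣3n+i) (λ D∣2n → D∤4n (even {D} 2 D∣2n)) c₂≡0 ⟨
          (2 ℕ.* n ℕ.+ ((n ℕ.+ i) ℕ.+ (n ℕ.+ j))) / D
            ≡⟨ ≡.cong (λ m → (2 ℕ.* n ℕ.+ m) / D) total₂ ⟩
          (2 ℕ.* n ℕ.+ 4 ℕ.* n) / D
            ≡⟨ ≡.cong (_/ D) (ℕ.*-distribʳ-+ n 2 4) ⟨
          (6 ℕ.* n) / D
            ≡⟨ ⌊n⌋ 6 6 (3 ℕ.* y)
                   (solve 1 (λ y → con 6 :* (con 1 :+ y :* con 4) := con 6 :+ con 3 :* y :* con 8) ≡.refl y) 6<8 ⟩
          3 ℕ.* y ∎)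
          where
          open ≡.≡-Reasoning
          ⌊n⌋ = scaled-/ n h d 8 (1 ℕ.+ y ℕ.* 4) d≡8h n≡
          2<8 = s≤s (s≤s (s≤s z≤n))
          4<8 = s≤s (s≤s (s≤s (s≤s (s≤s z≤n))))
          6<8 = s≤s (s≤s (s≤s (s≤s (s≤s (s≤s (s≤s z≤n))))))

  module _ {h v d : ℕ} (n≡vh : n ≡ v ℕ.* h) (3∤v : ¬ 3 ℕ.∣ v) (d≡3h : suc d ≡ 3 ℕ.* h) where

    -- The fractional part of n/d is 1/3 or 2/3, so `u` is 20 or 40, which `finite-check₆` excludes
    -- for a carry-free summand.
    special₃ : ∀ i j → i ℕ.+ j ≡ 2 ℕ.* n → Enough 2 n r s t d 1 i j
    special₃ i j i+j≡2n = by-remainder (v % 3) ≡.refl (ℕ.m%n<n v 3)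
      where
      third : ∀ c → v % 3 ≡ c → c < 3 → (60 ℕ.* (n % suc d)) / suc d ≡ 20 ℕ.* c
      third c v%3≡c c<3 = ≡.trans (third-/ n h v d n≡vh d≡3h) (≡.cong (20 ℕ.*_) v%3≡c)
      conclude : ∀ c → v % 3 ≡ c → c < 3 → 20 ℕ.* c < 50 →
                 (20 ℕ.* c ≢ 20 → 20 ℕ.* c ≢ 40 → ⊥) → Enough 2 n r s t d 1 i j
      conclude c v%3≡c c<3 small bad = enough-one 0<r 0<s 0<t ℕ.≤-refl λ (c₁ , c₂ , c₃) →
        let open CarryFree₆ {n} {d} {i} {j} i+j≡2n c₁ c₂ c₃
                   (≡.subst (_< 50) (≡.sym (third c v%3≡c c<3)) small)
            u≢20 , u≢40 = not-third in
        bad (λ eq → u≢20 (≡.trans (third c v%3≡c c<3) eq)) (λ eq → u≢40 (≡.trans (third c v%3≡c c<3) eq))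
      by-remainder : ∀ c → v % 3 ≡ c → c < 3 → Enough 2 n r s t d 1 i j
      by-remainder 0 eq _ = contradiction (ℕ.m%n≡0⇒n∣m v 3 eq) 3∤v
      by-remainder 1 eq c<3 = conclude 1 eq c<3 (ℕ.m≤m+n 21 29) (λ ≢20 _ → ≢20 ≡.refl)
      by-remainder 2 eq c<3 = conclude 2 eq c<3 (ℕ.m≤m+n 41 9) (λ _ ≢40 → ≢40 ≡.refl)
      by-remainder (suc (suc (suc c))) _ (s≤s (s≤s (s≤s ())))

private
  remainder : ∀ {r e D b} a → r ℕ.+ e ≡ D → D ≡ b ℕ.+ 2 ℕ.* suc a ℕ.* e → r ≡ b ℕ.+ (1 ℕ.+ 2 ℕ.* a) ℕ.* e
  remainder {r} {e} {D} {b} a r+e≡D D≡ = ℕ.+-cancelʳ-≡ e r _ (≡.trans r+e≡D (≡.trans D≡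
    (solve 3 (λ a b e → b :+ con 2 :* (con 1 :+ a) :* e := (b :+ (con 1 :+ con 2 :* a) :* e) :+ e)
      ≡.refl a b e)))
    where open +-*-Solver

-- From exponents to divisibility of the sum

module Assembly
  {c ℓ : Level} (R : CommutativeRing c ℓ) (q : CommutativeRing.Carrier R)
  (1-q^m-primitive : Base.PowersPrimitive R q) (N : ℕ) where

  open Base R
  open Divisors R q 1-q^m-primitive N public

  ^-∣ : ∀ {x y e r} → e ≤ r → x ∣ y → x ^ e ∣ y ^ r
  ^-∣ z≤n       x∣y = _ , *-identityʳ _
  ^-∣ (s≤s e≤r) x∣y = ∙-cong-∣ x∣y (^-∣ e≤r x∣y)

  ^-∣-supported : ∀ {x y bound e P} → Supported bound e P → (P → x ∣ y) → x ^ e ∣ y ^ bound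
  ^-∣-supported (inj₁ ≡.refl)        _   = _ , *-identityʳ _
  ^-∣-supported (inj₂ (e≤bound , p)) x∣y = ^-∣ e≤bound (x∣y p)

  -- The divisors of p^(γ+1) are those of p^γ and the number itself, so a single Φ survives in the
  -- quotient of 1 - q^(p^(γ+1)) by 1 - q^(p^γ).
  geometric≈Φ : ∀ {p} → Prime p → ∀ γ {d} → suc d ≡ p ℕ.^ suc γ → d < N →
                geometric p (q ^ (p ℕ.^ γ)) ≈ Φ d
  geometric≈Φ {p} p-prime γ {d} d≡p^ d<N = from (p ℕ.^ γ) ≡.refl
    where
    instance
      _ = prime⇒nonTrivial p-prime
      _ = prime⇒nonZero p-prime
    from : ∀ k → p ℕ.^ γ ≡ k → geometric p (q ^ k) ≈ Φ d
    from zero    p^≡0 = contradiction p^≡0 (ℕ.≢-nonZero⁻¹ (p ℕ.^ γ) {{ℕ.m^n≢0 p γ}})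
    from (suc k) p^≡k = cancel (1-q^m-primitive k) (begin
      (1# - q ^ suc k) * geometric p (q ^ suc k)
        ≈⟨ *-comm _ _ ⟩
      geometric p (q ^ suc k) * (1# - q ^ suc k)
        ≈⟨ geometric-* p (q ^ suc k) ⟩
      1# - (q ^ suc k) ^ p
        ≈⟨ +-congˡ (-‿cong (trans (^-assocʳ q (suc k) p) (reflexive (≡.cong (q ^_) [1+k]p≡d)))) ⟩
      1# - q ^ suc d
        ≈⟨ 1-q^≈Φ d<N ⟩
      F (λ e → ⟦ suc e ∣ suc d ⟧)
        ≈⟨ F-cong (λ {e} _ → divisors e (suc e ℕ.∣? suc k) (d ℕ.≟ e)) ⟩
      F (λ e → ⟦ suc e ∣ suc k ⟧ ℕ.+ ⟦ d ≡ e ⟧)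
        ≈⟨ factored-+ Φ N (λ e → ⟦ suc e ∣ suc k ⟧) ⟦ d ≡_⟧ ⟩
      F (λ e → ⟦ suc e ∣ suc k ⟧) * F ⟦ d ≡_⟧
        ≈⟨ *-cong (sym (1-q^≈Φ (ℕ.<-trans k<d d<N))) (factored-single Φ d<N) ⟩
      (1# - q ^ suc k) * Φ d ∎)
      where
      [1+k]p≡d : suc k ℕ.* p ≡ suc d
      [1+k]p≡d = ≡.trans (≡.cong (ℕ._* p) (≡.sym p^≡k)) (≡.trans (ℕ.*-comm (p ℕ.^ γ) p) (≡.sym d≡p^))
      k<d : k < d
      k<d = ℕ.s<s⁻¹ (≡.subst (suc k <_) [1+k]p≡d (ℕ.m<m*n (suc k) p (ℕ.nonTrivial⇒n>1 p)))
      k∣d : suc k ℕ.∣ suc d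
      k∣d = ℕ.divides p (≡.trans (≡.sym [1+k]p≡d) (ℕ.*-comm (suc k) p))
      divisors : ∀ e → Dec (suc e ℕ.∣ suc k) → Dec (d ≡ e) →
                 ⟦ suc e ∣ suc d ⟧ ≡ ⟦ suc e ∣ suc k ⟧ ℕ.+ ⟦ d ≡ e ⟧
      divisors e (yes e∣k) (yes ≡.refl) = contradiction e∣k (ℕ.>⇒∤ (ℕ.s<s k<d))
      divisors e (yes e∣k) (no d≢e)
        rewrite ⟦∣⟧-yes e∣k | ⟦∣⟧-yes (ℕ.∣-trans e∣k k∣d) | ⟦≡⟧-no d≢e = ≡.refl
      divisors e (no e∤k) (yes ≡.refl)
        rewrite ⟦∣⟧-no e∤k | ⟦∣⟧-yes (ℕ.∣-refl {suc d}) | ⟦≡⟧-yes d = ≡.refl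
      divisors e (no e∤k) (no d≢e) rewrite ⟦∣⟧-no e∤k | ⟦≡⟧-no d≢e = ⟦∣⟧-no λ e∣d →
        [ (λ e≡p^ → d≢e (ℕ.suc-injective (≡.trans d≡p^ (≡.sym e≡p^))))
        , (λ e∣p^ → e∤k (≡.subst (suc e ℕ.∣_) p^≡k e∣p^)) ]′
        (∣p^[1+k]⇒≡⊎∣p^k p-prime γ (≡.subst (suc e ℕ.∣_) d≡p^ e∣d))

  module _ (a′ : ℕ) {n r s t : ℕ} (0<r : 0 < r) (0<s : 0 < s) (0<t : 0 < t)
           (top≤N : 2 ℕ.* suc (suc a′) ℕ.* n ≤ N) {ε : ℕ → Carrier} (alternating : Alternating q n ε)
           (ε-pair : ∀ i j → i ℕ.+ j ≡ 2 ℕ.* n → 1# + q ^ ∣ i - n ∣ ∣ ε i + ε j)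
           where

    private
      a : ℕ
      a = suc a′
      G₁ G₂ G₃ : ℕ → Carrier
      G₁ i = gauss (2 ℕ.* suc a ℕ.* n) (a ℕ.* n ℕ.+ i)
      G₂ i = gauss (4 ℕ.* n) (n ℕ.+ i)
      G₃ i = gauss (2 ℕ.* n) i
      weight : ℕ → Carrier
      weight i = G₁ i ^ r * G₂ i ^ s * G₃ i ^ t
      4n≤N : 4 ℕ.* n ≤ N
      4n≤N = ℕ.≤-trans (ℕ.*-monoˡ-≤ n (ℕ.*-monoʳ-≤ 2 {2} {suc a} (s≤s (s≤s z≤n)))) top≤N
      2n≤N : 2 ℕ.* n ≤ N
      2n≤N = ℕ.≤-trans (ℕ.*-monoˡ-≤ n {2} {4} (s≤s (s≤s z≤n))) 4n≤N

    -- All three binomials agree at `i` and j = 2n - i, so the pair contributes `ε i + ε j` times a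
    -- common weight, and 1 + q^|k| divides the first factor.
    ∣-S : ∀ {x} → Primitive x → (∀ i j → i ℕ.+ j ≡ 2 ℕ.* n → x ∣ (1# + q ^ ∣ i - n ∣) * weight i) →
          x ∣ S a n r s t ε
    ∣-S {x} px x∣pair = primitive-half px (∣-∑-paired (2 ℕ.* n) (term a n r s t ε) λ i j i+j≡2n →
      ∣-respʳ-≈ (sym (term-pair i j i+j≡2n))
        (∣ʳ-trans (x∣pair i j i+j≡2n) (∙-cong-∣ (ε-pair i j i+j≡2n) ∣ʳ-refl)))
      where
      term-pair : ∀ i j → i ℕ.+ j ≡ 2 ℕ.* n →
                  term a n r s t ε i + term a n r s t ε j ≈ (ε i + ε j) * weight i
      term-pair i j i+j≡2n = trans (+-congˡ (weighted-cong r s t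
        (sym (gauss-symmetric (a ℕ.* n ℕ.+ i) (a ℕ.* n ℕ.+ j) (total₁ a) top≤N))
        (sym (gauss-symmetric (n ℕ.+ i) (n ℕ.+ j) total₂ 4n≤N))
        (sym (gauss-symmetric i j i+j≡2n 2n≤N))))
        (weighted-+ r s t)
        where open Pair {n} {i} {j} i+j≡2n

    Φ^∣S : ∀ {d f} → d < N → Status a n r s t d f → Φ d ^ f ∣ S a n r s t ε
    Φ^∣S d<N absent = _ , *-identityʳ _
    Φ^∣S {d} {f} d<N (blocks f≤1 small) = ∣ʳ-trans (^-∣ f≤1 ∣ʳ-refl)
      (∣-respˡ-≈ (sym (*-identityʳ (Φ d))) (from (suc d ∸ n % suc d) ≡.refl))
      where
      D = suc d
      from : ∀ e → D ∸ n % D ≡ e → Φ d ∣ S a n r s t ε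
      from zero    D∸r≡0 = contradiction (ℕ.m∸n≡0⇒m≤n D∸r≡0) (ℕ.<⇒≱ (ℕ.m%n<n n D))
      from (suc e) D∸r≡e =
        Φ∣S-blocks a′ (n / D) b e r s t d<N D≡ n≡ 0<r 0<t alternating
        where
        b = D ∸ 2 ℕ.* suc a ℕ.* suc e
        D≡ : D ≡ b ℕ.+ 2 ℕ.* suc a ℕ.* suc e
        D≡ = ≡.sym (ℕ.m∸n+n≡m (≡.subst (λ e → 2 ℕ.* suc a ℕ.* e ≤ D) D∸r≡e small))
        r≡ : n % D ≡ b ℕ.+ (1 ℕ.+ 2 ℕ.* a) ℕ.* suc e
        r≡ = remainder {n % D} {suc e} {D} {b} a
          (≡.trans (≡.cong (n % D ℕ.+_) (≡.sym D∸r≡e)) (ℕ.m+[n∸m]≡n (ℕ.m%n≤n n D))) D≡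
        n≡ : n ≡ n / D ℕ.* D ℕ.+ (b ℕ.+ (1 ℕ.+ 2 ℕ.* a) ℕ.* suc e)
        n≡ = ≡.trans (ℕ.m≡m%n+[m/n]*n n D) (≡.trans (ℕ.+-comm (n % D) _) (≡.cong (n / D ℕ.* D ℕ.+_) r≡))
    Φ^∣S {d} {f} d<N (pairs enough-pairs) = ∣-S (primitive-^ (Φ-primitive d<N) f) λ i j i+j≡2n →
      ∣-pair i j i+j≡2n (enough-pairs i j i+j≡2n)
      where
      ∣-pair : ∀ i j → i ℕ.+ j ≡ 2 ℕ.* n → Enough a n r s t d f i j →
               Φ d ^ f ∣ (1# + q ^ ∣ i - n ∣) * weight i
      ∣-pair i j i+j≡2n (enough e₀ e₁ e₂ e₃ supported₀ supported₁ supported₂ supported₃ bound) =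
        ∣ʳ-trans (^-∣ bound ∣ʳ-refl) (∣-respˡ-≈ split (∙-cong-∣ div₀ (∙-cong-∣ (∙-cong-∣ div₁ div₂) div₃)))
        where
        open Pair {n} {i} {j} i+j≡2n
        split : Φ d ^ e₀ * (Φ d ^ e₁ * Φ d ^ e₂ * Φ d ^ e₃) ≈ Φ d ^ (e₀ ℕ.+ e₁ ℕ.+ e₂ ℕ.+ e₃)
        split = sym (trans (^-homo-* (Φ d) (e₀ ℕ.+ e₁ ℕ.+ e₂) e₃) (trans (*-congʳ
          (trans (^-homo-* (Φ d) (e₀ ℕ.+ e₁) e₂) (*-congʳ (^-homo-* (Φ d) e₀ e₁))))
          (solve 4 (λ x y z w → x :* y :* z :* w := x :* (y :* z :* w)) refl _ _ _ _)))
        div₀ : Φ d ^ e₀ ∣ 1# + q ^ ∣ i - n ∣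
        div₀ = ∣-respʳ-≈ (*-identityʳ _) (^-∣-supported supported₀ λ (g , d≡2g , m , i-n≡) →
          ∣ʳ-trans (Φ-half g d<N d≡2g) (∣-respʳ-≈
            (+-congˡ (trans (^-assocʳ q g (1 ℕ.+ 2 ℕ.* m)) (reflexive (≡.cong (q ^_) (≡.sym i-n≡)))))
            (1+x∣1+x^odd (q ^ g) m)))
        div₁ : Φ d ^ e₁ ∣ G₁ i ^ r
        div₁ = ^-∣-supported supported₁ (Φ∣gauss (a ℕ.* n ℕ.+ i) (a ℕ.* n ℕ.+ j) (total₁ a) top≤N d<N)
        div₂ : Φ d ^ e₂ ∣ G₂ i ^ s
        div₂ = ^-∣-supported supported₂ (Φ∣gauss (n ℕ.+ i) (n ℕ.+ j) total₂ 4n≤N d<N)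
        div₃ : Φ d ^ e₃ ∣ G₃ i ^ t
        div₃ = ^-∣-supported supported₃ (Φ∣gauss i j i+j≡2n 2n≤N d<N)

    F∣S : ∀ f → (∀ {d} → d < N → Status a n r s t d (f d)) → F f ∣ S a n r s t ε
    F∣S f status = factored-least Φ N f Φ-primitive Φ-coprime (λ d<N → Φ^∣S d<N (status d<N))

-- The signed powers of q

≤-split : ∀ i n → (∃ λ m → i ≡ n ℕ.+ m) ⊎ (∃ λ m → n ≡ i ℕ.+ suc m)
≤-split i n with n ℕ.≤? i
... | yes n≤i = inj₁ (i ∸ n , ≡.sym (ℕ.m+[n∸m]≡n n≤i))
... | no  n≰i = inj₂ (n ∸ suc i , ≡.sym (≡.trans (ℕ.+-suc i _) (ℕ.m+[n∸m]≡n (ℕ.≰⇒> n≰i))))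

module SignedPowers
  {c ℓ : Level} (R : CommutativeRing c ℓ) (q : CommutativeRing.Carrier R)
  where

  open Base R
  open Signs R

  -- ε i = (-1)^k q^C(k,2) for k = i - n.
  record IsSigned (n : ℕ) (ε : ℕ → Carrier) : Set ℓ where
    field
      above : ∀ m → ε (n ℕ.+ m) ≈ (- 1#) ^ m * q ^ triangle m
      below : ∀ i m → i ℕ.+ m ≡ n → ε i ≈ (- 1#) ^ m * q ^ (triangle m ℕ.+ m)

  module _ {n : ℕ} {ε : ℕ → Carrier} (signed : IsSigned n ε) where

    open IsSigned signed

    private
      negate : ∀ x y → - 1# * x * y ≈ - (x * y)
      negate x y = trans (*-assoc (- 1#) x y) (-1*x≈-x (x * y))

    -- With k = i - n this is C(k+1,2) = C(k,2) + k, for k ≥ 0 and for k < 0.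
    signed⇒alternating : Alternating q n ε
    signed⇒alternating i with ≤-split i n
    ... | inj₁ (m , ≡.refl) = begin
      q ^ n * ε (suc (n ℕ.+ m))
        ≈⟨ *-congˡ (trans (reflexive (≡.cong ε (≡.sym (ℕ.+-suc n m)))) (above (suc m))) ⟩
      q ^ n * (- 1# * (- 1#) ^ m * q ^ (triangle m ℕ.+ m))
        ≈⟨ *-congˡ (*-congˡ (^-homo-* q (triangle m) m)) ⟩
      q ^ n * (- 1# * (- 1#) ^ m * (q ^ triangle m * q ^ m))
        ≈⟨ solve 5 (λ a b c x y → a :* (b :* c :* (x :* y)) := b :* (a :* y) :* (c :* x)) refl _ _ _ _ _ ⟩
      - 1# * (q ^ n * q ^ m) * ((- 1#) ^ m * q ^ triangle m)
        ≈⟨ negate _ _ ⟩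
      - (q ^ n * q ^ m * ((- 1#) ^ m * q ^ triangle m))
        ≈⟨ -‿cong (*-cong (^-homo-* q n m) (above m)) ⟨
      - (q ^ (n ℕ.+ m) * ε (n ℕ.+ m)) ∎
    ... | inj₂ (m , ≡.refl) = begin
      q ^ (i ℕ.+ suc m) * ε (suc i)
        ≈⟨ *-cong (^-homo-* q i (suc m)) (below (suc i) m (≡.sym (ℕ.+-suc i m))) ⟩
      q ^ i * q ^ suc m * ((- 1#) ^ m * q ^ (triangle m ℕ.+ m))
        ≈⟨ solve 4 (λ a b c d → a :* b :* (c :* d) := a :* (c :* (d :* b))) refl _ _ _ _ ⟩
      q ^ i * ((- 1#) ^ m * (q ^ (triangle m ℕ.+ m) * q ^ suc m))
        ≈⟨ *-congˡ (*-congˡ (^-homo-* q (triangle m ℕ.+ m) (suc m))) ⟨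
      q ^ i * ((- 1#) ^ m * q ^ (triangle (suc m) ℕ.+ suc m))
        ≈⟨ -‿involutive _ ⟨
      - - (q ^ i * ((- 1#) ^ m * q ^ (triangle (suc m) ℕ.+ suc m)))
        ≈⟨ -‿cong (trans (sym (-1*x≈-x _)) (solve 4 (λ a b c d → a :* (b :* (c :* d)) := b :* (a :* c :* d)) refl _ _ _ _)) ⟩
      - (q ^ i * ((- 1#) ^ suc m * q ^ (triangle (suc m) ℕ.+ suc m)))
        ≈⟨ -‿cong (*-congˡ (below i (suc m) ≡.refl)) ⟨
      - (q ^ i * ε i) ∎

    private
      -- C(-m,2) = C(m,2) + m and the signs agree, so (-1)^m q^C(m,2) can be taken out.
      pair-sum : ∀ m j → j ℕ.+ m ≡ n → 1# + q ^ m ∣ ε (n ℕ.+ m) + ε j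
      pair-sum m j j+m≡n = (- 1#) ^ m * q ^ triangle m , (begin
        (- 1#) ^ m * q ^ triangle m * (1# + q ^ m)
          ≈⟨ solve 3 (λ a b c → a :* b :* (con 1 :+ c) := a :* b :+ a :* (b :* c)) refl _ _ _ ⟩
        (- 1#) ^ m * q ^ triangle m + (- 1#) ^ m * (q ^ triangle m * q ^ m)
          ≈⟨ +-cong (above m) (trans (below j m j+m≡n) (*-congˡ (^-homo-* q (triangle m) m))) ⟨
        ε (n ℕ.+ m) + ε j ∎)

      opposite : ∀ m j → n ℕ.+ m ℕ.+ j ≡ 2 ℕ.* n → j ℕ.+ m ≡ n
      opposite m j eq = ℕ.+-cancelˡ-≡ n (j ℕ.+ m) n (≡.trans
        (≡.trans (≡.cong (n ℕ.+_) (ℕ.+-comm j m)) (≡.sym (ℕ.+-assoc n m j)))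
        (≡.trans eq (≡.cong (n ℕ.+_) (ℕ.+-identityʳ n))))

    signed⇒pair : ∀ i j → i ℕ.+ j ≡ 2 ℕ.* n → 1# + q ^ ∣ i - n ∣ ∣ ε i + ε j
    signed⇒pair i j i+j≡2n with ∣-∣-cases i n
    ... | inj₁ i≡n+m = ≡.subst (λ k → 1# + q ^ ∣ i - n ∣ ∣ ε k + ε j) (≡.sym i≡n+m)
      (pair-sum ∣ i - n ∣ j (opposite ∣ i - n ∣ j (≡.subst (λ k → k ℕ.+ j ≡ 2 ℕ.* n) i≡n+m i+j≡2n)))
    ... | inj₂ n≡i+m = ∣-respʳ-≈ (+-comm _ _)
      (≡.subst (λ k → 1# + q ^ ∣ i - n ∣ ∣ ε k + ε i) (≡.sym j≡n+m) (pair-sum ∣ i - n ∣ i (≡.sym n≡i+m)))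
      where
      j≡n+m : j ≡ n ℕ.+ ∣ i - n ∣
      j≡n+m = ℕ.+-cancelˡ-≡ i j (n ℕ.+ ∣ i - n ∣) (≡.trans i+j≡2n
        (≡.trans (≡.cong (n ℕ.+_) (≡.trans (ℕ.+-identityʳ n) n≡i+m))
          (≡.trans (≡.sym (ℕ.+-assoc n i _)) (≡.trans (≡.cong (ℕ._+ ∣ i - n ∣) (ℕ.+-comm n i)) (ℕ.+-assoc i n _)))))

module GeometricSum {c ℓ : Level} (R : CommutativeRing c ℓ) where

  open Base R
  open Geometric R
  open Sums R
  open SemiringSum semiring using (*-distribˡ-sum)

  ∑≈geometric : ∀ m x → ∑ m (x ^_) ≈ geometric m x
  ∑≈geometric zero    x = refl
  ∑≈geometric (suc m) x = +-congˡ (trans (sym (*-distribˡ-sum {m} x _)) (*-congˡ (∑≈geometric m x)))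

-- Specialisation to ℤ[q]

open import Defs
open RawMagmaDefinitions *-rawMagma using (_∣ʳ_; _,_)

private
  module B = Base ℤ[q]

q*-zero : ∀ f → coeff (q * f) 0 ≡ 0ℤ
q*-zero f = ≡.trans (coeff-+ (0ℤ · f) (0ℤ ∷ 1# * f) 0) (≡.cong (ℤ._+ 0ℤ) (coeff≡ (0·-zero f) 0))

q*-suc : ∀ f i → coeff (q * f) (suc i) ≡ coeff f i
q*-suc f i = ≡.trans (coeff-+ (0ℤ · f) (0ℤ ∷ 1# * f) (suc i)) (≡.trans
  (≡.cong₂ ℤ._+_ (coeff≡ (0·-zero f) (suc i)) (coeff≡ (*-identityˡ f) i)) (ℤ.+-identityˡ _))

q^*-low : ∀ n f {i} → i < n → coeff (q ^ n * f) i ≡ 0ℤ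
q^*-low (suc n) f {zero}  _         =
  ≡.trans (coeff≡ (*-assoc q (q ^ n) f) 0) (q*-zero (q ^ n * f))
q^*-low (suc n) f {suc i} (s≤s i<n) =
  ≡.trans (coeff≡ (*-assoc q (q ^ n) f) (suc i)) (≡.trans (q*-suc (q ^ n * f) i) (q^*-low n f i<n))

q^*-high : ∀ n f i → coeff (q ^ n * f) (n ℕ.+ i) ≡ coeff f i
q^*-high zero    f i = coeff≡ (*-identityˡ f) i
q^*-high (suc n) f i = ≡.trans (coeff≡ (*-assoc q (q ^ n) f) (suc (n ℕ.+ i)))
  (≡.trans (q*-suc (q ^ n * f) (n ℕ.+ i)) (q^*-high n f i))

[1-q^]*-coeff : ∀ n f i → coeff ((1# - q ^ n) * f) i ≡ coeff f i ℤ.- coeff (q ^ n * f) i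
[1-q^]*-coeff n f i = ≡.trans (coeff≡ (B.[y-z]x≈yx-zx f 1# (q ^ n)) i)
  (≡.trans (coeff-+ (1# * f) (- (q ^ n * f)) i)
    (≡.cong₂ ℤ._+_ (coeff≡ (*-identityˡ f) i) (coeff-neg (q ^ n * f) i)))

[1-q^]*-low : ∀ n f {i} → i < n → coeff ((1# - q ^ n) * f) i ≡ coeff f i
[1-q^]*-low n f {i} i<n = ≡.trans ([1-q^]*-coeff n f i)
  (≡.trans (≡.cong (λ x → coeff f i ℤ.- x) (q^*-low n f i<n)) (ℤ.+-identityʳ (coeff f i)))

[1-q^]*-high : ∀ n f i → coeff ((1# - q ^ n) * f) (n ℕ.+ i) ≡ coeff f (n ℕ.+ i) ℤ.- coeff f i
[1-q^]*-high n f i = ≡.trans ([1-q^]*-coeff n f (n ℕ.+ i))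
  (≡.cong (λ x → coeff f (n ℕ.+ i) ℤ.- x) (q^*-high n f i))

coeff-× : ∀ c f i → coeff (c B.×ᵣ f) i ≡ + c ℤ.* coeff f i
coeff-× zero    f i = ≡.sym (ℤ.*-zeroˡ (coeff f i))
coeff-× (suc c) f i = ≡.trans (coeff-+ f (c B.×ᵣ f) i)
  (≡.trans (≡.cong (λ x → coeff f i ℤ.+ x) (coeff-× c f i)) (≡.sym (ℤ.suc-* (+ c) (coeff f i))))

×-cancel : ∀ c {f g} → suc c B.×ᵣ f ≈ suc c B.×ᵣ g → f ≈ g
×-cancel c {f} {g} eq = coeffs≡ λ i → ℤ.*-cancelˡ-≡ (+ suc c) (coeff f i) (coeff g i)
  (≡.trans (≡.sym (coeff-× (suc c) f i)) (≡.trans (coeff≡ eq i) (coeff-× (suc c) g i)))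

[i-j]+j≡i : ∀ i j → i ℤ.- j ℤ.+ j ≡ i
[i-j]+j≡i i j = ≡.trans (ℤ.+-assoc i (ℤ.- j) j)
  (≡.trans (≡.cong (λ k → i ℤ.+ k) (ℤ.+-inverseˡ j)) (ℤ.+-identityʳ i))

-- Multiplication by 1 - q^(n+1) keeps the first n + 1 coefficients and turns the later ones into
-- differences at distance n + 1, so coefficients are recovered in steps of that length.
index-induction : ∀ n (P : ℕ → Set) → (∀ {i} → i < suc n → P i) →
                  (∀ i → P i → P (suc n ℕ.+ i)) → ∀ i → P i
index-induction n P low high = <-rec P step
  where
  step : ∀ i → (∀ {j} → j < i → P j) → P i
  step i rec with ≤-split i (suc n)
  ... | inj₁ (k , ≡.refl) = high k (rec (s≤s (ℕ.m≤n+m k n)))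
  ... | inj₂ (k , 1+n≡)   = low (≡.subst (i <_) (≡.sym 1+n≡) (ℕ.m<m+n i (s≤s z≤n)))

divide-coefficients : ∀ c f → (∀ i → ∃ λ k → coeff f i ≡ + suc c ℤ.* k) →
                      ∃ λ g → ∀ i → coeff f i ≡ + suc c ℤ.* coeff g i
divide-coefficients c []      _         = [] , λ _ → ≡.sym (ℤ.*-zeroʳ (+ suc c))
divide-coefficients c (a ∷ f) divisible
  with k , a≡ck ← divisible 0 | g , f≡cg ← divide-coefficients c f (λ i → divisible (suc i)) =
  k ∷ g , λ where
    zero    → a≡ck
    (suc i) → f≡cg i

-- The coefficients of a cofactor are recovered recursively from the product; equality and
-- divisibility by an integer therefore pass from the product to the cofactor.
1-q^-primitive : B.PowersPrimitive q
1-q^-primitive m = record { cancel = λ {f} {g} → cancel {f} {g} ; saturated = λ c {f} → saturated c {f} }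
  where
  X = 1# - q ^ suc m
  cancel : ∀ {f g} → X * f ≈ X * g → f ≈ g
  cancel {f} {g} eq = coeffs≡ (index-induction m (λ i → coeff f i ≡ coeff g i)
    (λ {i} i<n → ≡.trans (≡.sym ([1-q^]*-low (suc m) f i<n)) (≡.trans (coeff≡ eq i) ([1-q^]*-low (suc m) g i<n)))
    (λ i fᵢ≡gᵢ → begin
      coeff f (suc m ℕ.+ i)                            ≡⟨ [i-j]+j≡i _ (coeff f i) ⟨
      coeff f (suc m ℕ.+ i) ℤ.- coeff f i ℤ.+ coeff f i ≡⟨ ≡.cong₂ ℤ._+_ (difference i) fᵢ≡gᵢ ⟩
      coeff g (suc m ℕ.+ i) ℤ.- coeff g i ℤ.+ coeff g i ≡⟨ [i-j]+j≡i _ (coeff g i) ⟩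
      coeff g (suc m ℕ.+ i)                            ∎))
    where
    open ≡.≡-Reasoning
    difference : ∀ i → coeff f (suc m ℕ.+ i) ℤ.- coeff f i ≡ coeff g (suc m ℕ.+ i) ℤ.- coeff g i
    difference i = ≡.trans (≡.sym ([1-q^]*-high (suc m) f i))
      (≡.trans (coeff≡ eq (suc m ℕ.+ i)) ([1-q^]*-high (suc m) g i))
  saturated : ∀ c {f} → X ∣ suc c B.×ᵣ f → X ∣ f
  saturated c {f} (w , wX≈cf) = conclude (divide-coefficients c w (index-induction m
    (λ i → ∃ λ k → coeff w i ≡ + suc c ℤ.* k)
    (λ {i} i<n → coeff f i , ≡.trans (≡.sym ([1-q^]*-low (suc m) w i<n)) (coefficient i))
    (λ i (k , wᵢ≡ck) → coeff f (suc m ℕ.+ i) ℤ.+ k , (begin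
      coeff w (suc m ℕ.+ i)
        ≡⟨ [i-j]+j≡i (coeff w (suc m ℕ.+ i)) (coeff w i) ⟨
      coeff w (suc m ℕ.+ i) ℤ.- coeff w i ℤ.+ coeff w i
        ≡⟨ ≡.cong₂ ℤ._+_ (≡.trans (≡.sym ([1-q^]*-high (suc m) w i)) (coefficient (suc m ℕ.+ i))) wᵢ≡ck ⟩
      + suc c ℤ.* coeff f (suc m ℕ.+ i) ℤ.+ + suc c ℤ.* k
        ≡⟨ ℤ.*-distribˡ-+ (+ suc c) (coeff f (suc m ℕ.+ i)) k ⟨
      + suc c ℤ.* (coeff f (suc m ℕ.+ i) ℤ.+ k) ∎))))
    where
    open ≡.≡-Reasoning
    coefficient : ∀ i → coeff (X * w) i ≡ + suc c ℤ.* coeff f i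
    coefficient i = ≡.trans (coeff≡ (≈-trans (*-comm X w) wX≈cf) i) (coeff-× (suc c) f i)
    conclude : (∃ λ v → ∀ i → coeff w i ≡ + suc c ℤ.* coeff v i) → X ∣ f
    conclude (v , w≡cv) = v , (×-cancel c (≈-trans (≈-sym (B.×-assoc-* (suc c) v X))
      (≈-trans (*-cong {suc c B.×ᵣ v} {w}
        (coeffs≡ λ i → ≡.trans (coeff-× (suc c) v i) (≡.sym (w≡cv i))) (≈-refl {X})) wX≈cf)))

open Gauss ℤ[q] q using (gauss; gauss-zero)

quotient≡gauss : ∀ m k → _∣ʳ_.quotient (denominator∣numerator m k) ≡ gauss m k
quotient≡gauss m       zero    = ≡.refl
quotient≡gauss zero    (suc k) = ≡.refl
quotient≡gauss (suc m) (suc k) =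
  ≡.cong₂ (λ f g → f + q ^ suc k * g) (quotient≡gauss m k) (quotient≡gauss m (suc k))

qBinomial≈gauss : ∀ m k → qBinomial m (+ k) ≈ gauss m k
qBinomial≈gauss m zero    = ≈-refl
qBinomial≈gauss m (suc k) = by-cases (suc k ℕ.≤? m)
  where
  select = λ b → if b then _∣ʳ_.quotient (denominator∣numerator m (suc k)) else 0#
  by-cases : Dec (suc k ≤ m) → qBinomial m (+ suc k) ≈ gauss m (suc k)
  by-cases (yes k<m) = B.reflexive (≡.trans
    (≡.cong select (dec-true (suc k ℕ.≤? m) k<m)) (quotient≡gauss m (suc k)))
  by-cases (no  k≮m) = ≈-trans (B.reflexive (≡.cong select (dec-false (suc k ℕ.≤? m) k≮m)))
    (≈-sym (gauss-zero (ℕ.≰⇒> k≮m)))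

2*triangle[1+k] : ∀ k → suc k ℕ.* k ≡ 2 ℕ.* triangle (suc k)
2*triangle[1+k] k = ℕ.+-cancelʳ-≡ (suc k) _ _ (≡.trans
  (≡.trans (ℕ.+-comm (suc k ℕ.* k) (suc k)) (≡.sym (ℕ.*-suc (suc k) k)))
  (≡.sym (2*triangle (suc k))))

choose₂-half : ∀ k t → k ℤ.* (k ℤ.- 1ℤ) ≡ + (2 ℕ.* t) → choose₂ k ≡ t
choose₂-half k t eq = ≡.trans (≡.cong (λ x → ℤ.∣ x ℤ./ + 2 ∣) eq)
  (≡.trans (≡.cong ℤ.∣_∣ (ℤ.div-pos-is-/ℕ (+ (2 ℕ.* t)) 2))
    (≡.trans (≡.cong (_/ 2) (ℕ.*-comm 2 t)) (ℕ.m*n/n≡m t 2)))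

choose₂-+ : ∀ m → choose₂ (+ m) ≡ triangle m
choose₂-+ zero    = ≡.refl
choose₂-+ (suc k) = choose₂-half (+ suc k) (triangle (suc k))
  (≡.trans (≡.sym (ℤ.pos-* (suc k) k)) (≡.cong +_ (2*triangle[1+k] k)))

choose₂-neg : ∀ m → choose₂ (ℤ.- (+ m)) ≡ triangle m ℕ.+ m
choose₂-neg zero    = ≡.refl
choose₂-neg (suc k) = choose₂-half -[1+ k ] (triangle (suc (suc k))) (≡.cong +_ (≡.trans
  (≡.cong (λ l → suc k ℕ.* suc (suc l)) (ℕ.+-identityʳ k))
  (≡.trans (ℕ.*-comm (suc k) (suc (suc k))) (2*triangle[1+k] (suc k)))))

+[n+m]-+n : ∀ n m → + (n ℕ.+ m) ℤ.- + n ≡ + m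
+[n+m]-+n n m = ≡.trans (ℤ.[+m]-[+n]≡m⊖n (n ℕ.+ m) n)
  (≡.trans (ℤ.⊖-≥ (ℕ.m≤m+n n m)) (≡.cong +_ (ℕ.m+n∸m≡n n m)))

+i-+[i+m] : ∀ i m → + i ℤ.- + (i ℕ.+ m) ≡ ℤ.- (+ m)
+i-+[i+m] i m = ≡.trans (ℤ.[+m]-[+n]≡m⊖n i (i ℕ.+ m))
  (≡.trans (ℤ.⊖-≤ (ℕ.m≤m+n i m)) (≡.cong (λ k → ℤ.- (+ k)) (ℕ.m+n∸m≡n i m)))

shift-index : ∀ n x y i → x ≡ n ℕ.+ y → + x ℤ.+ (+ i ℤ.- + n) ≡ + (y ℕ.+ i)
shift-index n x y i ≡.refl = ≡.trans (≡.sym (ℤ.+-assoc (+ x) (+ i) (ℤ.- + n)))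
  (≡.trans (≡.cong (λ m → + m ℤ.- + n) (ℕ.+-assoc n y i)) (+[n+m]-+n n (y ℕ.+ i)))

signedPower : ℕ → ℕ → Poly
signedPower n i = sign (+ i ℤ.- + n) * q ^ choose₂ (+ i ℤ.- + n)

open SignedPowers ℤ[q] q

signedPower-signed : ∀ n → IsSigned n (signedPower n)
signedPower-signed n = record
  { above = λ m → B.reflexive (≡.trans (≡.cong (λ k → sign k * q ^ choose₂ k) (+[n+m]-+n n m))
      (≡.cong (λ e → (- 1#) ^ m * q ^ e) (choose₂-+ m)))
  ; below = λ where
      i m ≡.refl → B.reflexive (≡.trans (≡.cong (λ k → sign k * q ^ choose₂ k) (+i-+[i+m] i m))
        (≡.cong₂ (λ l e → (- 1#) ^ l * q ^ e) (ℤ.∣-i∣≡∣i∣ (+ m)) (choose₂-neg m)))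
  }

open Terms ℤ[q] q using (S; weighted-cong)

summand≈ : ∀ {a n r s t} k i {x₁} → x₁ ≡ n ℕ.+ a ℕ.* n → k ≡ 2 ℕ.* suc a ℕ.* n →
  sign (+ i ℤ.- + n) * q ^ choose₂ (+ i ℤ.- + n)
    * qBinomial k (+ x₁ ℤ.+ (+ i ℤ.- + n)) ^ r
    * qBinomial (4 ℕ.* n) (+ (2 ℕ.* n) ℤ.+ (+ i ℤ.- + n)) ^ s
    * qBinomial (2 ℕ.* n) (+ n ℤ.+ (+ i ℤ.- + n)) ^ t
  ≈ Terms.term ℤ[q] q a n r s t (signedPower n) i
summand≈ {a} {n} {r} {s} {t} k i {x₁} x₁≡ ≡.refl = weighted-cong r s t {signedPower n i}
  (at k x₁ (a ℕ.* n) x₁≡)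
  (at (4 ℕ.* n) (2 ℕ.* n) n (≡.cong (n ℕ.+_) (ℕ.+-identityʳ n)))
  (at (2 ℕ.* n) n 0 (≡.sym (ℕ.+-identityʳ n)))
  where
  at : ∀ m x y → x ≡ n ℕ.+ y → qBinomial m (+ x ℤ.+ (+ i ℤ.- + n)) ≈ gauss m (y ℕ.+ i)
  at m x y x≡ = ≈-trans (B.reflexive (≡.cong (qBinomial m) (shift-index n x y i x≡)))
    (qBinomial≈gauss m (y ℕ.+ i))

S₆≈S : ∀ n r s t → S₆ n r s t ≈ S 2 n r s t (signedPower n)
S₆≈S n r s t = Sums.∑-cong ℤ[q] (suc (2 ℕ.* n)) λ {i} _ →
  summand≈ {2} {n} {r} {s} {t} (6 ℕ.* n) i ≡.refl ≡.refl

S₈≈S : ∀ n r s t → S₈ n r s t ≈ S 3 n r s t (signedPower n)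
S₈≈S n r s t = Sums.∑-cong ℤ[q] (suc (2 ℕ.* n)) λ {i} _ →
  summand≈ {3} {n} {r} {s} {t} (8 ℕ.* n) i ≡.refl ≡.refl

valuation-∤ : ∀ {p n v} → IsValuation p n v → ¬ p ℕ.* p ℕ.^ v ℕ.∣ n
valuation-∤ {v = v} val p^∣n = ℕ.1+n≰n (IsValuation.greatest val (suc v) p^∣n)

enough-≤ : ∀ {a n r s t d f g i j} → f ≤ g → Enough a n r s t d g i j → Enough a n r s t d f i j
enough-≤ f≤g (enough e₀ e₁ e₂ e₃ s₀ s₁ s₂ s₃ bound) =
  enough e₀ e₁ e₂ e₃ s₀ s₁ s₂ s₃ (ℕ.≤-trans f≤g bound)

-- A modulus raises the exponent by one at its own index `d₀`; elsewhere the exponent remains `f`.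
marked : ∀ {a n r s t d} d₀ f → (d₀ ≡ d → Status a n r s t d (1 ℕ.+ f)) →
         (d₀ ≢ d → Status a n r s t d f) → Status a n r s t d (⟦ d₀ ≡ d ⟧ ℕ.+ f)
marked {d = d} d₀ f special generic with d₀ ℕ.≟ d
... | yes ≡.refl rewrite ⟦≡⟧-yes d₀  = special ≡.refl
... | no  d₀≢d   rewrite ⟦≡⟧-no d₀≢d = generic d₀≢d

-- If n were below ch, the difference would be nonzero and at most ch < 4h in absolute value, hence
-- no multiple of 4h.
residue-class : ∀ n h c → c < 4 → .{{NonZero h}} → 4 ℕ.* h ℕ.∣ ℤ.∣ + n ℤ.- + (c ℕ.* h) ∣ →
                ∃ λ y → n ≡ (c ℕ.+ y ℕ.* 4) ℕ.* h
residue-class n h c c<4 4h∣ with ≤-split n (c ℕ.* h)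
... | inj₁ (m , ≡.refl) with ≡.subst (λ k → 4 ℕ.* h ℕ.∣ ℤ.∣ k ∣) (+[n+m]-+n (c ℕ.* h) m) 4h∣
... | ℕ.divides y ≡.refl = y ,
  solve 3 (λ c h y → c :* h :+ y :* (con 4 :* h) := (c :+ y :* con 4) :* h) ≡.refl c h y
  where open +-*-Solver
residue-class n h c c<4 4h∣ | inj₂ (m , ch≡n+m) =
  contradiction (≡.subst (λ k → 4 ℕ.* h ℕ.∣ ℤ.∣ k ∣)
      (≡.trans (≡.cong (λ k → + n ℤ.- + k) ch≡n+m) (+i-+[i+m] n (suc m))) 4h∣)
    (ℕ.>⇒∤ (ℕ.≤-<-trans (≡.subst (suc m ≤_) (≡.sym ch≡n+m) (ℕ.m≤n+m (suc m) n)) (ℕ.*-monoˡ-< h c<4)))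

-- Assembly of the congruences

module Sum
  (n r s t : ℕ) (0<r : 0 < r) (0<s : 0 < s) (0<t : 0 < t)
  where

  -- The upper indices and the indices of all moduli are at most 8n, so one stage of the
  -- factorisation serves every part.
  N : ℕ
  N = 8 ℕ.* n

  open Assembly ℤ[q] q 1-q^-primitive N public
    using (F; Φ; factored-+; factored-single; F∣S; gauss≈F; geometric≈Φ)

  F∣S₆ : ∀ f → (∀ {d} → d < N → Status 2 n r s t d (f d)) → F f ∣ S₆ n r s t
  F∣S₆ f status = B.∣-respʳ-≈ (≈-sym (S₆≈S n r s t))
    (F∣S 1 0<r 0<s 0<t (ℕ.*-monoˡ-≤ n (ℕ.m≤m+n 6 2)) (signed⇒alternating (signedPower-signed n))
      (signed⇒pair (signedPower-signed n)) f status)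

  F∣S₈ : ∀ f → (∀ {d} → d < N → Status 3 n r s t d (f d)) → F f ∣ S₈ n r s t
  F∣S₈ f status = B.∣-respʳ-≈ (≈-sym (S₈≈S n r s t))
    (F∣S 2 0<r 0<s 0<t ℕ.≤-refl (signed⇒alternating (signedPower-signed n))
      (signed⇒pair (signedPower-signed n)) f status)

  qBinomial≈F : ∀ m k l → k ℕ.+ l ≡ m → m ≤ N → qBinomial m (+ k) ≈ F (carry k l)
  qBinomial≈F m k l k+l≡m m≤N = ≈-trans (qBinomial≈gauss m k) (gauss≈F k l k+l≡m m≤N)

  [p]≈F : ∀ {p} → Prime p → ∀ γ {d} → suc d ≡ p ℕ.^ suc γ → d < N →
          [ p ]⟨ q ^ (p ℕ.^ γ) ⟩ ≈ F ⟦ d ≡_⟧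
  [p]≈F {p} p-prime γ d≡ d<N = ≈-trans (GeometricSum.∑≈geometric ℤ[q] p (q ^ (p ℕ.^ γ)))
    (≈-trans (geometric≈Φ p-prime γ d≡ d<N) (≈-sym (factored-single Φ d<N)))

  congruence : ∀ {B M T f g} → B ≈ F f → M ≈ F g → F (λ d → g d ℕ.+ f d) ∣ T → B ⁻¹* T ≡0[mod M ]
  congruence {B} {M} {T} {f} {g} B≈ M≈ (H , H*F≈T) = H ,
    ≈-trans (≈-sym H*F≈T) (≈-trans (*-congˡ H (≈-trans (factored-+ Φ N g f) (*-cong (≈-sym M≈) (≈-sym B≈))))
      (≈-sym (*-assoc H M B)))

2-prime : Prime 2
2-prime = toWitness {a? = prime? 2} tt

3-prime : Prime 3
3-prime = toWitness {a? = prime? 3} tt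

3^≢2* : ∀ k m → 3 ℕ.^ k ≢ 2 ℕ.* m
3^≢2* k m eq with *≡p^⇒≡1⊎p∣ 3-prime k {2} {m} (≡.sym eq)
... | inj₂ 3∣2 = ℕ.>⇒∤ (s≤s (s≤s (s≤s z≤n))) 3∣2

theorem2 : ∀ (n α β r s t : ℕ) → 0 < n →
    IsValuation 2 n α → IsValuation 3 n β →
    0 < r → 0 < s → 0 < t →
    (qBinomial (6 ℕ.* n) (+ n) ⁻¹* S₆ n r s t ≡0[mod [ 2 ]⟨ q ^ (2 ℕ.^ α) ⟩ ])
    ×
    (qBinomial (6 ℕ.* n) (+ (3 ℕ.* n)) ⁻¹* S₆ n r s t ≡0[mod [ 2 ]⟨ q ^ (2 ℕ.^ α) ⟩ * [ 3 ]⟨ q ^ (3 ℕ.^ β) ⟩ ])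
    ×
    ( (2 ≤ t →
    qBinomial (8 ℕ.* n) (+ (3 ℕ.* n)) ⁻¹* S₈ n r s t ≡0[mod [ 2 ]⟨ q ^ (2 ℕ.^ α) ⟩ ])
    ×
    (2 ≤ s ⊎ (2 ≤ r × n ≡ 3 ℕ.* 2 ℕ.^ α [mod 2 ℕ.^ (α ℕ.+ 2) ]) →
    qBinomial (8 ℕ.* n) (+ (3 ℕ.* n)) ⁻¹* S₈ n r s t ≡0[mod [ 2 ]⟨ q ^ (2 ℕ.^ (α ℕ.+ 1)) ⟩ ])
    ×
    (2 ≤ r × n ≡ 2 ℕ.^ α [mod 2 ℕ.^ (α ℕ.+ 2) ] →
    qBinomial (8 ℕ.* n) (+ (3 ℕ.* n)) ⁻¹* S₈ n r s t ≡0[mod [ 2 ]⟨ q ^ (2 ℕ.^ (α ℕ.+ 2)) ⟩ ]))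
theorem2 n α β r s t 0<n val₂ val₃ 0<r 0<s 0<t =
  part₁ , part₂ , part₃-t , part₃-s , part₃-r
  where
  open Sum n r s t 0<r 0<s 0<t

  instance
    n≢0 : NonZero n
    n≢0 = ℕ.>-nonZero 0<n
    2^≢0 : NonZero (2 ℕ.^ α)
    2^≢0 = ℕ.m^n≢0 2 α

  h : ℕ
  h = 2 ℕ.^ α
  h∣n : h ℕ.∣ n
  h∣n = IsValuation.divides val₂
  2h∤n : ¬ 2 ℕ.* h ℕ.∣ n
  2h∤n = valuation-∤ val₂

  4h≡ : 4 ℕ.* h ≡ 2 ℕ.^ (α ℕ.+ 2)
  4h≡ = ≡.trans (≡.sym (ℕ.*-comm h 4)) (≡.sym (ℕ.^-distribˡ-+-* 2 α 2))

  index : ∀ k m → .{{NonZero k}} → .{{NonZero m}} → m ℕ.∣ n → k ≤ 8 → ∃ λ d → suc d ≡ k ℕ.* m × d < N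
  index (suc k) (suc m) m∣n k≤8 = m ℕ.+ k ℕ.* suc m , ≡.refl , ℕ.*-mono-≤ k≤8 (ℕ.∣⇒≤ m∣n)

  6n≤N : 6 ℕ.* n ≤ N
  6n≤N = ℕ.*-monoˡ-≤ n (ℕ.m≤m+n 6 2)

  carry+1≤2 : ∀ k l d → 1 ℕ.+ carry k l d ≤ 2
  carry+1≤2 k l d = s≤s (carry≤1 k l d)

  B₃ : qBinomial (8 ℕ.* n) (+ (3 ℕ.* n)) ≈ F (carry (3 ℕ.* n) (5 ℕ.* n))
  B₃ = qBinomial≈F (8 ℕ.* n) (3 ℕ.* n) (5 ℕ.* n) (≡.sym (ℕ.*-distribʳ-+ n 3 5)) ℕ.≤-refl

  -- The divisor may itself contain the Φ of the modulus, so two factors are asked for at that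
  -- index.
  part₃ : ∀ γ {d} → suc d ≡ 2 ℕ.^ suc γ → d < N →
          (∀ i j → i ℕ.+ j ≡ 2 ℕ.* n → Enough 3 n r s t d 2 i j) →
          qBinomial (8 ℕ.* n) (+ (3 ℕ.* n)) ⁻¹* S₈ n r s t ≡0[mod [ 2 ]⟨ q ^ (2 ℕ.^ γ) ⟩ ]
  part₃ γ {d₀} d₀≡ d₀<N special = congruence B₃ ([p]≈F 2-prime γ d₀≡ d₀<N)
    (F∣S₈ (λ d → ⟦ d₀ ≡ d ⟧ ℕ.+ carry (3 ℕ.* n) (5 ℕ.* n) d) λ {d} _ → marked d₀ (carry (3 ℕ.* n) (5 ℕ.* n) d)
      (λ where ≡.refl → pairs λ i j eq → enough-≤ (carry+1≤2 (3 ℕ.* n) (5 ℕ.* n) d) (special i j eq))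
      (λ _ → generic₈ 0<r 0<s 0<t d (carry≤1 (3 ℕ.* n) (5 ℕ.* n) d) ≡.refl))

  part₁ : qBinomial (6 ℕ.* n) (+ n) ⁻¹* S₆ n r s t ≡0[mod [ 2 ]⟨ q ^ h ⟩ ]
  part₁ with d₀ , d₀≡ , d₀<N ← index 2 h h∣n (s≤s (s≤s z≤n)) = congruence
    (qBinomial≈F (6 ℕ.* n) n (5 ℕ.* n) ≡.refl 6n≤N) ([p]≈F 2-prime α d₀≡ d₀<N)
    (F∣S₆ (λ d → ⟦ d₀ ≡ d ⟧ ℕ.+ carry n (5 ℕ.* n) d) λ {d} _ → marked d₀ (carry n (5 ℕ.* n) d)
      (λ where ≡.refl → pairs λ i j eq → enough-≤ (carry+1≤2 n (5 ℕ.* n) d)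
                 (special₆ 0<r 0<s 0<t h∣n 2h∤n d₀≡ i j eq))
      (λ _ → generic₆ 0<r 0<s 0<t d (carry≤1 n (5 ℕ.* n) d) (inj₁ ≡.refl)))

  part₂ : qBinomial (6 ℕ.* n) (+ (3 ℕ.* n)) ⁻¹* S₆ n r s t
            ≡0[mod [ 2 ]⟨ q ^ h ⟩ * [ 3 ]⟨ q ^ (3 ℕ.^ β) ⟩ ]
  part₂ with IsValuation.divides val₃
  ... | ℕ.divides v n≡v3^
    with index 2 h h∣n (s≤s (s≤s z≤n))
       | index 3 (3 ℕ.^ β) {{_}} {{ℕ.m^n≢0 3 β}} (IsValuation.divides val₃) (s≤s (s≤s (s≤s z≤n)))
  ... | d₂ , d₂≡ , d₂<N | d₃ , d₃≡ , d₃<N = congruence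
    (qBinomial≈F (6 ℕ.* n) (3 ℕ.* n) (3 ℕ.* n) (≡.sym (ℕ.*-distribʳ-+ n 3 3)) 6n≤N)
    (≈-trans (*-cong ([p]≈F 2-prime α d₂≡ d₂<N) ([p]≈F 3-prime β d₃≡ d₃<N))
      (≈-sym (factored-+ Φ N ⟦ d₂ ≡_⟧ ⟦ d₃ ≡_⟧)))
    (F∣S₆ (λ d → ⟦ d₂ ≡ d ⟧ ℕ.+ ⟦ d₃ ≡ d ⟧ ℕ.+ carry (3 ℕ.* n) (3 ℕ.* n) d) λ {d} _ →
      ≡.subst (Status 2 n r s t d) (≡.sym (ℕ.+-assoc ⟦ d₂ ≡ d ⟧ ⟦ d₃ ≡ d ⟧ _))
      (marked d₂ (⟦ d₃ ≡ d ⟧ ℕ.+ carry (3 ℕ.* n) (3 ℕ.* n) d)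
        -- The other modulus has a different index, a power of 3 being odd, so at most 1 + carry ≤ 2
        -- factors are asked for.
        (λ where ≡.refl → pairs λ i j eq → enough-≤
                   (≡.subst (λ k → 1 ℕ.+ (k ℕ.+ carry (3 ℕ.* n) (3 ℕ.* n) d) ≤ 2) (≡.sym (⟦≡⟧-no d₃≢d₂))
                     (carry+1≤2 (3 ℕ.* n) (3 ℕ.* n) d))
                   (special₆ 0<r 0<s 0<t h∣n 2h∤n d₂≡ i j eq))
        (λ _ → marked d₃ (carry (3 ℕ.* n) (3 ℕ.* n) d)
          -- At this index the divisor has no carry because d₃ + 1 divides 3n, so one factor is
          -- enough.
          (λ where ≡.refl → pairs λ i j eq → enough-≤
                     (ℕ.≤-reflexive (≡.cong suc (carry-∣ (3 ℕ.* n) d₃∣3n)))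
                     (special₃ 0<r 0<s 0<t n≡v3^ 3∤v d₃≡ i j eq))
          (λ _ → generic₆ 0<r 0<s 0<t d (carry≤1 (3 ℕ.* n) (3 ℕ.* n) d) (inj₂ ≡.refl)))))
    where
    d₃∣3n : suc d₃ ℕ.∣ 3 ℕ.* n
    d₃∣3n = ≡.subst (ℕ._∣ 3 ℕ.* n) (≡.sym d₃≡) (ℕ.*-monoʳ-∣ 3 (IsValuation.divides val₃))
    d₃≢d₂ : d₃ ≢ d₂
    d₃≢d₂ d₃≡d₂ = 3^≢2* (suc β) h (≡.trans (≡.sym d₃≡) (≡.trans (≡.cong suc d₃≡d₂) d₂≡))
    3∤v : ¬ 3 ℕ.∣ v
    3∤v 3∣v = valuation-∤ val₃ (≡.subst (3 ℕ.* 3 ℕ.^ β ℕ.∣_) (≡.sym n≡v3^) (ℕ.*-monoˡ-∣ (3 ℕ.^ β) 3∣v))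

  part₃-t : 2 ≤ t → qBinomial (8 ℕ.* n) (+ (3 ℕ.* n)) ⁻¹* S₈ n r s t ≡0[mod [ 2 ]⟨ q ^ (2 ℕ.^ α) ⟩ ]
  part₃-t 2≤t with d₀ , d₀≡ , d₀<N ← index 2 h h∣n (s≤s (s≤s z≤n)) =
    part₃ α d₀≡ d₀<N (special₈-t 0<r 0<s 0<t h∣n 2h∤n d₀≡ 2≤t)

  part₃-s : 2 ≤ s ⊎ (2 ≤ r × n ≡ 3 ℕ.* 2 ℕ.^ α [mod 2 ℕ.^ (α ℕ.+ 2) ]) →
            qBinomial (8 ℕ.* n) (+ (3 ℕ.* n)) ⁻¹* S₈ n r s t ≡0[mod [ 2 ]⟨ q ^ (2 ℕ.^ (α ℕ.+ 1)) ⟩ ]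
  part₃-s cases with d₀ , d₀≡ , d₀<N ← index 4 h h∣n (ℕ.m≤m+n 4 4) =
    part₃ (α ℕ.+ 1) (≡.trans d₀≡ (≡.trans 4h≡ (≡.cong (2 ℕ.^_) (ℕ.+-suc α 1)))) d₀<N
      (special₈-s 0<r 0<s 0<t h∣n 2h∤n d₀≡ ([ inj₁ , (λ (2≤r , n≡3h) → inj₂ (2≤r ,
        residue-class n h 3 (s≤s (s≤s (s≤s (s≤s z≤n))))
          (≡.subst (ℕ._∣ ℤ.∣ + n ℤ.- + (3 ℕ.* h) ∣) (≡.sym 4h≡) n≡3h))) ]′ cases))

  part₃-r : 2 ≤ r × n ≡ 2 ℕ.^ α [mod 2 ℕ.^ (α ℕ.+ 2) ] →
            qBinomial (8 ℕ.* n) (+ (3 ℕ.* n)) ⁻¹* S₈ n r s t ≡0[mod [ 2 ]⟨ q ^ (2 ℕ.^ (α ℕ.+ 2)) ⟩ ]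
  part₃-r (2≤r , n≡h)
    with d₀ , d₀≡ , d₀<N ← index 8 h h∣n ℕ.≤-refl
       | y , n≡ ← residue-class n h 1 (s≤s (s≤s z≤n)) (≡.subst₂ (λ m k → m ℕ.∣ ℤ.∣ + n ℤ.- + k ∣)
                    (≡.sym 4h≡) (≡.sym (ℕ.*-identityˡ h)) n≡h)
    = part₃ (α ℕ.+ 2) (≡.trans d₀≡ (≡.trans (ℕ.*-assoc 2 4 h) (≡.cong (2 ℕ.*_) 4h≡))) d₀<N
      (special₈-r 0<r 0<s 0<t h∣n 2h∤n d₀≡ 2≤r y n≡)
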